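{- Let $q$ be an odd prime power and fix integers and coefficients as follows: $m\ge0$ and $c_0,\ldots,c_m\in\mathbb F_q$ with $c_m\neq0$. For each $n$, let $\ell_n$ be an arbitrary $\mathbb F_q$-linear form in the coefficients $f_0,\ldots,f_n$ of a polynomial $f=\sum_{i=0}^n f_it^i$, and for $f\in\mathcal P(n)$ put \[ Q_A(f)=\sum_{j=0}^m c_j\sum_{i=j}^n f_if_{i-j}+\ell_n(f) \] (with $f_n=1$). Then for every $\gamma\in\mathbb F_q$, \[ \#\{f\in\mathcal P(n):Q_A(f)=\gamma\}=\frac{\#\mathcal P(n)}{q}+O_A\bigl(q^{19n/20+o(n)}\bigr) \] as $n\to\infty$ with $q$ and $(c_0,\ldots,c_m)$ fixed, uniformly in the choice of the linear forms $\ell_n$.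
   Context: $\mathbb F_q$ is the finite field with $q$ elements and $\mathcal P(n)$ is the set of monic irreducible polynomials of degree $n$ in $\mathbb F_q[t]$. The symbol $A$ refers to the Laurent polynomial $A(z)=c_0+\frac12\sum_{l=1}^m c_l(z^l+z^{ -l})$ determined by the fixed coefficients; $O_A$ means the implied constant depends only on $q$ and $c_0,\ldots,c_m$. The term $q^{o(n)}$ denotes a factor which, for every $\varepsilon>0$, is at most $q^{\varepsilon n}$ for all sufficiently large $n$. -}

module Defs where

open import Level using (0ℓ)
open import Data.Nat using (ℕ; zero; suc; _+_; _*_; _∸_; _^_; _≤_; _<_; _≟_)
open import Data.Nat.Properties using (<-cmp)
open import Data.Vec using (Vec; lookup)
open import Data.Fin using (Fin; fromℕ<)
open import Data.List using (List; length)
open import Data.List.Membership.Propositional using (_∈_)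
open import Data.List.Relation.Unary.Unique.Propositional using (Unique)
open import Data.Product using (Σ; _×_; _,_)
open import Relation.Binary.PropositionalEquality using (_≡_; _≢_)
open import Relation.Binary.Definitions using (Tri; tri<; tri≈; tri>)
open import Relation.Nullary using (¬_)
open import Algebra.Structures using (IsCommutativeRing)
open import Function.Bundles using (_⇔_)

record FiniteField : Set₁ where
  field
    Carrier : Set
    _+F_ : Carrier → Carrier → Carrier
    _*F_ : Carrier → Carrier → Carrier
    -F_  : Carrier → Carrier
    0F   : Carrier
    1F   : Carrier
    isCommutativeRing : IsCommutativeRing _≡_ _+F_ _*F_ -F_ 0F 1F
    0≢1 : 0F ≢ 1F
    inverse : ∀ x → x ≢ 0F → Σ Carrier (λ y → x *F y ≡ 1F)
    elements : List Carrier
    elements-unique : Unique elements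
    elements-complete : ∀ x → x ∈ elements

  size : ℕ
  size = length elements

module _ (F : FiniteField) where
  open FiniteField F

  sumFrom : ℕ → ℕ → (ℕ → Carrier) → Carrier
  sumFrom a zero    g = 0F
  sumFrom a (suc k) g = g a +F sumFrom (suc a) k g

  sumRange : ℕ → ℕ → (ℕ → Carrier) → Carrier
  sumRange a b g = sumFrom a (suc b ∸ a) g

  -- A monic polynomial of degree n is represented by its lower coefficients
  -- f_0, …, f_{n-1} (a vector of length n); f_n = 1 and f_i = 0 for i > n.
  coeff : {n : ℕ} → Vec Carrier n → ℕ → Carrier
  coeff {n} v i with <-cmp i n
  ... | tri< i<n _ _ = lookup v (fromℕ< i<n)
  ... | tri≈ _ _ _   = 1F
  ... | tri> _ _ _   = 0F

  IsProduct : {a b n : ℕ} → Vec Carrier a → Vec Carrier b → Vec Carrier n → Set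
  IsProduct {a} {b} {n} g h f =
    a + b ≡ n × (∀ k → k ≤ n → coeff f k ≡ sumRange 0 k (λ i → coeff g i *F coeff h (k ∸ i)))

  Irreducible : {n : ℕ} → Vec Carrier n → Set
  Irreducible {n} f = 1 ≤ n ×
    (∀ a b → 1 ≤ a → 1 ≤ b → (g : Vec Carrier a) (h : Vec Carrier b) → ¬ IsProduct g h f)

  QA : (m : ℕ) → Vec Carrier (suc m) → (n : ℕ) → Vec Carrier (suc n) → Vec Carrier n → Carrier
  QA m c n a f =
    sumRange 0 m (λ j → lookupℕ c j *F sumRange j n (λ i → coeff f i *F coeff f (i ∸ j)))
    +F sumRange 0 n (λ i → lookupℕ a i *F coeff f i)
    where
    lookupℕ : {k : ℕ} → Vec Carrier k → ℕ → Carrier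
    lookupℕ {k} v i with <-cmp i k
    ... | tri< i<k _ _ = lookup v (fromℕ< i<k)
    ... | tri≈ _ _ _   = 0F
    ... | tri> _ _ _   = 0F

  Enumerates : {A : Set} → List A → (A → Set) → Set
  Enumerates {A} L P = Unique L × (∀ x → (x ∈ L) ⇔ P x)

-- Write f* for the reversal of f. The quadratic part of Q_A is a linear functional of the palindrome f f*, so for f = g h it depends
-- on g g* and h h* only. Characters are replaced by the integer-valued κ(x) = q·[x = 0] - 1, and D = q·#{Q_A = γ} - #P(n) is the sum of
-- κ(Q_A(f) - γ) over the irreducible f. Vaughan's identity, with both cut-offs at n/5, splits the sum of Λ(f) κ(Q_A(f) - γ) into linear
-- sums with at most 2n/5 in the rough variable and bilinear sums whose factors both have degree at least n/5.
--
-- Linear sums: differencing in the smooth variable k leaves the number of y for which x ↦ [A h h* (x y* + y x*)] vanishes. Such a y is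
-- determined by the low coefficients of A h h* y, so each inner sum is O(q^(n/2)).
--
-- Bilinear sums: two applications of Cauchy-Schwarz lead to the sum of κ over all x, y, u, v of the form [A (x y* + y x*)(u v* + v u*)].
-- All κ-sums of linear forms are nonnegative, so one may pass from the palindromes x y* + y x* to all palindromes, at the cost of the
-- number R(a) of pairs with x y* + y x* = 0. As 2 is invertible this equation is h h* = h′ h′* for h = x + y, h′ = x - y; taking out
-- gcd(h, h′) shows R(a) = O(a² q^a). This saves a factor q^(b/4) for b ≤ a, that is q^(n/20) at b = n/5. The mean squares of the
-- convolution coefficients are bounded by parametrising e k = e′ k′ as e = x y, k = z w, e′ = x z, k′ = y w.

module Submission where

open import Defs
open import Algebra.Bundles using (CommutativeRing)

-- The bilinear sums decide the exponent: a rough variable of degree at most 2n/5 and inner sums of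
-- size q^(n/2) give only q^(9n/10) for the linear ones. To count kernels one has to get rid of A.
-- On palindromes, twice the quadratic functional is the middle coefficient of the product with A₂ =
-- t^m (C(t) + C(1/t)), C = Σ c_j t^j, itself a palindrome. Its constant term is c_m, or 2c_0 if m =
-- 0, hence nonzero, so A₂ is a unit among power series and can be cancelled from the low
-- coefficients. That is why palindromes are treated inside power series, and one reason for q odd
-- and c_m ≠ 0. The estimates arise as bounds for squares and fourth powers. To stay within the
-- integers all of them are turned into one bound for twentieth powers, 20 being the denominator of
-- the exponent; an integer twentieth root serves to add the pieces. The parameter k plays the part
-- of 1/ε: after a 20k-th root the allowed exponent is (19/20 + 1/k)n, and the powers of n + 1
-- coming from divisor-type counts disappear in the 1/k.

-- Ring identities with integer coefficients in any commutative ring.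

module IntegerSolver {c ℓ} (R : CommutativeRing c ℓ) where

  open import Data.Nat as ℕ using (ℕ; zero; suc)
  open import Data.Integer as ℤ using (ℤ; +_; -[1+_]; _⊖_)
  import Data.Nat.Properties as ℕ
  import Data.Integer.Properties as ℤ
  open import Data.Maybe using (Maybe; just; nothing)
  open import Relation.Nullary using (yes; no)
  import Relation.Binary.PropositionalEquality as ≡
  open import Algebra.Solver.Ring.AlmostCommutativeRing using (_-Raw-AlmostCommutative⟶_; fromCommutativeRing)
  open import Algebra.Bundles.Raw using (RawRing)

  open CommutativeRing R
  open import Algebra.Properties.Semiring.Mult semiring using (×-homo-+; ×1-homo-*) renaming (_×_ to _⊗_)
  open import Algebra.Properties.Ring ring using (-0#≈0#; -‿+-comm; -‿involutive; -‿distribˡ-*; -‿distribʳ-*)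
  open import Relation.Binary.Reasoning.Setoid setoid

  -- Normalisation has to compare coefficients. Equality of power series is not decidable, equality
  -- of integers is, so the coefficients are taken from ℤ.
  fromℤ : ℤ → Carrier
  fromℤ (+ n)    = n ⊗ 1#
  fromℤ -[1+ n ] = - (suc n ⊗ 1#)

  private
    cancel : ∀ x y → (1# + x) - (1# + y) ≈ x - y
    cancel x y = begin
      (1# + x) - (1# + y)       ≈⟨ +-cong (+-comm 1# x) (sym (-‿+-comm 1# y)) ⟩
      (x + 1#) + (- 1# + - y)   ≈⟨ +-assoc x 1# _ ⟩
      x + (1# + (- 1# + - y))   ≈⟨ +-congˡ (sym (+-assoc 1# (- 1#) (- y))) ⟩
      x + ((1# - 1#) + - y)     ≈⟨ +-congˡ (+-congʳ (-‿inverseʳ 1#)) ⟩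
      x + (0# + - y)            ≈⟨ +-congˡ (+-identityˡ (- y)) ⟩
      x - y ∎

  fromℤ-⊖ : ∀ m n → fromℤ (m ⊖ n) ≈ m ⊗ 1# - n ⊗ 1#
  fromℤ-⊖ m zero = sym (trans (+-congˡ -0#≈0#) (+-identityʳ _))
  fromℤ-⊖ zero (suc n) = sym (+-identityˡ _)
  fromℤ-⊖ (suc m) (suc n) = begin
    fromℤ (suc m ⊖ suc n) ≡⟨ ≡.cong fromℤ (ℤ.[1+m]⊖[1+n]≡m⊖n m n) ⟩
    fromℤ (m ⊖ n)         ≈⟨ fromℤ-⊖ m n ⟩
    m ⊗ 1# - n ⊗ 1#       ≈⟨ cancel (m ⊗ 1#) (n ⊗ 1#) ⟨
    (suc m ⊗ 1#) - (suc n ⊗ 1#) ∎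

  fromℤ-+ : ∀ i j → fromℤ (i ℤ.+ j) ≈ fromℤ i + fromℤ j
  fromℤ-+ (+ m)    (+ n)    = ×-homo-+ 1# m n
  fromℤ-+ (+ m)    -[1+ n ] = fromℤ-⊖ m (suc n)
  fromℤ-+ -[1+ m ] (+ n)    = trans (fromℤ-⊖ n (suc m)) (+-comm _ _)
  fromℤ-+ -[1+ m ] -[1+ n ] = trans (-‿cong (trans (reflexive (≡.cong (λ k → suc k ⊗ 1#) (≡.sym (ℕ.+-suc m n)))) (×-homo-+ 1# (suc m) (suc n))))
    (sym (-‿+-comm _ _))

  fromℤ-neg : ∀ i → fromℤ (ℤ.- i) ≈ - fromℤ i
  fromℤ-neg (+ zero)  = sym -0#≈0#
  fromℤ-neg (+ suc n) = refl
  fromℤ-neg -[1+ n ]  = sym (-‿involutive _)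

  fromℤ-*⁺ : ∀ m j → fromℤ (+ m ℤ.* j) ≈ fromℤ (+ m) * fromℤ j
  fromℤ-*⁺ m (+ n) = trans (reflexive (≡.cong fromℤ (≡.sym (ℤ.pos-* m n)))) (×1-homo-* m n)
  fromℤ-*⁺ m -[1+ n ] = begin
    fromℤ (+ m ℤ.* -[1+ n ])         ≡⟨ ≡.cong fromℤ (≡.sym (ℤ.neg-distribʳ-* (+ m) (+ suc n))) ⟩
    fromℤ (ℤ.- (+ m ℤ.* + suc n))    ≈⟨ fromℤ-neg (+ m ℤ.* + suc n) ⟩
    - fromℤ (+ m ℤ.* + suc n)        ≈⟨ -‿cong (fromℤ-*⁺ m (+ suc n)) ⟩
    - (fromℤ (+ m) * fromℤ (+ suc n)) ≈⟨ -‿distribʳ-* _ _ ⟩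
    fromℤ (+ m) * fromℤ -[1+ n ] ∎

  fromℤ-* : ∀ i j → fromℤ (i ℤ.* j) ≈ fromℤ i * fromℤ j
  fromℤ-* (+ m) j = fromℤ-*⁺ m j
  fromℤ-* -[1+ m ] j = begin
    fromℤ (-[1+ m ] ℤ.* j)       ≡⟨ ≡.cong fromℤ (≡.sym (ℤ.neg-distribˡ-* (+ suc m) j)) ⟩
    fromℤ (ℤ.- (+ suc m ℤ.* j))  ≈⟨ fromℤ-neg (+ suc m ℤ.* j) ⟩
    - fromℤ (+ suc m ℤ.* j)      ≈⟨ -‿cong (fromℤ-*⁺ (suc m) j) ⟩
    - (fromℤ (+ suc m) * fromℤ j) ≈⟨ -‿distribˡ-* _ _ ⟩
    fromℤ -[1+ m ] * fromℤ j ∎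

  ℤ-rawRing : RawRing _ _
  ℤ-rawRing = CommutativeRing.rawRing ℤ.+-*-commutativeRing

  morphism : ℤ-rawRing -Raw-AlmostCommutative⟶ fromCommutativeRing R
  morphism = record
    { ⟦_⟧ = fromℤ
    ; +-homo = fromℤ-+
    ; *-homo = fromℤ-*
    ; -‿homo = fromℤ-neg
    ; 0-homo = refl
    ; 1-homo = +-identityʳ 1#
    }

  _≟ℤ_ : ∀ i j → Maybe (fromℤ i ≈ fromℤ j)
  i ≟ℤ j with i ℤ.≟ j
  ... | yes eq = just (reflexive (≡.cong fromℤ eq))
  ... | no _   = nothing

  open import Algebra.Solver.Ring ℤ-rawRing (fromCommutativeRing R) morphism _≟ℤ_ public
    using (solve; _:=_; _:+_; _:*_; _:-_; :-_)

-- Arithmetic of exponents and constants.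

module NumericalBounds where

  open import Data.Nat
  open import Data.Nat.Properties
  open import Data.Nat.DivMod using (_/_; _%_; m≡m%n+[m/n]*n; m%n<n; m/n*n≤m)
  open import Data.Nat.Solver using (module +-*-Solver)
  open import Data.Product using (∃; _×_; _,_)
  open import Data.Empty using (⊥-elim)
  open import Relation.Nullary using (yes; no)
  open import Relation.Binary.PropositionalEquality
  open ≤-Reasoning

  ^-distribʳ : ∀ k x y → (x * y) ^ k ≡ x ^ k * y ^ k
  ^-distribʳ zero    x y = refl
  ^-distribʳ (suc k) x y = trans (cong (x * y *_) (^-distribʳ k x y))
    (solve 4 (λ x y u v → (x :* y) :* (u :* v) := (x :* u) :* (y :* v)) refl x y (x ^ k) (y ^ k))
    where open +-*-Solver

  square^ : ∀ x k → (x * x) ^ k ≡ x ^ (2 * k)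
  square^ x k = trans (cong (λ y → (x * y) ^ k) (sym (*-identityʳ x))) (^-*-assoc x 2 k)

  -- Abstract because unfolding N ^ 60 at a successor N is exponential.
  abstract
    bound : ℕ → ℕ → ℕ → ℕ → ℕ
    bound N q m n = N ^ 60 * q ^ (60 + 10 * m + 19 * n)

    bound-unfold : ∀ N q m n → bound N q m n ≡ N ^ 60 * q ^ (60 + 10 * m + 19 * n)
    bound-unfold N q m n = refl

  ^-mono : ∀ {q} → 1 ≤ q → ∀ {i j} → i ≤ j → q ^ i ≤ q ^ j
  ^-mono {q} q≥1 le = ^-monoʳ-≤ q {{>-nonZero q≥1}} le

  -- In the tenth power the rough variable enters as q^(20b), at most q^(8n). With the 10n of the
  -- inner sums this makes 18n, below the 19n available.
  typeI-power : ∀ {N q} → 1 ≤ N → 1 ≤ q → ∀ m n b {x} → 5 * b ≤ 2 * n →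
    x * x ≤ (q ^ b * (N * N)) * (q ^ b * q ^ (2 + m + n)) → x ^ 20 ≤ bound N q m n
  typeI-power {N} {q} N≥1 q≥1 m n b {x} 5b≤2n le = begin
    x ^ 20
      ≡⟨ square^ x 10 ⟨
    (x * x) ^ 10
      ≤⟨ ^-monoˡ-≤ 10 le ⟩
    ((q ^ b * (N * N)) * (q ^ b * q ^ (2 + m + n))) ^ 10
      ≡⟨ cong (_^ 10) (trans (solve 3 (λ u N v → (u :* (N :* N)) :* (u :* v) := (N :* N) :* (u :* (u :* v))) refl (q ^ b) (N) (q ^ (2 + m + n)))
           (cong (N * N *_) (trans (cong (q ^ b *_) (sym (^-distribˡ-+-* q b (2 + m + n)))) (sym (^-distribˡ-+-* q b (b + (2 + m + n))))))) ⟩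
    ((N * N) * q ^ e) ^ 10
      ≡⟨ trans (^-distribʳ 10 (N * N) (q ^ e)) (cong₂ _*_ (square^ (N) 10) (^-*-assoc q e 10)) ⟩
    N ^ 20 * q ^ (e * 10)
      ≤⟨ *-mono-≤ (^-mono N≥1 (m≤n+m 20 40)) (^-mono q≥1 exponent) ⟩
    N ^ 60 * q ^ (60 + 10 * m + 19 * n)
      ≡⟨ bound-unfold N q m n ⟨
    bound N q m n ∎
    where
    open +-*-Solver
    e = b + (b + (2 + m + n))
    exponent : e * 10 ≤ 60 + 10 * m + 19 * n
    exponent = begin
      e * 10
        ≡⟨ solve 3 (λ b m n → (b :+ (b :+ (con 2 :+ m :+ n))) :* con 10 := con 4 :* (con 5 :* b) :+ (con 20 :+ con 10 :* m :+ con 10 :* n)) refl b m n ⟩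
      4 * (5 * b) + (20 + 10 * m + 10 * n)
        ≤⟨ +-monoˡ-≤ (20 + 10 * m + 10 * n) (*-monoʳ-≤ 4 5b≤2n) ⟩
      4 * (2 * n) + (20 + 10 * m + 10 * n)
        ≤⟨ m≤m+n _ (40 + n) ⟩
      4 * (2 * n) + (20 + 10 * m + 10 * n) + (40 + n)
        ≡⟨ solve 2 (λ m n → con 4 :* (con 2 :* n) :+ (con 20 :+ con 10 :* m :+ con 10 :* n) :+ (con 40 :+ n) := con 60 :+ con 10 :* m :+ con 19 :* n) refl m n ⟩
      60 + 10 * m + 19 * n ∎

  -- The fifth power turns the saving q^s into q^(5s), at least q^n, which is cancelled from
  -- q^(20n). The 60 and 10m of `bound` dominate the 55 and 5m arising here as well as the 20 and
  -- 10m of the linear sums.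
  typeII-power : ∀ {N q} → 1 ≤ q → ∀ m n s {x} → n ≤ 5 * s →
    (x * x) * (x * x) * q ^ s ≤ N ^ 12 * q ^ (11 + m + 4 * n) → x ^ 20 ≤ bound N q m n
  typeII-power {N} {q} q≥1 m n s {x} n≤5s le = *-cancelʳ-≤ (x ^ 20) (bound N q m n) (q ^ n) {{m^n≢0 q n {{>-nonZero q≥1}}}} (begin
    x ^ 20 * q ^ n
      ≤⟨ *-monoʳ-≤ (x ^ 20) (^-mono q≥1 n≤5s) ⟩
    x ^ 20 * q ^ (5 * s)
      ≡⟨ cong₂ _*_ (trans (sym (square^ x 10)) (sym (square^ (x * x) 5))) (trans (cong (q ^_) (*-comm 5 s)) (sym (^-*-assoc q s 5))) ⟩
    ((x * x) * (x * x)) ^ 5 * (q ^ s) ^ 5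
      ≡⟨ ^-distribʳ 5 ((x * x) * (x * x)) (q ^ s) ⟨
    ((x * x) * (x * x) * q ^ s) ^ 5
      ≤⟨ ^-monoˡ-≤ 5 le ⟩
    (N ^ 12 * q ^ (11 + m + 4 * n)) ^ 5
      ≡⟨ trans (^-distribʳ 5 (N ^ 12) (q ^ (11 + m + 4 * n))) (cong₂ _*_ (^-*-assoc (N) 12 5) (^-*-assoc q (11 + m + 4 * n) 5)) ⟩
    N ^ 60 * q ^ ((11 + m + 4 * n) * 5)
      ≤⟨ *-monoʳ-≤ (N ^ 60) (^-mono q≥1 exponent) ⟩
    N ^ 60 * q ^ ((60 + 10 * m + 19 * n) + n)
      ≡⟨ trans (cong (N ^ 60 *_) (^-distribˡ-+-* q (60 + 10 * m + 19 * n) n)) (sym (*-assoc (N ^ 60) _ (q ^ n))) ⟩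
    N ^ 60 * q ^ (60 + 10 * m + 19 * n) * q ^ n
      ≡⟨ cong (_* q ^ n) (bound-unfold N q m n) ⟨
    bound N q m n * q ^ n ∎)
    where
    open +-*-Solver
    exponent : (11 + m + 4 * n) * 5 ≤ (60 + 10 * m + 19 * n) + n
    exponent = begin
      (11 + m + 4 * n) * 5
        ≤⟨ m≤m+n _ (5 + 5 * m) ⟩
      (11 + m + 4 * n) * 5 + (5 + 5 * m)
        ≡⟨ solve 2 (λ m n → (con 11 :+ m :+ con 4 :* n) :* con 5 :+ (con 5 :+ con 5 :* m) := (con 60 :+ con 10 :* m :+ con 19 :* n) :+ n) refl m n ⟩
      (60 + 10 * m + 19 * n) + n ∎

  half-power : ∀ {N q} → 1 ≤ N → 1 ≤ q → ∀ m n → (q ^ (n / 2)) ^ 20 ≤ bound N q m n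
  half-power {N} {q} N≥1 q≥1 m n = begin
    (q ^ (n / 2)) ^ 20      ≡⟨ ^-*-assoc q (n / 2) 20 ⟩
    q ^ (n / 2 * 20)        ≤⟨ ^-mono q≥1 exponent ⟩
    q ^ (60 + 10 * m + 19 * n) ≤⟨ m≤n*m _ (N ^ 60) {{m^n≢0 N 60 {{>-nonZero N≥1}}}} ⟩
    N ^ 60 * q ^ (60 + 10 * m + 19 * n) ≡⟨ bound-unfold N q m n ⟨
    bound N q m n ∎
    where
    exponent : n / 2 * 20 ≤ 60 + 10 * m + 19 * n
    exponent = begin
      n / 2 * 20            ≡⟨ *-assoc (n / 2) 2 10 ⟨
      n / 2 * 2 * 10        ≤⟨ *-monoˡ-≤ 10 (m/n*n≤m n 2) ⟩
      n * 10                ≡⟨ *-comm n 10 ⟩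
      10 * n                ≤⟨ *-monoˡ-≤ n (m≤m+n 10 9) ⟩
      19 * n                ≤⟨ m≤n+m (19 * n) (60 + 10 * m) ⟩
      60 + 10 * m + 19 * n ∎

  -- The factors are, in order, the bounds for the squares of `∥α∥`, of the q in the first use of
  -- `κ-square` and of `∥β∥`, then the q of the second use, `R b`, `R a` and `G₀`. Their exponents
  -- add up to 11 + m + 4a + 3b; the b missing from 4(a + b) is the saving.
  bilinear-constants : ∀ {q} → 1 ≤ q → ∀ N m a b s → s ≤ b → let Na = N * N * q ^ a ; Nb = N * N * q ^ b in
    (Na * Na) * ((q * q) * ((Nb * Nb) * (q * ((N * N * q ^ (3 + b)) * ((N * N * q ^ (3 + a)) * ((q ^ suc a * q) * q ^ m)))))) * q ^ s
    ≤ N ^ 12 * q ^ (11 + m + 4 * (a + b))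
  bilinear-constants {q} q≥1 N m a b s s≤b = begin
    _ ≡⟨ cong (_* q ^ s) (solve 5 (λ N u v w q →
           ((N :* N :* u) :* (N :* N :* u)) :* ((q :* q) :* (((N :* N :* v) :* (N :* N :* v)) :* (q :* ((N :* N :* (q :* (q :* (q :* v)))) :*
             ((N :* N :* (q :* (q :* (q :* u)))) :* (((q :* u) :* q) :* w)))))) :=
           (N :^ 12) :* ((q :^ 11) :* (w :* ((u :^ 4) :* (v :^ 3))))) refl N (q ^ a) (q ^ b) (q ^ m) q) ⟩
    N ^ 12 * (q ^ 11 * (q ^ m * ((q ^ a) ^ 4 * (q ^ b) ^ 3))) * q ^ s
      ≡⟨ trans (*-assoc (N ^ 12) _ (q ^ s)) (cong (N ^ 12 *_) (begin-equality
           q ^ 11 * (q ^ m * ((q ^ a) ^ 4 * (q ^ b) ^ 3)) * q ^ s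
             ≡⟨ cong (_* q ^ s) (cong (q ^ 11 *_) (trans (cong (q ^ m *_) (trans (cong₂ _*_ (^-*-assoc q a 4) (^-*-assoc q b 3))
                  (sym (^-distribˡ-+-* q (a * 4) (b * 3))))) (sym (^-distribˡ-+-* q m (a * 4 + b * 3))))) ⟩
           q ^ 11 * q ^ (m + (a * 4 + b * 3)) * q ^ s
             ≡⟨ trans (cong (_* q ^ s) (sym (^-distribˡ-+-* q 11 (m + (a * 4 + b * 3))))) (sym (^-distribˡ-+-* q (11 + (m + (a * 4 + b * 3))) s)) ⟩
           q ^ (11 + (m + (a * 4 + b * 3)) + s) ∎)) ⟩
    N ^ 12 * q ^ (11 + (m + (a * 4 + b * 3)) + s)
      ≤⟨ *-monoʳ-≤ (N ^ 12) (^-mono q≥1 (≤-trans (+-monoʳ-≤ (11 + (m + (a * 4 + b * 3))) s≤b)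
           (≤-reflexive (solve 3 (λ m a b → con 11 :+ (m :+ (a :* con 4 :+ b :* con 3)) :+ b := con 11 :+ m :+ con 4 :* (a :+ b)) refl m a b)))) ⟩
    N ^ 12 * q ^ (11 + m + 4 * (a + b)) ∎
    where open +-*-Solver

  -- Bounds for twentieth powers cannot be added, bounds for sizes can: each estimate passes to the
  -- largest admissible ρ, the sum is formed there and raised to the power again.
  root : ∀ k B → ∃ λ ρ → ρ ^ suc k ≤ B × (∀ x → x ^ suc k ≤ B → x ≤ ρ)
  root k zero = 0 , z≤n , λ where
    zero    _  → z≤n
    (suc x) le → ⊥-elim (<-irrefl refl (≤-trans (≤-trans (s≤s z≤n) (m≤m*n (suc x) (suc x ^ k) {{m^n≢0 (suc x) k}})) le))
  root k (suc B) with root k B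
  ... | ρ , le , largest with suc ρ ^ suc k ≤? suc B
  ... | no nle = ρ , m≤n⇒m≤1+n le , λ x xle → ≮⇒≥ (λ ρ<x → nle (≤-trans (^-monoˡ-≤ (suc k) ρ<x) xle))
  -- If some x > ρ + 1 fitted as well, the power of ρ + 1 would be at most B, against the maximality
  -- of ρ.
  ... | yes fits = suc ρ , fits , λ x xle → ≮⇒≥ (λ ρ<x → <-irrefl refl (≤-trans (s≤s (largest (suc ρ) (s≤s⁻¹ (begin-strict
      suc ρ ^ suc k  <⟨ ^-monoˡ-< (suc k) ρ<x ⟩
      x ^ suc k      ≤⟨ xle ⟩
      suc B ∎)))) ≤-refl))

  n<2^n : ∀ n → suc n ≤ 2 ^ n
  n<2^n zero    = ≤-refl
  n<2^n (suc n) = begin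
    suc (suc n)      ≤⟨ +-mono-≤ (m^n>0 2 n) (n<2^n n) ⟩
    2 ^ n + 2 ^ n    ≡⟨ cong (2 ^ n +_) (+-identityʳ (2 ^ n)) ⟨
    2 ^ suc n ∎

  -- Apply n < 2ⁿ to the quotient of n by K.
  power≤exponential : ∀ K .{{_ : NonZero K}} n → suc n ^ K ≤ K ^ K * 2 ^ n
  power≤exponential K n = begin
    suc n ^ K                   ≤⟨ ^-monoˡ-≤ K small ⟩
    (K * 2 ^ (n / K)) ^ K       ≡⟨ ^-distribʳ K K (2 ^ (n / K)) ⟩
    K ^ K * (2 ^ (n / K)) ^ K   ≡⟨ cong (K ^ K *_) (^-*-assoc 2 (n / K) K) ⟩
    K ^ K * 2 ^ (n / K * K)     ≤⟨ *-monoʳ-≤ (K ^ K) (^-monoʳ-≤ 2 (m/n*n≤m n K)) ⟩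
    K ^ K * 2 ^ n ∎
    where
    small : suc n ≤ K * 2 ^ (n / K)
    small = begin
      suc n                       ≡⟨ cong suc (m≡m%n+[m/n]*n n K) ⟩
      suc (n % K) + n / K * K     ≤⟨ +-monoˡ-≤ (n / K * K) (m%n<n n K) ⟩
      K + n / K * K               ≡⟨ *-comm (suc (n / K)) K ⟩
      K * suc (n / K)             ≤⟨ *-monoʳ-≤ K (n<2^n (n / K)) ⟩
      K * 2 ^ (n / K) ∎

  final-constant : ℕ → ℕ → ℕ → ℕ
  final-constant q m k = ((4 * q) ^ 20 * q ^ (60 + 10 * m)) ^ k * (120 * k) ^ (120 * k)

  -- The factor N^120, 60 from `bound` and 60 from the twentieth power of N³, becomes N^(120k), a
  -- constant times 2^n at most. As 2 ≤ q this costs one n in the exponent, within the 20n that 1/k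
  -- provides.
  final-power : ∀ {N q x} → 2 ≤ q → ∀ m n k → N ^ (120 * k) ≤ (120 * k) ^ (120 * k) * 2 ^ n →
    x ^ 20 ≤ (4 * q * N ^ 3) ^ 20 * bound N q m n →
    x ^ (20 * k) ≤ final-constant q m k * q ^ (20 * k) * q ^ ((19 * k + 20) * n)
  final-power {N} {q} {x} q≥2 m n k N≤ le = begin
    x ^ (20 * k)
      ≡⟨ ^-*-assoc x 20 k ⟨
    (x ^ 20) ^ k
      ≤⟨ ^-monoˡ-≤ k le ⟩
    ((4 * q * N ^ 3) ^ 20 * bound N q m n) ^ k
      ≡⟨ cong (_^ k) collect ⟩
    (A * (N ^ 120 * q ^ (19 * n))) ^ k
      ≡⟨ trans (^-distribʳ k A _) (cong (A ^ k *_) (trans (^-distribʳ k (N ^ 120) (q ^ (19 * n))) (cong₂ _*_ (^-*-assoc N 120 k) (^-*-assoc q (19 * n) k)))) ⟩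
    A ^ k * (N ^ (120 * k) * q ^ (19 * n * k))
      ≤⟨ *-monoʳ-≤ (A ^ k) (*-monoˡ-≤ (q ^ (19 * n * k)) (≤-trans N≤ (*-monoʳ-≤ ((120 * k) ^ (120 * k)) (^-monoˡ-≤ n q≥2)))) ⟩
    A ^ k * ((120 * k) ^ (120 * k) * q ^ n * q ^ (19 * n * k))
      ≡⟨ trans (cong (A ^ k *_) (*-assoc ((120 * k) ^ (120 * k)) (q ^ n) (q ^ (19 * n * k)))) (trans (sym (*-assoc (A ^ k) ((120 * k) ^ (120 * k)) _))
           (cong (final-constant q m k *_) (sym (^-distribˡ-+-* q n (19 * n * k))))) ⟩
    final-constant q m k * q ^ (n + 19 * n * k)
      -- The factor q^(20k) belongs to the final statement, where the discrepancy is multiplied by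
      -- q; here it only has to be at least 1.
      ≤⟨ *-mono-≤ (m≤m*n (final-constant q m k) (q ^ (20 * k)) {{m^n≢0 q (20 * k) {{>-nonZero q≥1}}}}) (^-mono q≥1 exponent) ⟩
    final-constant q m k * q ^ (20 * k) * q ^ ((19 * k + 20) * n) ∎
    where
    open +-*-Solver
    q≥1 : 1 ≤ q
    q≥1 = ≤-trans (s≤s z≤n) q≥2
    A = (4 * q) ^ 20 * q ^ (60 + 10 * m)
    collect : (4 * q * N ^ 3) ^ 20 * bound N q m n ≡ A * (N ^ 120 * q ^ (19 * n))
    collect = trans (cong₂ _*_ (trans (^-distribʳ 20 (4 * q) (N ^ 3)) (cong ((4 * q) ^ 20 *_) (^-*-assoc N 3 20)))
        (trans (bound-unfold N q m n) (cong (N ^ 60 *_) (^-distribˡ-+-* q (60 + 10 * m) (19 * n)))))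
      (trans (solve 4 (λ a u v w → (a :* u) :* (u :* (v :* w)) := (a :* v) :* ((u :* u) :* w)) refl ((4 * q) ^ 20) (N ^ 60) (q ^ (60 + 10 * m)) (q ^ (19 * n)))
        (cong (λ s → A * (s * q ^ (19 * n))) (sym (^-distribˡ-+-* N 60 60))))
    exponent : n + 19 * n * k ≤ (19 * k + 20) * n
    exponent = begin
      n + 19 * n * k             ≤⟨ m≤m+n _ (19 * n) ⟩
      n + 19 * n * k + 19 * n    ≡⟨ solve 2 (λ n k → n :+ con 19 :* n :* k :+ con 19 :* n := (con 19 :* k :+ con 20) :* n) refl n k ⟩
      (19 * k + 20) * n ∎

open import Data.Nat as ℕ using (ℕ; zero; suc; _∸_; _<_; z≤n; s≤s)
open import Data.Integer as ℤ using (ℤ; +_; 0ℤ; 1ℤ; +≤+; _⊖_)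
open import Data.Vec using (Vec; lookup; last)
open import Data.List as List using (List; _++_; map; length; cartesianProductWith; cartesianProduct; upTo; downFrom; filter)
open import Data.List.Membership.Propositional using (_∈_; lose; _∉_)
open import Data.List.Membership.Propositional.Properties using (∈-cartesianProductWith⁺; ∈-cartesianProduct⁺; ∈-upTo⁺; ∈-map⁺; ∈-map⁻; ∈-++⁺ˡ; ∈-++⁺ʳ; ∈-++⁻; ∈-filter⁺; ∈-filter⁻; ∈-downFrom⁺; ∈-downFrom⁻; ∈-cartesianProduct⁻)
open import Data.List.Relation.Unary.Any as Any using (here; there; any?; satisfied)
open import Data.List.Relation.Unary.All as All using (All; all?)
open import Data.List.Relation.Unary.Unique.Propositional using (Unique)
open import Data.Product using (Σ; _×_; _,_; proj₁; proj₂; ∃)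
open import Data.Sum using (_⊎_; inj₁; inj₂)
open import Data.Empty using (⊥-elim; ⊥)
open import Relation.Nullary using (¬_; Dec; yes; no; ¬?; _×-dec_; _⊎-dec_; _→-dec_)
open import Relation.Nullary.Decidable using (map′)
open import Relation.Binary.PropositionalEquality hiding (J)
open import Relation.Binary.Definitions using (tri<; tri≈; tri>)
import Data.Nat.Properties as ℕ
import Data.Integer.Properties as ℤ
import Data.List.Properties as List
import Data.List.Relation.Unary.Unique.Propositional.Properties as Unique
import Data.Product.Properties as Product

-- Finite sums of integers over lists, counting, Cauchy-Schwarz.

module FiniteSums where

  open import Data.Integer using (-[1+_]; _+_; _*_; -_; _-_; ∣_∣; _≤_; nonNegative)
  open import Data.Integer.Properties
  open import Data.Integer.Solver using (module +-*-Solver)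
  open import Data.List using ([]; _∷_)
  open import Data.List.Properties using (length-++; length-map)
  open import Data.List.Relation.Unary.All using ([]; _∷_)
  open import Data.List.Relation.Unary.AllPairs using ([]; _∷_)

  private
    variable
      A B C : Set

  +-congʳ : ∀ a {b c : ℤ} → b ≡ c → a + b ≡ a + c
  +-congʳ a refl = refl

  *-congʳ : ∀ a {b c : ℤ} → b ≡ c → a * b ≡ a * c
  *-congʳ a refl = refl

  *-mono-nonneg : ∀ {c a b} → 0ℤ ≤ c → a ≤ b → c * a ≤ c * b
  *-mono-nonneg {c} 0≤c a≤b = *-monoˡ-≤-nonNeg c {{nonNegative 0≤c}} a≤b

  *-nonneg : ∀ {a b} → 0ℤ ≤ a → 0ℤ ≤ b → 0ℤ ≤ a * b
  *-nonneg {a} {b} 0≤a 0≤b = subst (_≤ a * b) (*-zeroʳ a) (*-mono-nonneg 0≤a 0≤b)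

  *-mono₂-nonneg : ∀ {a b c d} → 0ℤ ≤ c → 0ℤ ≤ b → a ≤ b → c ≤ d → a * c ≤ b * d
  *-mono₂-nonneg {a} {b} {c} {d} 0≤c 0≤b a≤b c≤d = ≤-trans
    (subst₂ _≤_ (*-comm c a) (*-comm c b) (*-mono-nonneg 0≤c a≤b)) (*-mono-nonneg 0≤b c≤d)

  square-nonneg : ∀ x → 0ℤ ≤ x * x
  square-nonneg (+ n) = *-nonneg {+ n} {+ n} (+≤+ ℕ.z≤n) (+≤+ ℕ.z≤n)
  square-nonneg -[1+ n ] = +≤+ ℕ.z≤n

  square-mono : ∀ {a b} → 0ℤ ≤ a → a ≤ b → a * a ≤ b * b
  square-mono 0≤a a≤b = *-mono₂-nonneg 0≤a (≤-trans 0≤a a≤b) a≤b a≤b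

  pos-nonneg : ∀ n → 0ℤ ≤ + n
  pos-nonneg n = +≤+ ℕ.z≤n

  𝟙 : {P : Set} → Dec P → ℤ
  𝟙 (yes _) = 1ℤ
  𝟙 (no _)  = 0ℤ

  𝟙-yes : {P : Set} (d : Dec P) → P → 𝟙 d ≡ 1ℤ
  𝟙-yes (yes _) p = refl
  𝟙-yes (no ¬p) p = ⊥-elim (¬p p)

  𝟙-no : {P : Set} (d : Dec P) → ¬ P → 𝟙 d ≡ 0ℤ
  𝟙-no (yes p) ¬p = ⊥-elim (¬p p)
  𝟙-no (no _)  ¬p = refl

  𝟙-nonneg : {P : Set} (d : Dec P) → 0ℤ ≤ 𝟙 d
  𝟙-nonneg (yes _) = +≤+ ℕ.z≤n
  𝟙-nonneg (no _)  = ≤-refl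

  𝟙≤1 : {P : Set} (d : Dec P) → 𝟙 d ≤ 1ℤ
  𝟙≤1 (yes _) = ≤-refl
  𝟙≤1 (no _)  = +≤+ ℕ.z≤n

  𝟙-⇔ : {P Q : Set} (d : Dec P) (e : Dec Q) → (P → Q) → (Q → P) → 𝟙 d ≡ 𝟙 e
  𝟙-⇔ (yes p) e f g = sym (𝟙-yes e (f p))
  𝟙-⇔ (no ¬p) e f g = sym (𝟙-no e (λ q → ¬p (g q)))

  𝟙-mono : {P Q : Set} (d : Dec P) (e : Dec Q) → (P → Q) → 𝟙 d ≤ 𝟙 e
  𝟙-mono (yes p) e f = ≤-reflexive (sym (𝟙-yes e (f p)))
  𝟙-mono (no ¬p) e f = 𝟙-nonneg e

  Sum : List A → (A → ℤ) → ℤ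
  Sum []       f = 0ℤ
  Sum (x ∷ xs) f = f x + Sum xs f

  Sum-cong∈ : (L : List A) {f g : A → ℤ} → (∀ {x} → x ∈ L → f x ≡ g x) → Sum L f ≡ Sum L g
  Sum-cong∈ []      eq = refl
  Sum-cong∈ (x ∷ L) eq = cong₂ _+_ (eq (here refl)) (Sum-cong∈ L (λ i → eq (there i)))

  Sum-cong : (L : List A) {f g : A → ℤ} → (∀ x → f x ≡ g x) → Sum L f ≡ Sum L g
  Sum-cong L eq = Sum-cong∈ L (λ {x} _ → eq x)

  Sum-mono∈ : (L : List A) {f g : A → ℤ} → (∀ {x} → x ∈ L → f x ≤ g x) → Sum L f ≤ Sum L g
  Sum-mono∈ []      le = ≤-refl
  Sum-mono∈ (x ∷ L) le = +-mono-≤ (le (here refl)) (Sum-mono∈ L (λ i → le (there i)))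

  Sum-mono : (L : List A) {f g : A → ℤ} → (∀ x → f x ≤ g x) → Sum L f ≤ Sum L g
  Sum-mono L le = Sum-mono∈ L (λ {x} _ → le x)

  Sum-zero : (L : List A) → Sum L (λ _ → 0ℤ) ≡ 0ℤ
  Sum-zero []      = refl
  Sum-zero (x ∷ L) = trans (+-identityˡ _) (Sum-zero L)

  Sum-nonneg : (L : List A) {f : A → ℤ} → (∀ x → 0ℤ ≤ f x) → 0ℤ ≤ Sum L f
  Sum-nonneg L nn = ≤-trans (≤-reflexive (sym (Sum-zero L))) (Sum-mono L nn)

  Sum-const : (L : List A) (c : ℤ) → Sum L (λ _ → c) ≡ + length L * c
  Sum-const []      c = sym (*-zeroˡ c)
  Sum-const (x ∷ L) c = trans (+-congʳ c (Sum-const L c)) (sym (suc-* (+ length L) c))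

  Sum-+ : (L : List A) (f g : A → ℤ) → Sum L (λ x → f x + g x) ≡ Sum L f + Sum L g
  Sum-+ []      f g = refl
  Sum-+ (x ∷ L) f g = trans (+-congʳ (f x + g x) (Sum-+ L f g))
    (solve 4 (λ a b c d → (a :+ b) :+ (c :+ d) := (a :+ c) :+ (b :+ d)) refl (f x) (g x) (Sum L f) (Sum L g))
    where open +-*-Solver

  Sum-*ˡ : (L : List A) (c : ℤ) (f : A → ℤ) → Sum L (λ x → c * f x) ≡ c * Sum L f
  Sum-*ˡ []      c f = sym (*-zeroʳ c)
  Sum-*ˡ (x ∷ L) c f = trans (+-congʳ (c * f x) (Sum-*ˡ L c f)) (sym (*-distribˡ-+ c (f x) (Sum L f)))

  Sum-*ʳ : (L : List A) (c : ℤ) (f : A → ℤ) → Sum L (λ x → f x * c) ≡ Sum L f * c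
  Sum-*ʳ L c f = trans (Sum-cong L (λ x → *-comm (f x) c)) (trans (Sum-*ˡ L c f) (*-comm c _))

  Sum-neg : (L : List A) (f : A → ℤ) → Sum L (λ x → - f x) ≡ - Sum L f
  Sum-neg []      f = refl
  Sum-neg (x ∷ L) f = trans (+-congʳ (- f x) (Sum-neg L f)) (sym (neg-distrib-+ (f x) (Sum L f)))

  Sum-minus : (L : List A) (f g : A → ℤ) → Sum L (λ x → f x - g x) ≡ Sum L f - Sum L g
  Sum-minus L f g = trans (Sum-+ L f (λ x → - g x)) (+-congʳ (Sum L f) (Sum-neg L g))

  Sum-swap : (L : List A) (M : List B) (f : A → B → ℤ) →
    Sum L (λ x → Sum M (λ y → f x y)) ≡ Sum M (λ y → Sum L (λ x → f x y))
  Sum-swap []      M f = sym (Sum-zero M)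
  Sum-swap (x ∷ L) M f = trans (+-congʳ (Sum M (f x)) (Sum-swap L M f)) (sym (Sum-+ M (f x) (λ y → Sum L (λ x → f x y))))

  Sum-product : (L : List A) (M : List B) (f : A → ℤ) (g : B → ℤ) →
    Sum L (λ x → Sum M (λ y → f x * g y)) ≡ Sum L f * Sum M g
  Sum-product L M f g = trans (Sum-cong L (λ x → Sum-*ˡ M (f x) g)) (Sum-*ʳ L (Sum M g) f)

  Sum-++ : (L M : List A) (f : A → ℤ) → Sum (L ++ M) f ≡ Sum L f + Sum M f
  Sum-++ []      M f = sym (+-identityˡ _)
  Sum-++ (x ∷ L) M f = trans (+-congʳ (f x) (Sum-++ L M f)) (sym (+-assoc (f x) _ _))

  Sum-map : (h : A → B) (L : List A) (f : B → ℤ) → Sum (map h L) f ≡ Sum L (λ x → f (h x))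
  Sum-map h []      f = refl
  Sum-map h (x ∷ L) f = +-congʳ (f (h x)) (Sum-map h L f)

  Sum-cartesian : (h : A → B → C) (L : List A) (M : List B) (f : C → ℤ) →
    Sum (cartesianProductWith h L M) f ≡ Sum L (λ x → Sum M (λ y → f (h x y)))
  Sum-cartesian h []      M f = refl
  Sum-cartesian h (x ∷ L) M f = trans (Sum-++ (map (h x) M) _ f)
    (cong₂ _+_ (Sum-map (h x) M f) (Sum-cartesian h L M f))

  Sum-abs : (L : List A) (f : A → ℤ) → + ∣ Sum L f ∣ ≤ Sum L (λ x → + ∣ f x ∣)
  Sum-abs []      f = ≤-refl
  Sum-abs (x ∷ L) f = ≤-trans (+≤+ (∣i+j∣≤∣i∣+∣j∣ (f x) (Sum L f)))
    (+-monoʳ-≤ (+ ∣ f x ∣) (Sum-abs L f))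

  term≤Sum : (L : List A) {f : A → ℤ} → (∀ x → 0ℤ ≤ f x) → ∀ {y} → y ∈ L → f y ≤ Sum L f
  term≤Sum (x ∷ L) {f} nn (here refl) = ≤-trans (≤-reflexive (sym (+-identityʳ (f x)))) (+-monoʳ-≤ (f x) (Sum-nonneg L nn))
  term≤Sum (x ∷ L) {f} nn (there i)   = subst (_≤ f x + Sum L f) (+-identityˡ _) (+-mono-≤ (nn x) (term≤Sum L nn i))

  Sum-single : (L : List A) → Unique L → {f : A → ℤ} → ∀ {y} → y ∈ L → (∀ x → x ≢ y → f x ≡ 0ℤ) → Sum L f ≡ f y
  Sum-single (x ∷ L) (x∉ ∷ u) {f} (here refl) z =
    trans (+-congʳ (f x) (trans (Sum-cong∈ L (λ i → z _ (λ e → All.lookup x∉ i (sym e)))) (Sum-zero L))) (+-identityʳ (f x))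
  Sum-single (x ∷ L) (x∉ ∷ u) {f} (there i) z =
    trans (cong₂ _+_ (z x (All.lookup x∉ i)) (Sum-single L u i z)) (+-identityˡ _)

  Sum-𝟙≤1 : (L : List A) → Unique L → {P : A → Set} (P? : ∀ x → Dec (P x)) →
    (∀ {x y} → P x → P y → x ≡ y) → Sum L (λ x → 𝟙 (P? x)) ≤ 1ℤ
  Sum-𝟙≤1 []      u P? at-most-one = +≤+ ℕ.z≤n
  Sum-𝟙≤1 (x ∷ L) (x∉ ∷ u) P? at-most-one with P? x
  ... | no _  = subst (_≤ 1ℤ) (sym (+-identityˡ _)) (Sum-𝟙≤1 L u P? at-most-one)
  ... | yes p = ≤-reflexive (+-congʳ 1ℤ
    (trans (Sum-cong∈ L (λ {y} i → 𝟙-no (P? y) (λ py → All.lookup x∉ i (at-most-one p py)))) (Sum-zero L)))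

  -- Counting by parametrisation: every solution is some `ψ i k`, so the number of parameters is an
  -- upper bound. Solutions hit several times do no harm.
  Sum-cover : {I : Set} (L : List A) → Unique L → {P : A → Set} (P? : ∀ x → Dec (P x)) →
    (≟A : (x y : A) → Dec (x ≡ y)) (J : List I) (K : I → Set) (M : (i : I) → List (K i)) (ψ : (i : I) → K i → A) →
    (∀ {x} → x ∈ L → P x → Σ I λ i → i ∈ J × Σ (K i) λ k → k ∈ M i × ψ i k ≡ x) →
    Sum L (λ x → 𝟙 (P? x)) ≤ Sum J (λ i → + length (M i))
  Sum-cover {A = A} {I} L u P? ≟A J K M ψ cover = ≤-trans (Sum-mono∈ L bound)
    (≤-trans (≤-reflexive (trans (Sum-swap L J _) (Sum-cong J (λ i → Sum-swap L (M i) _))))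
    (Sum-mono J (λ i → ≤-trans (Sum-mono (M i) (λ k → Sum-𝟙≤1 L u (λ x → ≟A (ψ i k) x) (λ p q → trans (sym p) q)))
      (≤-reflexive (trans (Sum-const (M i) 1ℤ) (*-identityʳ _))))))
    where
    hits : A → I → ℤ
    hits x i = Sum (M i) (λ k → 𝟙 (≟A (ψ i k) x))
    hits-nonneg : ∀ x i → 0ℤ ≤ hits x i
    hits-nonneg x i = Sum-nonneg (M i) (λ k → 𝟙-nonneg (≟A (ψ i k) x))
    bound : ∀ {x} → x ∈ L → 𝟙 (P? x) ≤ Sum J (hits x)
    bound {x} x∈ with P? x
    ... | no _  = Sum-nonneg J (hits-nonneg x)
    ... | yes p with cover x∈ p
    ... | i , i∈ , k , k∈ , eq = ≤-trans (≤-trans (≤-reflexive (sym (𝟙-yes (≟A (ψ i k) x) eq)))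
      (term≤Sum (M i) (λ k → 𝟙-nonneg (≟A (ψ i k) x)) k∈)) (term≤Sum J (hits-nonneg x) i∈)

  Sum-inject : (L : List A) → Unique L → {P : A → Set} (P? : ∀ x → Dec (P x)) →
    (≟B : (x y : B) → Dec (x ≡ y)) (M : List B) → (∀ y → y ∈ M) → (ψ : A → B) →
    (∀ {x y} → P x → P y → ψ x ≡ ψ y → x ≡ y) → Sum L (λ x → 𝟙 (P? x)) ≤ + length M
  Sum-inject {A = A} {B} L u {P} P? ≟B M complete ψ inj = ≤-trans (Sum-mono L bound)
    (≤-trans (≤-reflexive (Sum-swap L M _))
    (≤-trans (Sum-mono M (λ y → Sum-𝟙≤1 L u (λ x → both x y) (λ p q → inj (proj₁ p) (proj₁ q) (trans (proj₂ p) (sym (proj₂ q))))))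
      (≤-reflexive (trans (Sum-const M 1ℤ) (*-identityʳ _)))))
    where
    both : ∀ x y → Dec (P x × ψ x ≡ y)
    both x y with P? x | ≟B (ψ x) y
    ... | yes p | yes e = yes (p , e)
    ... | yes p | no ne = no (λ z → ne (proj₂ z))
    ... | no np | _     = no (λ z → np (proj₁ z))
    bound : ∀ x → 𝟙 (P? x) ≤ Sum M (λ y → 𝟙 (both x y))
    bound x = ≤-trans (𝟙-mono (P? x) (both x (ψ x)) (λ p → p , refl)) (term≤Sum M (λ y → 𝟙-nonneg (both x y)) (complete (ψ x)))

  Sum-delta : (L : List A) → Unique L → (≟A : (x y : A) → Dec (x ≡ y)) → ∀ {y} → y ∈ L → (f : A → ℤ) →
    Sum L (λ x → 𝟙 (≟A x y) * f x) ≡ f y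
  Sum-delta L u ≟A {y} y∈ f = trans
    (Sum-single L u y∈ (λ x x≢y → cong (_* f x) (𝟙-no (≟A x y) x≢y)))
    (trans (cong (_* f y) (𝟙-yes (≟A y y) refl)) (*-identityˡ (f y)))

  -- No permutation of the list is constructed: a delta sum is inserted, the order of summation
  -- exchanged, and the delta resolved through `τ`.
  Sum-reindex : (L : List A) → Unique L → (≟A : (x y : A) → Dec (x ≡ y)) → (∀ x → x ∈ L) →
    (σ τ : A → A) → (∀ x → σ (τ x) ≡ x) → (∀ x → τ (σ x) ≡ x) → (f : A → ℤ) →
    Sum L (λ x → f (σ x)) ≡ Sum L f
  Sum-reindex L u ≟A complete σ τ στ τσ f = begin
    Sum L (λ x → f (σ x))
      ≡⟨ Sum-cong L (λ x → sym (Sum-delta L u ≟A (complete (σ x)) f)) ⟩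
    Sum L (λ x → Sum L (λ y → 𝟙 (≟A y (σ x)) * f y))
      ≡⟨ Sum-swap L L _ ⟩
    Sum L (λ y → Sum L (λ x → 𝟙 (≟A y (σ x)) * f y))
      ≡⟨ Sum-cong L (λ y → trans (Sum-cong L (λ x → cong (_* f y)
           (𝟙-⇔ (≟A y (σ x)) (≟A x (τ y)) (λ e → sym (trans (cong τ e) (τσ x))) (λ e → sym (trans (cong σ e) (στ y))))))
           (Sum-delta L u ≟A (complete (τ y)) (λ _ → f y))) ⟩
    Sum L f ∎
    where open ≡-Reasoning

  -- Lagrange's identity: the nonnegative double sum of (f x g y - f y g x)² is twice the difference
  -- of the two sides.
  cauchy-schwarz : (L : List A) (f g : A → ℤ) →
    Sum L (λ x → f x * g x) * Sum L (λ x → f x * g x) ≤ Sum L (λ x → f x * f x) * Sum L (λ x → g x * g x)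
  cauchy-schwarz L f g = *-cancelˡ-≤-pos _ _ (+ 2) (0≤i-j⇒j≤i (subst (0ℤ ≤_) expand
    (Sum-nonneg L (λ x → Sum-nonneg L (λ y → square-nonneg (f x * g y - f y * g x))))))
    where
    open +-*-Solver
    fg = Sum L (λ x → f x * g x)
    ff = Sum L (λ x → f x * f x)
    gg = Sum L (λ x → g x * g x)
    expand : Sum L (λ x → Sum L (λ y → (f x * g y - f y * g x) * (f x * g y - f y * g x)))
             ≡ + 2 * (ff * gg) - + 2 * (fg * fg)
    expand = begin
      Sum L (λ x → Sum L (λ y → (f x * g y - f y * g x) * (f x * g y - f y * g x)))
        ≡⟨ Sum-cong L (λ x → Sum-cong L (λ y → solve 4 (λ a b c d →
             (a :* d :- b :* c) :* (a :* d :- b :* c) :=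
             (a :* a) :* (d :* d) :+ ((c :* c) :* (b :* b) :+ con (- + 2) :* ((a :* c) :* (b :* d)))) refl (f x) (f y) (g x) (g y))) ⟩
      Sum L (λ x → Sum L (λ y → (f x * f x) * (g y * g y) + ((g x * g x) * (f y * f y) + - + 2 * ((f x * g x) * (f y * g y)))))
        ≡⟨ Sum-cong L (λ x → trans (Sum-+ L _ _) (cong₂ _+_ (Sum-*ˡ L (f x * f x) _) (trans (Sum-+ L _ _) (cong₂ _+_ (Sum-*ˡ L (g x * g x) _)
             (trans (Sum-*ˡ L (- + 2) _) (*-congʳ (- + 2) (Sum-*ˡ L (f x * g x) _))))))) ⟩
      Sum L (λ x → (f x * f x) * gg + ((g x * g x) * ff + - + 2 * ((f x * g x) * fg)))
        ≡⟨ trans (Sum-+ L _ _) (cong₂ _+_ (Sum-*ʳ L gg _) (trans (Sum-+ L _ _) (cong₂ _+_ (Sum-*ʳ L ff _)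
             (trans (Sum-*ˡ L (- + 2) _) (*-congʳ (- + 2) (Sum-*ʳ L fg _)))))) ⟩
      ff * gg + (gg * ff + - + 2 * (fg * fg))
        ≡⟨ solve 3 (λ a b c → a :* b :+ (b :* a :+ con (- + 2) :* (c :* c)) := con (+ 2) :* (a :* b) :- con (+ 2) :* (c :* c)) refl ff gg fg ⟩
      + 2 * (ff * gg) - + 2 * (fg * fg) ∎
      where open ≡-Reasoning

  length-cartesianProductWith : (h : A → B → C) (L : List A) (M : List B) →
    length (cartesianProductWith h L M) ≡ length L ℕ.* length M
  length-cartesianProductWith h []      M = refl
  length-cartesianProductWith h (x ∷ L) M = trans (length-++ (map (h x) M))
    (cong₂ ℕ._+_ (length-map (h x) M) (length-cartesianProductWith h L M))

  Sum-nonzero : (L : List A) (f : A → ℤ) → Sum L f ≢ 0ℤ → Σ A λ x → x ∈ L × f x ≢ 0ℤ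
  Sum-nonzero []      f ne = ⊥-elim (ne refl)
  Sum-nonzero (x ∷ L) f ne with f x ≟ 0ℤ
  ... | no fx≢0  = x , here refl , fx≢0
  ... | yes fx≡0 with Sum-nonzero L f (λ e → ne (cong₂ _+_ fx≡0 e))
  ... | y , y∈ , fy≢0 = y , there y∈ , fy≢0

  square-abs : ∀ x → x * x ≡ + (∣ x ∣ ℕ.* ∣ x ∣)
  square-abs (+ n)    = sym (pos-* n n)
  square-abs -[1+ n ] = refl

  square-bound : ∀ {x K} → x * x ≤ + K → ∣ x ∣ ℕ.* ∣ x ∣ ℕ.≤ K
  square-bound {x} le = drop‿+≤+ (subst (_≤ _) (square-abs x) le)

  abs-bound⇒square : ∀ {x K} → ∣ x ∣ ℕ.≤ K → x * x ≤ + (K ℕ.* K)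
  abs-bound⇒square {x} le = ≤-trans (≤-reflexive (square-abs x)) (+≤+ (ℕ.*-mono-≤ le le))

  Sum-bounded : (L : List A) {f : A → ℤ} {K : ℕ} → (∀ {x} → x ∈ L → f x ≤ + K) → Sum L f ≤ + (length L ℕ.* K)
  Sum-bounded L {K = K} le = ≤-trans (Sum-mono∈ L le) (≤-reflexive (trans (Sum-const L (+ K)) (sym (pos-* (length L) K))))

  -- Cauchy-Schwarz takes the place of the triangle inequality because for `I` only squares are
  -- bounded.
  sum-of-squares-bound : (L : List A) (c I : A → ℤ) {K W : ℕ} → (∀ {x} → x ∈ L → ∣ c x ∣ ℕ.≤ K) → (∀ {x} → x ∈ L → I x * I x ≤ + W) →
    ∣ Sum L (λ x → c x * I x) ∣ ℕ.* ∣ Sum L (λ x → c x * I x) ∣ ℕ.≤ (length L ℕ.* (K ℕ.* K)) ℕ.* (length L ℕ.* W)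
  sum-of-squares-bound L c I {K} {W} c≤ I≤ = square-bound {Sum L (λ x → c x * I x)} (≤-trans (cauchy-schwarz L c I)
    (≤-trans (*-mono₂-nonneg (Sum-nonneg L (λ x → square-nonneg (I x))) (pos-nonneg (length L ℕ.* (K ℕ.* K)))
        (Sum-bounded L (λ {x} i → abs-bound⇒square {c x} (c≤ i))) (Sum-bounded L I≤))
      (≤-reflexive (sym (pos-* (length L ℕ.* (K ℕ.* K)) (length L ℕ.* W))))))

-- Sums over the field and over vectors; the weight κ.

module FieldSums (F : FiniteField) where

  open import Level using (0ℓ)
  open import Data.Integer using (_+_; _*_; -_; _-_; ∣_∣; _≤_)
  open import Data.Integer.Properties hiding (_≟_)
  open import Data.Integer.Solver using (module +-*-Solver)
  open import Data.List using ([]; _∷_)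
  open import Data.List.Relation.Unary.Any.Properties using (lookup-index)
  open import Data.List.Relation.Unary.All using ([])
  open import Data.List.Relation.Unary.AllPairs using ([]; _∷_)
  open import Data.Fin as Fin using (Fin)
  import Data.Fin.Properties as Fin
  open import Data.Vec using ([]; _∷_)
  import Data.Vec.Properties as Vec
  open FiniteSums

  open FiniteField F public renaming (_+F_ to infixl 6 _⊕_; _*F_ to infixl 7 _⊙_; -F_ to infix 8 ⊖_) 

  FR : CommutativeRing 0ℓ 0ℓ
  FR = record { isCommutativeRing = isCommutativeRing }

  module FR = CommutativeRing FR
  module FS = IntegerSolver FR

  infixl 6 _⊝_
  _⊝_ : Carrier → Carrier → Carrier
  x ⊝ y = x ⊕ ⊖ y

  q : ℕ
  q = size

  -- Decidable equality is extracted from the enumeration: an element is recovered from the place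
  -- where the list contains it, so comparing places suffices.
  position : Carrier → Fin q
  position x = Any.index (elements-complete x)

  lookup-position : ∀ x → x ≡ List.lookup elements (position x)
  lookup-position x = lookup-index (elements-complete x)

  position-injective : ∀ {x y} → position x ≡ position y → x ≡ y
  position-injective {x} {y} eq = trans (lookup-position x) (trans (cong (List.lookup elements) eq) (sym (lookup-position y)))

  infix 4 _≟_
  _≟_ : (x y : Carrier) → Dec (x ≡ y)
  x ≟ y with position x Fin.≟ position y
  ... | yes eq = yes (position-injective eq)
  ... | no neq = no (λ e → neq (cong position e))

  ⊝-zero : ∀ {x y} → x ⊝ y ≡ 0F → x ≡ y
  ⊝-zero {x} {y} eq = trans (FS.solve 2 (λ x y → x FS.:= (x FS.:- y) FS.:+ y) refl x y) (trans (cong (_⊕ y) eq) (FR.+-identityˡ y))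

  ⊝-self : ∀ x → x ⊝ x ≡ 0F
  ⊝-self x = FR.-‿inverseʳ x

  cancel-nonzero : ∀ {x y} → x ≢ 0F → x ⊙ y ≡ 0F → y ≡ 0F
  cancel-nonzero {x} {y} x≢0 eq with inverse x x≢0
  ... | x⁻¹ , inv = begin
    y                ≡⟨ FR.*-identityˡ y ⟨
    1F ⊙ y           ≡⟨ cong (_⊙ y) inv ⟨
    (x ⊙ x⁻¹) ⊙ y    ≡⟨ FS.solve 3 (λ x i y → (x FS.:* i) FS.:* y FS.:= i FS.:* (x FS.:* y)) refl x x⁻¹ y ⟩
    x⁻¹ ⊙ (x ⊙ y)    ≡⟨ cong (x⁻¹ ⊙_) eq ⟩
    x⁻¹ ⊙ 0F         ≡⟨ FR.zeroʳ x⁻¹ ⟩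
    0F ∎
    where open ≡-Reasoning

  *-nonzero : ∀ {x y} → x ≢ 0F → y ≢ 0F → x ⊙ y ≢ 0F
  *-nonzero x≢0 y≢0 eq = y≢0 (cancel-nonzero x≢0 eq)

  2F : Carrier
  2F = 1F ⊕ 1F

  SumF : (Carrier → ℤ) → ℤ
  SumF = Sum elements

  -- In characteristic two, x ↦ x + 1 is an involution without fixed points; each of its orbits contributes exactly
  -- one point that precedes its image in the enumeration.
  odd⇒2≢0 : (∀ k → q ≢ 2 ℕ.* k) → 2F ≢ 0F
  odd⇒2≢0 odd 2≡0 = odd ∣ ups ∣ (+-injective (begin
    + q                                ≡⟨ *-identityʳ (+ q) ⟨
    + q * 1ℤ                           ≡⟨ Sum-const elements 1ℤ ⟨
    SumF (λ _ → 1ℤ)                    ≡⟨ Sum-cong elements split ⟩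
    SumF (λ x → up x + up (σ x))       ≡⟨ Sum-+ elements up (λ x → up (σ x)) ⟩
    ups + SumF (λ x → up (σ x))        ≡⟨ +-congʳ ups (Sum-reindex elements elements-unique _≟_ elements-complete σ σ σσ σσ up) ⟩
    ups + ups                          ≡⟨ solve 1 (λ u → u :+ u := con (+ 2) :* u) refl ups ⟩
    + 2 * ups                          ≡⟨ *-congʳ (+ 2) (0≤i⇒+∣i∣≡i (Sum-nonneg elements (λ x → 𝟙-nonneg (Fin._<?_ (position x) (position (σ x)))))) ⟨
    + 2 * + ∣ ups ∣                    ≡⟨ pos-* 2 ∣ ups ∣ ⟨
    + (2 ℕ.* ∣ ups ∣) ∎))
    where
    open ≡-Reasoning
    open +-*-Solver
    σ : Carrier → Carrier
    σ x = x ⊕ 1F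
    σσ : ∀ x → σ (σ x) ≡ x
    σσ x = trans (FR.+-assoc x 1F 1F) (trans (cong (x ⊕_) 2≡0) (FR.+-identityʳ x))
    up : Carrier → ℤ
    up x = 𝟙 (Fin._<?_ (position x) (position (σ x)))
    ups : ℤ
    ups = SumF up
    σ-moves : ∀ x → x ≢ σ x
    σ-moves x eq = 0≢1 (begin
      0F ≡⟨ ⊝-self x ⟨
      x ⊝ x ≡⟨ cong (_⊝ x) eq ⟩
      σ x ⊝ x ≡⟨ FS.solve 2 (λ x o → (x FS.:+ o) FS.:- x FS.:= o) refl x 1F ⟩
      1F ∎)
    split : ∀ x → 1ℤ ≡ up x + up (σ x)
    split x rewrite σσ x with Fin.<-cmp (position x) (position (σ x))
    ... | tri< lt _ ¬gt = sym (cong₂ _+_ (𝟙-yes (Fin._<?_ _ _) lt) (𝟙-no (Fin._<?_ _ _) ¬gt))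
    ... | tri≈ _ eq _   = ⊥-elim (σ-moves x (position-injective eq))
    ... | tri> ¬lt _ gt = sym (cong₂ _+_ (𝟙-no (Fin._<?_ _ _) ¬lt) (𝟙-yes (Fin._<?_ _ _) gt))

  SumF-delta : ∀ y (f : Carrier → ℤ) → SumF (λ x → 𝟙 (x ≟ y) * f x) ≡ f y
  SumF-delta y f = Sum-delta elements elements-unique _≟_ (elements-complete y) f

  SumF-𝟙 : ∀ y → SumF (λ x → 𝟙 (x ≟ y)) ≡ 1ℤ
  SumF-𝟙 y = trans (Sum-cong elements (λ x → sym (*-identityʳ _))) (SumF-delta y (λ _ → 1ℤ))

  SumF-affine : ∀ {l} → l ≢ 0F → ∀ c (f : Carrier → ℤ) → SumF (λ x → f (x ⊙ l ⊕ c)) ≡ SumF f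
  SumF-affine {l} l≢0 c f with inverse l l≢0
  ... | i , inv = Sum-reindex elements elements-unique _≟_ elements-complete
    (λ x → x ⊙ l ⊕ c) (λ y → (y ⊝ c) ⊙ i)
    (λ y → trans (cong (_⊕ c) (trans (FR.*-assoc (y ⊝ c) i l) (trans (cong ((y ⊝ c) ⊙_) (trans (FR.*-comm i l) inv)) (FR.*-identityʳ _))))
      (FS.solve 2 (λ y c → (y FS.:- c) FS.:+ c FS.:= y) refl y c))
    (λ x → trans (FS.solve 4 (λ x l c i → ((x FS.:* l FS.:+ c) FS.:- c) FS.:* i FS.:= x FS.:* (l FS.:* i)) refl x l c i)
      (trans (cong (x ⊙_) inv) (FR.*-identityʳ x))) f

  -- κ x = Σ ψ(x) over the nontrivial additive characters ψ of F.
  κ : Carrier → ℤ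
  κ x = + q * 𝟙 (x ≟ 0F) - 1ℤ

  κ-diff : ∀ x z → κ (x ⊝ z) ≡ + q * 𝟙 (z ≟ x) - 1ℤ
  κ-diff x z = cong (λ i → + q * i - 1ℤ) (𝟙-⇔ (x ⊝ z ≟ 0F) (z ≟ x) (λ e → sym (⊝-zero e)) (λ e → trans (cong (x ⊝_) e) (⊝-self x)))

  κ-total : SumF κ ≡ 0ℤ
  κ-total = begin
    SumF κ                                       ≡⟨ Sum-minus elements (λ x → + q * 𝟙 (x ≟ 0F)) (λ _ → 1ℤ) ⟩
    SumF (λ x → + q * 𝟙 (x ≟ 0F)) - SumF (λ _ → 1ℤ)
      ≡⟨ cong₂ _-_ (trans (Sum-*ˡ elements (+ q) _) (*-congʳ (+ q) (SumF-𝟙 0F))) (Sum-const elements 1ℤ) ⟩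
    + q * 1ℤ - + q * 1ℤ                          ≡⟨ +-inverseʳ (+ q * 1ℤ) ⟩
    0ℤ ∎
    where open ≡-Reasoning

  κ≤κ0 : ∀ x → κ x ≤ κ 0F
  κ≤κ0 x = +-monoˡ-≤ (- 1ℤ) (*-mono-nonneg (pos-nonneg q) (𝟙-mono (x ≟ 0F) (0F ≟ 0F) (λ _ → refl)))

  κ0≤q : κ 0F ≤ + q
  κ0≤q = ≤-trans (+-monoˡ-≤ (- 1ℤ) (*-mono-nonneg (pos-nonneg q) (𝟙≤1 (0F ≟ 0F))))
    (≤-trans (≤-reflexive (cong (_- 1ℤ) (*-identityʳ (+ q)))) (i-j≤i (+ q) 1ℤ))

  size-positive : 1 ℕ.≤ q
  size-positive with elements | elements-complete 0F
  ... | x ∷ xs | _ = ℕ.s≤s ℕ.z≤n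

  size≥2 : 2 ℕ.≤ q
  size≥2 with elements | elements-complete 0F | elements-complete 1F
  ... | x ∷ []     | here e | here e′ = ⊥-elim (0≢1 (trans e (sym e′)))
  ... | x ∷ y ∷ xs | _      | _       = ℕ.s≤s (ℕ.s≤s ℕ.z≤n)

  κ0-nonneg : 0ℤ ≤ κ 0F
  κ0-nonneg = subst (0ℤ ≤_) (cong (_- 1ℤ) (sym (trans (*-congʳ (+ q) (𝟙-yes (0F ≟ 0F) refl)) (*-identityʳ (+ q)))))
    (i≤j⇒0≤j-i (+≤+ size-positive))

  -- Orthogonality of characters in integer form: κ/q is an idempotent for convolution. The cross
  -- terms 𝟙 · 1 each sum to 1.
  κ-convolution : ∀ x y → SumF (λ z → κ (x ⊝ z) * κ (y ⊝ z)) ≡ + q * κ (x ⊝ y)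
  κ-convolution x y = begin
    SumF (λ z → κ (x ⊝ z) * κ (y ⊝ z))
      ≡⟨ Sum-cong elements (λ z → trans (cong₂ _*_ (κ-diff x z) (κ-diff y z))
           (solve 3 (λ q a b → (q :* a :- con 1ℤ) :* (q :* b :- con 1ℤ) :=
             (a :* (q :* q :* b)) :+ ((:- q) :* a :+ ((:- q) :* b :+ con 1ℤ))) refl (+ q) (𝟙 (z ≟ x)) (𝟙 (z ≟ y)))) ⟩
    SumF (λ z → 𝟙 (z ≟ x) * (+ q * + q * 𝟙 (z ≟ y)) + (- + q * 𝟙 (z ≟ x) + (- + q * 𝟙 (z ≟ y) + 1ℤ)))
      ≡⟨ trans (Sum-+ elements _ _) (cong₂ _+_ (SumF-delta x _) (trans (Sum-+ elements _ _) (cong₂ _+_ (Sum-*ˡ elements (- + q) _)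
           (trans (Sum-+ elements _ _) (cong₂ _+_ (Sum-*ˡ elements (- + q) _) (Sum-const elements 1ℤ)))))) ⟩
    + q * + q * 𝟙 (x ≟ y) + (- + q * SumF (λ z → 𝟙 (z ≟ x)) + (- + q * SumF (λ z → 𝟙 (z ≟ y)) + + q * 1ℤ))
      ≡⟨ cong₂ (λ u v → + q * + q * 𝟙 (x ≟ y) + (- + q * u + (- + q * v + + q * 1ℤ))) (SumF-𝟙 x) (SumF-𝟙 y) ⟩
    + q * + q * 𝟙 (x ≟ y) + (- + q * 1ℤ + (- + q * 1ℤ + + q * 1ℤ))
      ≡⟨ solve 2 (λ q a → q :* q :* a :+ ((:- q) :* con 1ℤ :+ ((:- q) :* con 1ℤ :+ q :* con 1ℤ)) := q :* (q :* a :- con 1ℤ)) refl (+ q) (𝟙 (x ≟ y)) ⟩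
    + q * (+ q * 𝟙 (x ≟ y) - 1ℤ)
      ≡⟨ *-congʳ (+ q) (trans (cong (λ i → + q * i - 1ℤ) (𝟙-⇔ (x ≟ y) (y ≟ x) sym sym)) (sym (κ-diff x y))) ⟩
    + q * κ (x ⊝ y) ∎
    where
    open ≡-Reasoning
    open +-*-Solver

  -- The κ-sum at γ is one of the nonnegative terms of the sum over all γ, which the convolution identity evaluates.
  κ-square : {A : Set} (L : List A) (β : A → ℤ) (φ : A → Carrier) (γ : Carrier) →
    Sum L (λ h → β h * κ (φ h ⊝ γ)) * Sum L (λ h → β h * κ (φ h ⊝ γ))
    ≤ + q * Sum L (λ h → Sum L (λ h′ → (β h * β h′) * κ (φ h ⊝ φ h′)))
  κ-square L β φ γ = ≤-trans (term≤Sum elements {λ z → S z * S z} (λ z → square-nonneg (S z)) (elements-complete γ)) (≤-reflexive (begin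
    SumF (λ z → S z * S z)
      ≡⟨ Sum-cong elements (λ z → sym (Sum-product L L (λ h → β h * κ (φ h ⊝ z)) (λ h → β h * κ (φ h ⊝ z)))) ⟩
    SumF (λ z → Sum L (λ h → Sum L (λ h′ → (β h * κ (φ h ⊝ z)) * (β h′ * κ (φ h′ ⊝ z)))))
      ≡⟨ trans (Sum-swap elements L _) (Sum-cong L (λ h → Sum-swap elements L _)) ⟩
    Sum L (λ h → Sum L (λ h′ → SumF (λ z → (β h * κ (φ h ⊝ z)) * (β h′ * κ (φ h′ ⊝ z)))))
      ≡⟨ Sum-cong L (λ h → Sum-cong L (λ h′ → pointwise h h′)) ⟩
    Sum L (λ h → Sum L (λ h′ → + q * ((β h * β h′) * κ (φ h ⊝ φ h′))))
      ≡⟨ trans (Sum-cong L (λ h → Sum-*ˡ L (+ q) _)) (Sum-*ˡ L (+ q) _) ⟩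
    + q * Sum L (λ h → Sum L (λ h′ → (β h * β h′) * κ (φ h ⊝ φ h′))) ∎))
    where
    open ≡-Reasoning
    open +-*-Solver
    S : Carrier → ℤ
    S z = Sum L (λ h → β h * κ (φ h ⊝ z))
    pointwise : ∀ h h′ → SumF (λ z → (β h * κ (φ h ⊝ z)) * (β h′ * κ (φ h′ ⊝ z))) ≡ + q * ((β h * β h′) * κ (φ h ⊝ φ h′))
    pointwise h h′ = begin
      SumF (λ z → (β h * κ (φ h ⊝ z)) * (β h′ * κ (φ h′ ⊝ z)))
        ≡⟨ Sum-cong elements (λ z → solve 4 (λ a b c d → (a :* b) :* (c :* d) := (a :* c) :* (b :* d)) refl (β h) (κ (φ h ⊝ z)) (β h′) (κ (φ h′ ⊝ z))) ⟩
      SumF (λ z → (β h * β h′) * (κ (φ h ⊝ z) * κ (φ h′ ⊝ z)))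
        ≡⟨ Sum-*ˡ elements (β h * β h′) _ ⟩
      (β h * β h′) * SumF (λ z → κ (φ h ⊝ z) * κ (φ h′ ⊝ z))
        ≡⟨ *-congʳ (β h * β h′) (κ-convolution (φ h) (φ h′)) ⟩
      (β h * β h′) * (+ q * κ (φ h ⊝ φ h′))
        ≡⟨ solve 3 (λ b q k → b :* (q :* k) := q :* (b :* k)) refl (β h * β h′) (+ q) (κ (φ h ⊝ φ h′)) ⟩
      + q * ((β h * β h′) * κ (φ h ⊝ φ h′)) ∎

  vecs : (n : ℕ) → List (Vec Carrier n)
  vecs zero    = [] ∷ []
  vecs (suc n) = cartesianProductWith _∷_ elements (vecs n)

  vecs-complete : ∀ {n} (v : Vec Carrier n) → v ∈ vecs n
  vecs-complete []      = here refl
  vecs-complete (x ∷ v) = ∈-cartesianProductWith⁺ _∷_ (elements-complete x) (vecs-complete v)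

  vecs-unique : ∀ n → Unique (vecs n)
  vecs-unique zero    = [] ∷ []
  vecs-unique (suc n) = Unique.cartesianProductWith⁺ _∷_ Vec.∷-injective elements-unique (vecs-unique n)

  vecs-length : ∀ n → length (vecs n) ≡ q ℕ.^ n
  vecs-length zero    = refl
  vecs-length (suc n) = trans (length-cartesianProductWith _∷_ elements (vecs n)) (cong (q ℕ.*_) (vecs-length n))

  infix 4 _≟V_
  _≟V_ : ∀ {n} (v w : Vec Carrier n) → Dec (v ≡ w)
  _≟V_ = Vec.≡-dec _≟_

  SumV : ∀ n → (Vec Carrier n → ℤ) → ℤ
  SumV n = Sum (vecs n)

  SumV-∷ : ∀ n (f : Vec Carrier (suc n) → ℤ) → SumV (suc n) f ≡ SumF (λ x → SumV n (λ v → f (x ∷ v)))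
  SumV-∷ n f = Sum-cartesian _∷_ elements (vecs n) f

  SumV-const : ∀ n c → SumV n (λ _ → c) ≡ + (q ℕ.^ n) * c
  SumV-const n c = trans (Sum-const (vecs n) c) (cong (λ l → + l * c) (vecs-length n))

-- Power series, degree bounds and reversal.

module PowerSeries (F : FiniteField) where

  open import Level using (0ℓ)
  open import Data.Nat using (_+_; _≤_)
  open import Data.Vec using ([]; _∷_)
  open FieldSums F

  -- Power series over F; polynomials are the series bounded by Deg<.
  Seq : Set
  Seq = ℕ → Carrier

  infix 4 _≈_
  -- A record instead of a bare function type, so that the two series can be inferred from a proof.
  record _≈_ (p r : Seq) : Set where
    constructor mk≈
    field at : ∀ k → p k ≡ r k
  open _≈_ public

  infixl 6 _⊞_
  infixl 7 _⊠_ _•_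
  infix 8 ⊟_

  _⊞_ _⊠_ : Seq → Seq → Seq
  (p ⊞ r) k = p k ⊕ r k
  (p ⊠ r) zero    = p 0 ⊙ r 0
  (p ⊠ r) (suc k) = p 0 ⊙ r (suc k) ⊕ ((λ i → p (suc i)) ⊠ r) k

  ⊟_ : Seq → Seq
  (⊟ p) k = ⊖ p k

  _•_ : Carrier → Seq → Seq
  (c • p) k = c ⊙ p k

  tail : Seq → Seq
  tail p k = p (suc k)

  0s : Seq
  0s _ = 0F

  X^ : ℕ → Seq
  X^ zero    zero    = 1F
  X^ zero    (suc k) = 0F
  X^ (suc n) zero    = 0F
  X^ (suc n) (suc k) = X^ n k

  1s : Seq
  1s = X^ 0

  ≈-refl : ∀ {p} → p ≈ p
  ≈-refl = mk≈ (λ _ → refl)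

  ≈-sym : ∀ {p r} → p ≈ r → r ≈ p
  ≈-sym e = mk≈ (λ k → sym (at e k))

  ≈-trans : ∀ {p r s} → p ≈ r → r ≈ s → p ≈ s
  ≈-trans e f = mk≈ (λ k → trans (at e k) (at f k))

  ⊠-cong-at : ∀ {p p′ r r′} → (∀ k → p k ≡ p′ k) → (∀ k → r k ≡ r′ k) → ∀ k → (p ⊠ r) k ≡ (p′ ⊠ r′) k
  ⊠-cong-at e f zero    = cong₂ _⊙_ (e 0) (f 0)
  ⊠-cong-at e f (suc k) = cong₂ _⊕_ (cong₂ _⊙_ (e 0) (f (suc k))) (⊠-cong-at (λ i → e (suc i)) f k)

  ⊠-zeroˡ : ∀ p → (∀ k → p k ≡ 0F) → ∀ r k → (p ⊠ r) k ≡ 0F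
  ⊠-zeroˡ p z r zero    = trans (cong (_⊙ r 0) (z 0)) (FR.zeroˡ _)
  ⊠-zeroˡ p z r (suc k) = trans (cong₂ _⊕_ (trans (cong (_⊙ r (suc k)) (z 0)) (FR.zeroˡ _)) (⊠-zeroˡ (tail p) (λ i → z (suc i)) r k)) (FR.+-identityˡ 0F)

  ⊠-constˡ : ∀ p r → (∀ k → p (suc k) ≡ 0F) → ∀ k → (p ⊠ r) k ≡ p 0 ⊙ r k
  ⊠-constˡ p r z zero    = refl
  ⊠-constˡ p r z (suc k) = trans (cong (_⊕_ _) (⊠-zeroˡ (tail p) z r k)) (FR.+-identityʳ _)

  ⊠-distribʳ : ∀ r p s k → ((p ⊞ s) ⊠ r) k ≡ (p ⊠ r) k ⊕ (s ⊠ r) k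
  ⊠-distribʳ r p s zero    = FR.distribʳ (r 0) (p 0) (s 0)
  ⊠-distribʳ r p s (suc k) = trans (cong (_⊕_ _) (⊠-distribʳ r (tail p) (tail s) k))
    (FS.solve 5 (λ a b c d e → (a FS.:+ b) FS.:* c FS.:+ (d FS.:+ e) FS.:= (a FS.:* c FS.:+ d) FS.:+ (b FS.:* c FS.:+ e)) refl
      (p 0) (s 0) (r (suc k)) ((tail p ⊠ r) k) ((tail s ⊠ r) k))

  •-⊠ : ∀ c p r k → ((c • p) ⊠ r) k ≡ c ⊙ (p ⊠ r) k
  •-⊠ c p r zero    = FR.*-assoc c (p 0) (r 0)
  •-⊠ c p r (suc k) = trans (cong (_⊕_ _) (•-⊠ c (tail p) r k))
    (FS.solve 4 (λ c a b d → (c FS.:* a) FS.:* b FS.:+ c FS.:* d FS.:= c FS.:* (a FS.:* b FS.:+ d)) refl c (p 0) (r (suc k)) ((tail p ⊠ r) k))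

  -- The defining recursion consumes the left factor; commutativity requires the same recursion on
  -- the right.
  ⊠-unfoldʳ : ∀ p r k → (p ⊠ r) (suc k) ≡ (p ⊠ tail r) k ⊕ p (suc k) ⊙ r 0
  ⊠-unfoldʳ p r zero    = refl
  ⊠-unfoldʳ p r (suc k) = trans (cong (_⊕_ _) (⊠-unfoldʳ (tail p) r k)) (sym (FR.+-assoc _ _ _))

  ⊠-comm-at : ∀ p r k → (p ⊠ r) k ≡ (r ⊠ p) k
  ⊠-comm-at p r zero    = FR.*-comm (p 0) (r 0)
  ⊠-comm-at p r (suc k) = begin
    p 0 ⊙ r (suc k) ⊕ (tail p ⊠ r) k   ≡⟨ cong₂ _⊕_ (FR.*-comm (p 0) (r (suc k))) (⊠-comm-at (tail p) r k) ⟩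
    r (suc k) ⊙ p 0 ⊕ (r ⊠ tail p) k   ≡⟨ FR.+-comm _ _ ⟩
    (r ⊠ tail p) k ⊕ r (suc k) ⊙ p 0   ≡⟨ ⊠-unfoldʳ r p k ⟨
    (r ⊠ p) (suc k) ∎
    where open ≡-Reasoning

  ⊠-assoc-at : ∀ p r s k → ((p ⊠ r) ⊠ s) k ≡ (p ⊠ (r ⊠ s)) k
  ⊠-assoc-at p r s zero    = FR.*-assoc _ _ _
  ⊠-assoc-at p r s (suc k) = begin
    p 0 ⊙ r 0 ⊙ s (suc k) ⊕ (tail (p ⊠ r) ⊠ s) k
      ≡⟨ cong (_⊕_ _) (⊠-distribʳ s (p 0 • tail r) (tail p ⊠ r) k) ⟩
    p 0 ⊙ r 0 ⊙ s (suc k) ⊕ (((p 0 • tail r) ⊠ s) k ⊕ ((tail p ⊠ r) ⊠ s) k)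
      ≡⟨ cong₂ (λ u v → p 0 ⊙ r 0 ⊙ s (suc k) ⊕ (u ⊕ v)) (•-⊠ (p 0) (tail r) s k) (⊠-assoc-at (tail p) r s k) ⟩
    p 0 ⊙ r 0 ⊙ s (suc k) ⊕ (p 0 ⊙ (tail r ⊠ s) k ⊕ (tail p ⊠ (r ⊠ s)) k)
      ≡⟨ FS.solve 5 (λ a b c d e → a FS.:* b FS.:* c FS.:+ (a FS.:* d FS.:+ e) FS.:= a FS.:* (b FS.:* c FS.:+ d) FS.:+ e) refl
           (p 0) (r 0) (s (suc k)) ((tail r ⊠ s) k) ((tail p ⊠ (r ⊠ s)) k) ⟩
    p 0 ⊙ (r ⊠ s) (suc k) ⊕ (tail p ⊠ (r ⊠ s)) k ∎
    where open ≡-Reasoning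

  ⊠-identityˡ-at : ∀ p k → (1s ⊠ p) k ≡ p k
  ⊠-identityˡ-at p k = trans (⊠-constˡ 1s p (λ _ → refl) k) (FR.*-identityˡ (p k))

  SR : CommutativeRing 0ℓ 0ℓ
  SR = record
    { Carrier = Seq ; _≈_ = _≈_ ; _+_ = _⊞_ ; _*_ = _⊠_ ; -_ = ⊟_ ; 0# = 0s ; 1# = 1s
    ; isCommutativeRing = record
      { isRing = record
        { +-isAbelianGroup = record
          { isGroup = record
            { isMonoid = record
              { isSemigroup = record
                { isMagma = record
                  { isEquivalence = record { refl = ≈-refl ; sym = ≈-sym ; trans = ≈-trans }
                  ; ∙-cong = λ e f → mk≈ (λ k → cong₂ _⊕_ (at e k) (at f k)) }
                ; assoc = λ p r s → mk≈ (λ k → FR.+-assoc (p k) (r k) (s k)) }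
              ; identity = (λ p → mk≈ (λ k → FR.+-identityˡ (p k))) , (λ p → mk≈ (λ k → FR.+-identityʳ (p k))) }
            ; inverse = (λ p → mk≈ (λ k → FR.-‿inverseˡ (p k))) , (λ p → mk≈ (λ k → FR.-‿inverseʳ (p k)))
            ; ⁻¹-cong = λ e → mk≈ (λ k → cong ⊖_ (at e k)) }
          ; comm = λ p r → mk≈ (λ k → FR.+-comm (p k) (r k)) }
        ; *-cong = λ e f → mk≈ (⊠-cong-at (at e) (at f))
        ; *-assoc = λ p r s → mk≈ (⊠-assoc-at p r s)
        ; *-identity = (λ p → mk≈ (⊠-identityˡ-at p)) , (λ p → mk≈ (λ k → trans (⊠-comm-at p 1s k) (⊠-identityˡ-at p k)))
        ; distrib = (λ r p s → mk≈ (λ k → trans (⊠-comm-at r (p ⊞ s) k) (trans (⊠-distribʳ r p s k) (cong₂ _⊕_ (⊠-comm-at p r k) (⊠-comm-at s r k)))))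
                  , (λ r p s → mk≈ (⊠-distribʳ r p s)) }
      ; *-comm = λ p r → mk≈ (⊠-comm-at p r) } }

  module SR = CommutativeRing SR
  module SS = IntegerSolver SR

  •≈⊠ : ∀ c p → c • p ≈ (c • 1s) ⊠ p
  •≈⊠ c p = mk≈ (λ k → sym (trans (•-⊠ c 1s p k) (cong (c ⊙_) (⊠-identityˡ-at p k))))

  •-cong : ∀ c {p r} → p ≈ r → c • p ≈ c • r
  •-cong c e = mk≈ (λ k → cong (c ⊙_) (at e k))

  split-tail : ∀ p → p ≈ p 0 • 1s ⊞ X^ 1 ⊠ tail p
  split-tail p = mk≈ λ where
    zero    → sym (trans (cong₂ _⊕_ (FR.*-identityʳ (p 0)) (FR.zeroˡ _)) (FR.+-identityʳ (p 0)))
    (suc k) → sym (trans (cong₂ _⊕_ (FR.zeroʳ (p 0)) (trans (cong₂ _⊕_ (FR.zeroˡ _) (⊠-identityˡ-at (tail p) k)) (FR.+-identityˡ _))) (FR.+-identityˡ _))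

  X^-shift : ∀ n p k → (X^ n ⊠ p) (n + k) ≡ p k
  X^-shift zero    p k = ⊠-identityˡ-at p k
  X^-shift (suc n) p k = trans (cong₂ _⊕_ (FR.zeroˡ _) (X^-shift n p k)) (FR.+-identityˡ _)

  X^-below : ∀ n p k → k < n → (X^ n ⊠ p) k ≡ 0F
  X^-below (suc n) p zero    lt       = FR.zeroˡ _
  X^-below (suc n) p (suc k) (s≤s lt) = trans (cong₂ _⊕_ (FR.zeroˡ _) (X^-below n p k lt)) (FR.+-identityˡ _)

  X^-top : ∀ n → X^ n n ≡ 1F
  X^-top zero    = refl
  X^-top (suc n) = X^-top n

  X^-other : ∀ n k → k ≢ n → X^ n k ≡ 0F
  X^-other zero    zero    ne = ⊥-elim (ne refl)
  X^-other zero    (suc k) ne = refl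
  X^-other (suc n) zero    ne = refl
  X^-other (suc n) (suc k) ne = X^-other n k (λ e → ne (cong suc e))

  X^-suc : ∀ n p → X^ (suc n) ⊠ p ≈ X^ 1 ⊠ (X^ n ⊠ p)
  X^-suc n p = mk≈ λ where
    zero    → trans (FR.zeroˡ _) (sym (FR.zeroˡ _))
    (suc k) → cong₂ _⊕_ (trans (FR.zeroˡ _) (sym (FR.zeroˡ _))) (sym (⊠-identityˡ-at (X^ n ⊠ p) k))

  Deg< : ℕ → Seq → Set
  Deg< n p = ∀ k → n ≤ k → p k ≡ 0F

  Deg<-mono : ∀ {m n p} → m ≤ n → Deg< m p → Deg< n p
  Deg<-mono m≤n d k n≤k = d k (ℕ.≤-trans m≤n n≤k)

  Deg<-cong : ∀ {n p r} → p ≈ r → Deg< n p → Deg< n r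
  Deg<-cong e d k n≤k = trans (sym (at e k)) (d k n≤k)

  Deg<-⊞ : ∀ {n p r} → Deg< n p → Deg< n r → Deg< n (p ⊞ r)
  Deg<-⊞ d e k n≤k = trans (cong₂ _⊕_ (d k n≤k) (e k n≤k)) (FR.+-identityˡ 0F)

  ⊖-zero : ⊖ 0F ≡ 0F
  ⊖-zero = trans (sym (FR.+-identityˡ (⊖ 0F))) (FR.-‿inverseʳ 0F)

  Deg<-⊟ : ∀ {n p} → Deg< n p → Deg< n (⊟ p)
  Deg<-⊟ d k n≤k = trans (cong ⊖_ (d k n≤k)) ⊖-zero

  Deg<-• : ∀ {n p} c → Deg< n p → Deg< n (c • p)
  Deg<-• c d k n≤k = trans (cong (c ⊙_) (d k n≤k)) (FR.zeroʳ c)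

  Deg<-X^ : ∀ n → Deg< (suc n) (X^ n)
  Deg<-X^ n k n<k = X^-other n k (λ e → ℕ.<-irrefl (sym e) n<k)

  Deg<-tail : ∀ {n p} → Deg< (suc n) p → Deg< n (tail p)
  Deg<-tail d k n≤k = d (suc k) (s≤s n≤k)

  Deg<-⊠ : ∀ a b {p r} → Deg< a p → Deg< (suc b) r → Deg< (a + b) (p ⊠ r)
  Deg<-⊠ zero    b {p} {r} d e k le = ⊠-zeroˡ p (λ i → d i z≤n) r k
  Deg<-⊠ (suc a) b {p} {r} d e (suc k) (s≤s le) = trans (cong₂ _⊕_
    (trans (cong (p 0 ⊙_) (e (suc k) (s≤s (ℕ.≤-trans (ℕ.m≤n+m b a) le)))) (FR.zeroʳ (p 0)))
    (Deg<-⊠ a b (Deg<-tail d) e k le)) (FR.+-identityˡ 0F)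

  ⊠-top : ∀ a b {p r} → Deg< (suc a) p → Deg< (suc b) r → (p ⊠ r) (a + b) ≡ p a ⊙ r b
  ⊠-top zero    b {p} {r} d e = ⊠-constˡ p r (λ k → d (suc k) (s≤s z≤n)) b
  ⊠-top (suc a) b {p} {r} d e = trans (cong₂ _⊕_
    (trans (cong (p 0 ⊙_) (e (suc (a + b)) (s≤s (ℕ.m≤n+m b a)))) (FR.zeroʳ (p 0))) (⊠-top a b (Deg<-tail d) e)) (FR.+-identityˡ _)

  Deg<0 : ∀ {p} → Deg< 0 p → p ≈ 0s
  Deg<0 d = mk≈ (λ k → d k z≤n)

  -- Reversal: rev n p = tⁿ p(1/t) for p of degree at most n.

  rev : ℕ → Seq → Seq
  rev zero    p zero    = p 0
  rev zero    p (suc k) = 0F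
  rev (suc n) p zero    = p (suc n)
  rev (suc n) p (suc k) = rev n p k

  rev-0 : ∀ n p → rev n p 0 ≡ p n
  rev-0 zero    p = refl
  rev-0 (suc n) p = refl

  rev-at : ∀ i j p → rev (i + j) p i ≡ p j
  rev-at zero    j p = rev-0 j p
  rev-at (suc i) j p = rev-at i j p

  Deg<-rev : ∀ n p → Deg< (suc n) (rev n p)
  Deg<-rev zero    p (suc k) le       = refl
  Deg<-rev (suc n) p (suc k) (s≤s le) = Deg<-rev n p k le

  rev-ext : ∀ n {p r} → (∀ k → k ≤ n → p k ≡ r k) → ∀ k → rev n p k ≡ rev n r k
  rev-ext zero    e zero    = e 0 z≤n
  rev-ext zero    e (suc k) = refl
  rev-ext (suc n) e zero    = e (suc n) ℕ.≤-refl
  rev-ext (suc n) e (suc k) = rev-ext n (λ i le → e i (ℕ.m≤n⇒m≤1+n le)) k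

  rev-cong : ∀ n {p r} → p ≈ r → rev n p ≈ rev n r
  rev-cong n e = mk≈ (rev-ext n (λ k _ → at e k))

  rev-⊞ : ∀ n p r → rev n (p ⊞ r) ≈ rev n p ⊞ rev n r
  rev-⊞ n p r = mk≈ (go n)
    where
    go : ∀ n k → rev n (p ⊞ r) k ≡ rev n p k ⊕ rev n r k
    go zero    zero    = refl
    go zero    (suc k) = sym (FR.+-identityˡ 0F)
    go (suc n) zero    = refl
    go (suc n) (suc k) = go n k

  rev-• : ∀ n c p → rev n (c • p) ≈ c • rev n p
  rev-• n c p = mk≈ (go n)
    where
    go : ∀ n k → rev n (c • p) k ≡ c ⊙ rev n p k
    go zero    zero    = refl
    go zero    (suc k) = sym (FR.zeroʳ c)
    go (suc n) zero    = refl
    go (suc n) (suc k) = go n k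

  rev-⊟ : ∀ n p → rev n (⊟ p) ≈ ⊟ rev n p
  rev-⊟ n p = mk≈ (go n)
    where
    go : ∀ n k → rev n (⊟ p) k ≡ ⊖ rev n p k
    go zero    zero    = refl
    go zero    (suc k) = sym ⊖-zero
    go (suc n) zero    = refl
    go (suc n) (suc k) = go n k

  split-≤ : ∀ {i n} → i ≤ n → ∃ λ j → i + j ≡ n
  split-≤ {i} {n} le = n ∸ i , ℕ.m+[n∸m]≡n le

  rev-unique : ∀ n {p r} → Deg< (suc n) r → (∀ i j → i + j ≡ n → r i ≡ p j) → rev n p ≈ r
  rev-unique n {p} {r} d e = mk≈ go
    where
    go : ∀ k → rev n p k ≡ r k
    go k with k ℕ.≤? n
    ... | no k≰n = trans (Deg<-rev n p k (ℕ.≰⇒> k≰n)) (sym (d k (ℕ.≰⇒> k≰n)))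
    ... | yes k≤n with split-≤ k≤n
    ... | j , refl = trans (rev-at k j p) (sym (e k j refl))

  rev-involutive : ∀ n {p} → Deg< (suc n) p → rev n (rev n p) ≈ p
  rev-involutive n {p} d = rev-unique n d λ { i j refl → sym (trans (cong (λ m → rev m p j) (ℕ.+-comm i j)) (rev-at j i p)) }

  rev-X : ∀ n p → rev (suc n) (X^ 1 ⊠ p) ≈ rev n p
  rev-X n p = rev-unique (suc n) (Deg<-mono (ℕ.n≤1+n (suc n)) (Deg<-rev n p)) λ where
    i zero eq → trans (Deg<-rev n p i (ℕ.≤-reflexive (trans (sym eq) (ℕ.+-identityʳ i)))) (sym (FR.zeroˡ (p 0)))
    i (suc j) eq → trans (trans (cong (λ m → rev m p i) (sym (ℕ.suc-injective (trans (sym (ℕ.+-suc i j)) eq)))) (rev-at i j p))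
      (sym (X^-shift 1 p j))

  rev-extend : ∀ k n {p} → Deg< (suc n) p → rev (k + n) p ≈ X^ k ⊠ rev n p
  rev-extend zero    n d = mk≈ (λ i → sym (⊠-identityˡ-at _ i))
  rev-extend (suc k) n {p} d = ≈-trans step (≈-trans (SR.*-congˡ (rev-extend k n d)) (≈-sym (X^-suc k (rev n p))))
    where
    step : rev (suc (k + n)) p ≈ X^ 1 ⊠ rev (k + n) p
    step = mk≈ λ where
      zero    → trans (d (suc (k + n)) (s≤s (ℕ.m≤n+m n k))) (sym (FR.zeroˡ _))
      (suc i) → sym (X^-shift 1 (rev (k + n) p) i)

  rev-1 : ∀ a → rev a 1s ≈ X^ a
  rev-1 a = ≈-trans (mk≈ (λ k → cong (λ m → rev m 1s k) (sym (ℕ.+-identityʳ a)))) (≈-trans (rev-extend a 0 (Deg<-X^ 0))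
    (≈-trans (SR.*-congˡ (mk≈ (λ { zero → refl ; (suc k) → refl }))) (SR.*-identityʳ (X^ a))))

  rev-split : ∀ a p → rev (suc a) p ≈ p 0 • X^ (suc a) ⊞ rev a (tail p)
  rev-split a p = ≈-trans (rev-cong (suc a) (split-tail p)) (≈-trans (rev-⊞ (suc a) _ _)
    (SR.+-cong (≈-trans (rev-• (suc a) (p 0) 1s) (•-cong (p 0) (rev-1 (suc a)))) (rev-X a (tail p))))

  -- This multiplicativity is what splits f f* into (g g*)(h h*). Induction on a writes p = p(0) + t
  -- · tail p: the constant contributes p(0) t^(a+1) r*, and the factor t is lost under reversal.
  rev-⊠ : ∀ a b {p r} → Deg< (suc a) p → Deg< (suc b) r → rev (a + b) (p ⊠ r) ≈ rev a p ⊠ rev b r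
  rev-⊠ zero b {p} {r} d e = begin
    rev b (p ⊠ r)      ≈⟨ rev-cong b (mk≈ {r = p 0 • r} (⊠-constˡ p r (λ k → d (suc k) (s≤s z≤n)))) ⟩
    rev b (p 0 • r)    ≈⟨ rev-• b (p 0) r ⟩
    p 0 • rev b r      ≈⟨ mk≈ (⊠-constˡ (rev 0 p) (rev b r) (λ _ → refl)) ⟨
    rev 0 p ⊠ rev b r ∎
    where open import Relation.Binary.Reasoning.Setoid SR.setoid
  rev-⊠ (suc a) b {p} {r} d e = begin
    rev (suc (a + b)) (p ⊠ r)
      ≈⟨ rev-cong (suc (a + b)) (≈-trans (SR.*-congʳ (split-tail p)) (≈-trans (SR.distribʳ r _ _)
           (SR.+-cong (≈-sym (•≈⊠ (p 0) r)) (SR.*-assoc (X^ 1) (tail p) r)))) ⟩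
    rev (suc (a + b)) (p 0 • r ⊞ X^ 1 ⊠ (tail p ⊠ r))
      ≈⟨ ≈-trans (rev-⊞ (suc (a + b)) _ _) (SR.+-cong (rev-• (suc (a + b)) (p 0) r) (rev-X (a + b) (tail p ⊠ r))) ⟩
    p 0 • rev (suc a + b) r ⊞ rev (a + b) (tail p ⊠ r)
      ≈⟨ SR.+-cong (≈-trans (•-cong (p 0) (rev-extend (suc a) b e))
           (≈-trans (•≈⊠ (p 0) _) (≈-trans (≈-sym (SR.*-assoc _ _ _)) (SR.*-congʳ (≈-sym (•≈⊠ (p 0) (X^ (suc a))))))))
           (rev-⊠ a b (Deg<-tail d) e) ⟩
    (p 0 • X^ (suc a)) ⊠ rev b r ⊞ rev a (tail p) ⊠ rev b r
      ≈⟨ SR.distribʳ (rev b r) _ _ ⟨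
    (p 0 • X^ (suc a) ⊞ rev a (tail p)) ⊠ rev b r
      ≈⟨ SR.*-congʳ (rev-split a p) ⟨
    rev (suc a) p ⊠ rev b r ∎
    where open import Relation.Binary.Reasoning.Setoid SR.setoid

  seq : ∀ {n} → Vec Carrier n → Seq
  seq []      k       = 0F
  seq (x ∷ v) zero    = x
  seq (x ∷ v) (suc k) = seq v k

  vec : (n : ℕ) → Seq → Vec Carrier n
  vec zero    p = []
  vec (suc n) p = p 0 ∷ vec n (tail p)

  Deg<-seq : ∀ {n} (v : Vec Carrier n) → Deg< n (seq v)
  Deg<-seq []      k       le       = refl
  Deg<-seq (x ∷ v) (suc k) (s≤s le) = Deg<-seq v k le

  seq-vec : ∀ n {p} → Deg< n p → seq (vec n p) ≈ p
  seq-vec n d = mk≈ (go n d)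
    where
    go : ∀ n {p} → Deg< n p → ∀ k → seq (vec n p) k ≡ p k
    go zero    d k       = sym (d k z≤n)
    go (suc n) d zero    = refl
    go (suc n) d (suc k) = go n (Deg<-tail d) k

  vec-cong : ∀ n {p r} → p ≈ r → vec n p ≡ vec n r
  vec-cong zero    e = refl
  vec-cong (suc n) e = cong₂ _∷_ (at e 0) (vec-cong n (mk≈ (λ k → at e (suc k))))

  vec-seq : ∀ {n} (v : Vec Carrier n) → vec n (seq v) ≡ v
  vec-seq []      = refl
  vec-seq (x ∷ v) = cong (x ∷_) (vec-seq v)

  seq-injective : ∀ {n} {v w : Vec Carrier n} → seq v ≈ seq w → v ≡ w
  seq-injective {n} {v} {w} e = trans (sym (vec-seq v)) (trans (vec-cong n e) (vec-seq w))

  vec-ext : ∀ n {p r} → (∀ k → k < n → p k ≡ r k) → vec n p ≡ vec n r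
  vec-ext zero    e = refl
  vec-ext (suc n) e = cong₂ _∷_ (e 0 (s≤s z≤n)) (vec-ext n (λ k lt → e (suc k) (s≤s lt)))

  seq-vec-at : ∀ n p k → k < n → seq (vec n p) k ≡ p k
  seq-vec-at (suc n) p zero    lt       = refl
  seq-vec-at (suc n) p (suc k) (s≤s lt) = seq-vec-at n (tail p) k lt

  vec-at : ∀ n {p r} → vec n p ≡ vec n r → ∀ k → k < n → p k ≡ r k
  vec-at n {p} {r} e k lt = trans (sym (seq-vec-at n p k lt)) (trans (cong (λ v → seq v k) e) (seq-vec-at n r k lt))

-- Exact degree, division with remainder, greatest common divisors.

module Polynomials (F : FiniteField) where

  open import Data.Nat using (_+_)
  open FieldSums F
  open PowerSeries F
  open SS using (solve; _:=_; _:+_; _:*_; _:-_; :-_)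

  Poly : Seq → Set
  Poly p = ∃ λ N → Deg< N p

  Poly-⊞ : ∀ {p r} → Poly p → Poly r → Poly (p ⊞ r)
  Poly-⊞ (M , d) (N , e) = M + N , Deg<-⊞ (Deg<-mono (ℕ.m≤m+n M N) d) (Deg<-mono (ℕ.m≤n+m N M) e)

  Poly-⊟ : ∀ {p} → Poly p → Poly (⊟ p)
  Poly-⊟ (M , d) = M , Deg<-⊟ d

  Poly-• : ∀ {p} c → Poly p → Poly (c • p)
  Poly-• c (M , d) = M , Deg<-• c d

  Poly-⊠ : ∀ {p r} → Poly p → Poly r → Poly (p ⊠ r)
  Poly-⊠ (M , d) (N , e) = M + N , Deg<-⊠ M N d (Deg<-mono (ℕ.n≤1+n N) e)

  Poly-0 : Poly 0s
  Poly-0 = 0 , λ _ _ → refl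

  Poly-1 : Poly 1s
  Poly-1 = 1 , Deg<-X^ 0

  Exact : ℕ → Seq → Set
  Exact d p = Deg< (suc d) p × p d ≢ 0F

  Exact⇒Poly : ∀ {d p} → Exact d p → Poly p
  Exact⇒Poly {d} (e , _) = suc d , e

  Exact-cong : ∀ {d p r} → p ≈ r → Exact d p → Exact d r
  Exact-cong {d} e (lt , ne) = Deg<-cong e lt , λ z → ne (trans (at e d) z)

  zero-or-exact : ∀ N {p} → Deg< N p → p ≈ 0s ⊎ ∃ λ d → d < N × Exact d p
  zero-or-exact zero    lt = inj₁ (Deg<0 lt)
  zero-or-exact (suc N) {p} lt with p N ≟ 0F
  ... | no ne  = inj₂ (N , ℕ.≤-refl , lt , ne)
  ... | yes eq with zero-or-exact N {p} lower
    where
    lower : Deg< N p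
    lower k le with ℕ.m≤n⇒m<n∨m≡n le
    ... | inj₁ N<k  = lt k N<k
    ... | inj₂ refl = eq
  ... | inj₁ z              = inj₁ z
  ... | inj₂ (d , d<N , ex) = inj₂ (d , ℕ.m≤n⇒m≤1+n d<N , ex)

  Exact-⊠ : ∀ {a b p r} → Exact a p → Exact b r → Exact (a + b) (p ⊠ r)
  Exact-⊠ {a} {b} (d , ne) (e , nf) = Deg<-⊠ (suc a) b d e , λ z → *-nonzero ne nf (trans (sym (⊠-top a b d e)) z)

  domain : ∀ {d x z} → Exact d x → Poly z → x ⊠ z ≈ 0s → z ≈ 0s
  domain {d} ex (N , lt) eq with zero-or-exact N lt
  ... | inj₁ z            = z
  ... | inj₂ (e , _ , ez) = ⊥-elim (proj₂ (Exact-⊠ ex ez) (at eq (d + e)))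

  ⊞-⊟-zero : ∀ {p r} → p ⊞ ⊟ r ≈ 0s → p ≈ r
  ⊞-⊟-zero eq = mk≈ (λ k → ⊝-zero (at eq k))

  ≈⇒⊞-⊟ : ∀ {p r} → p ≈ r → p ⊞ ⊟ r ≈ 0s
  ≈⇒⊞-⊟ {p} {r} eq = mk≈ (λ k → trans (cong (_⊝ r k) (at eq k)) (⊝-self (r k)))

  cancelˡ : ∀ {d x z w} → Exact d x → Poly z → Poly w → x ⊠ z ≈ x ⊠ w → z ≈ w
  cancelˡ {x = x} {z} {w} ex pz pw eq = ⊞-⊟-zero (domain ex (Poly-⊞ pz (Poly-⊟ pw))
    (≈-trans (solve 3 (λ x z w → x :* (z :+ :- w) := x :* z :+ :- (x :* w)) ≈-refl x z w) (≈⇒⊞-⊟ eq)))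

  quotient-degree : ∀ {d n x k} → Exact d x → Poly k → Deg< (d + n) (x ⊠ k) → Deg< n k
  quotient-degree {d} {n} ex (N , lt) bound with zero-or-exact N lt
  ... | inj₁ z = λ k _ → at z k
  ... | inj₂ (e , _ , ek) with e ℕ.<? n
  ... | yes e<n = Deg<-mono e<n (proj₁ ek)
  ... | no e≮n  = ⊥-elim (proj₂ (Exact-⊠ ex ek) (bound (d + e) (ℕ.+-monoʳ-≤ d (ℕ.≮⇒≥ e≮n))))

  divide : ∀ {d g} → Exact d g → ∀ N {f} → Deg< N f → ∃ λ Q → ∃ λ r → Poly Q × Deg< d r × f ≈ g ⊠ Q ⊞ r
  divide {d} {g} (lg , ng) N lf with N ℕ.≤? d
  ... | yes N≤d = 0s , _ , Poly-0 , Deg<-mono N≤d lf , ≈-sym (≈-trans (SR.+-congʳ (SR.zeroʳ g)) (SR.+-identityˡ _))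
  divide {d} {g} (lg , ng) zero lf | no N≰d = ⊥-elim (N≰d z≤n)
  divide {d} {g} (lg , ng) (suc N) {f} lf | no N≰d
    with split-≤ (ℕ.s≤s⁻¹ (ℕ.≰⇒> N≰d)) | inverse (g d) ng
  ... | j , refl | i , inv = step (divide (lg , ng) (d + j) lower)
    where
    c = f (d + j) ⊙ i
    m = c • (X^ j ⊠ g)
    f′ = f ⊞ ⊟ m
    m-deg : Deg< (suc (d + j)) m
    m-deg = Deg<-• c (Deg<-mono (ℕ.≤-reflexive (cong suc (ℕ.+-comm j d))) (Deg<-⊠ (suc j) d (Deg<-X^ j) lg))
    m-top : m (d + j) ≡ f (d + j)
    m-top = begin
      c ⊙ (X^ j ⊠ g) (d + j)     ≡⟨ cong (λ k → c ⊙ (X^ j ⊠ g) k) (ℕ.+-comm d j) ⟩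
      c ⊙ (X^ j ⊠ g) (j + d)     ≡⟨ cong (c ⊙_) (X^-shift j g d) ⟩
      f (d + j) ⊙ i ⊙ g d        ≡⟨ FR.*-assoc _ _ _ ⟩
      f (d + j) ⊙ (i ⊙ g d)      ≡⟨ cong (f (d + j) ⊙_) (trans (FR.*-comm i (g d)) inv) ⟩
      f (d + j) ⊙ 1F             ≡⟨ FR.*-identityʳ _ ⟩
      f (d + j) ∎
      where open ≡-Reasoning
    lower : Deg< (d + j) f′
    lower k le with ℕ.m≤n⇒m<n∨m≡n le
    ... | inj₁ lt   = Deg<-⊞ lf (Deg<-⊟ m-deg) k lt
    ... | inj₂ refl = trans (cong (f (d + j) ⊝_) m-top) (⊝-self (f (d + j)))
    step : (∃ λ Q → ∃ λ r → Poly Q × Deg< d r × f′ ≈ g ⊠ Q ⊞ r) → ∃ λ Q → ∃ λ r → Poly Q × Deg< d r × f ≈ g ⊠ Q ⊞ r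
    step (Q , r , pQ , lr , eq) = Q ⊞ c • X^ j , r , Poly-⊞ pQ (Poly-• c (suc j , Deg<-X^ j)) , lr , (begin
      f                                     ≈⟨ solve 2 (λ f m → f := (f :+ :- m) :+ m) ≈-refl f m ⟩
      f′ ⊞ m                                ≈⟨ SR.+-cong eq (•≈⊠ c (X^ j ⊠ g)) ⟩
      g ⊠ Q ⊞ r ⊞ (c • 1s) ⊠ (X^ j ⊠ g)     ≈⟨ solve 5 (λ g Q r c x → g :* Q :+ r :+ c :* (x :* g) := g :* (Q :+ c :* x) :+ r) ≈-refl g Q r (c • 1s) (X^ j) ⟩
      g ⊠ (Q ⊞ (c • 1s) ⊠ X^ j) ⊞ r         ≈⟨ SR.+-congʳ (SR.*-congˡ (SR.+-congˡ (•≈⊠ c (X^ j)))) ⟨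
      g ⊠ (Q ⊞ c • X^ j) ⊞ r ∎)
      where open import Relation.Binary.Reasoning.Setoid SR.setoid

  -- Bezout's identity is kept for the cofactors instead of for f and g. Coprimality is used in this
  -- form, and it survives the Euclidean algorithm without any division by x.
  record GCD (f g : Seq) : Set where
    field
      x k k′ α β : Seq
      d : ℕ
      x-exact : Exact d x
      k-poly : Poly k
      k′-poly : Poly k′
      α-poly : Poly α
      β-poly : Poly β
      f≈ : f ≈ x ⊠ k
      g≈ : g ≈ x ⊠ k′
      bezout : α ⊠ k ⊞ β ⊠ k′ ≈ 1s

  gcd : ∀ N {d f g} → Exact d f → Deg< N g → GCD f g
  gcd N {d} {f} {g} ef lg with zero-or-exact N lg
  ... | inj₁ g≈0 = record
    { x = f ; k = 1s ; k′ = 0s ; α = 1s ; β = 0s ; d = d ; x-exact = ef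
    ; k-poly = Poly-1 ; k′-poly = Poly-0 ; α-poly = Poly-1 ; β-poly = Poly-0
    ; f≈ = ≈-sym (SR.*-identityʳ f) ; g≈ = ≈-trans g≈0 (≈-sym (SR.zeroʳ f))
    ; bezout = ≈-trans (SR.+-cong (SR.*-identityˡ 1s) (SR.zeroˡ 0s)) (SR.+-identityʳ 1s) }
  gcd zero ef lg | inj₂ (_ , () , _)
  gcd (suc N) {f = f} {g} ef lg | inj₂ (e , s≤s e≤N , eg) with divide eg _ (proj₁ ef)
  ... | Q , r , pQ , lr , eq = record
    -- From g = x k and r = x k′ follows f = g Q + r = x (k Q + k′); the Bezout coefficients are
    -- adapted to the new pair k Q + k′ and k.
    { x = x ; k = k ⊠ Q ⊞ k′ ; k′ = k ; α = β ; β = α ⊞ ⊟ (β ⊠ Q) ; d = d ; x-exact = x-exact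
    ; k-poly = Poly-⊞ (Poly-⊠ k-poly pQ) k′-poly ; k′-poly = k-poly
    ; α-poly = β-poly ; β-poly = Poly-⊞ α-poly (Poly-⊟ (Poly-⊠ β-poly pQ))
    ; f≈ = ≈-trans eq (≈-trans (SR.+-cong (SR.*-congʳ f≈) g≈)
        (solve 4 (λ x k Q k′ → (x :* k) :* Q :+ x :* k′ := x :* (k :* Q :+ k′)) ≈-refl x k Q k′))
    ; g≈ = f≈
    ; bezout = ≈-trans (solve 5 (λ a b k Q k′ → b :* (k :* Q :+ k′) :+ (a :+ :- (b :* Q)) :* k := a :* k :+ b :* k′) ≈-refl α β k Q k′) bezout }
    where open GCD (gcd N eg (Deg<-mono e≤N lr))

  -- The quotient is explicit because divisibility among power series would not make it a
  -- polynomial, and its degree is needed later.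
  coprime-divides : ∀ {α β k k′ j l} → α ⊠ k ⊞ β ⊠ k′ ≈ 1s → k ⊠ j ≈ k′ ⊠ l → l ≈ k ⊠ (α ⊠ l ⊞ β ⊠ j)
  coprime-divides {α} {β} {k} {k′} {j} {l} bez eq = begin
    l                             ≈⟨ SR.*-identityˡ l ⟨
    1s ⊠ l                        ≈⟨ SR.*-congʳ bez ⟨
    (α ⊠ k ⊞ β ⊠ k′) ⊠ l          ≈⟨ solve 5 (λ a b k k′ l → (a :* k :+ b :* k′) :* l := a :* k :* l :+ b :* (k′ :* l)) ≈-refl α β k k′ l ⟩
    α ⊠ k ⊠ l ⊞ β ⊠ (k′ ⊠ l)      ≈⟨ SR.+-congˡ (SR.*-congˡ eq) ⟨
    α ⊠ k ⊠ l ⊞ β ⊠ (k ⊠ j)       ≈⟨ solve 5 (λ a b k j l → a :* k :* l :+ b :* (k :* j) := k :* (a :* l :+ b :* j)) ≈-refl α β k j l ⟩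
    k ⊠ (α ⊠ l ⊞ β ⊠ j) ∎
    where open import Relation.Binary.Reasoning.Setoid SR.setoid

-- Palindromes x y* + y x* and the number of pairs for which they vanish.

module PalindromicPairs (F : FiniteField) where

  open import Data.Nat using (_+_; _*_; _^_; _≤_)
  open import Data.Vec using ([])
  open import Data.List using ([])
  open FiniteSums
  open FieldSums F
  open PowerSeries F
  open Polynomials F
  open SS using (solve; _:=_; _:+_; _:*_; _:-_; :-_)

  -- The polarisation of x ↦ x x*.
  P : ℕ → Seq → Seq → Seq
  P a x y = x ⊠ rev a y ⊞ y ⊠ rev a x

  P-cong : ∀ a {x x′ y y′} → x ≈ x′ → y ≈ y′ → P a x y ≈ P a x′ y′
  P-cong a e f = SR.+-cong (SR.*-cong e (rev-cong a f)) (SR.*-cong f (rev-cong a e))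

  P-⊞ˡ : ∀ a x x′ y → P a (x ⊞ x′) y ≈ P a x y ⊞ P a x′ y
  P-⊞ˡ a x x′ y = ≈-trans (SR.+-congˡ (SR.*-congˡ (rev-⊞ a x x′)))
    (solve 6 (λ x x′ y rx rx′ ry → (x :+ x′) :* ry :+ y :* (rx :+ rx′) := (x :* ry :+ y :* rx) :+ (x′ :* ry :+ y :* rx′)) ≈-refl
      x x′ y (rev a x) (rev a x′) (rev a y))

  P-⊟ˡ : ∀ a x y → P a (⊟ x) y ≈ ⊟ P a x y
  P-⊟ˡ a x y = ≈-trans (SR.+-congˡ (SR.*-congˡ (rev-⊟ a x)))
    (solve 4 (λ x y rx ry → (:- x) :* ry :+ y :* (:- rx) := :- (x :* ry :+ y :* rx)) ≈-refl x y (rev a x) (rev a y))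

  P-•ˡ : ∀ a c x y → P a (c • x) y ≈ c • P a x y
  P-•ˡ a c x y = ≈-trans (SR.+-cong (SR.*-congʳ (•≈⊠ c x)) (SR.*-congˡ (≈-trans (rev-• a c x) (•≈⊠ c (rev a x)))))
    (≈-trans (solve 5 (λ c x y rx ry → (c :* x) :* ry :+ y :* (c :* rx) := c :* (x :* ry :+ y :* rx)) ≈-refl (c • 1s) x y (rev a x) (rev a y))
      (≈-sym (•≈⊠ c (P a x y))))

  Palindrome : ℕ → Seq → Set
  Palindrome n z = Deg< (suc n) z × rev n z ≈ z

  P-palindrome : ∀ a {x y} → Deg< (suc a) x → Deg< (suc a) y → Palindrome (a + a) (P a x y)
  P-palindrome a {x} {y} dx dy =
    Deg<-⊞ (Deg<-⊠ (suc a) a dx (Deg<-rev a y)) (Deg<-⊠ (suc a) a dy (Deg<-rev a x)) ,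
    ≈-trans (rev-⊞ (a + a) _ _) (≈-trans (SR.+-cong (flip dx dy) (flip dy dx)) (SR.+-comm _ _))
    where
    flip : ∀ {x y} → Deg< (suc a) x → Deg< (suc a) y → rev (a + a) (x ⊠ rev a y) ≈ y ⊠ rev a x
    flip {x} {y} dx dy = ≈-trans (rev-⊠ a a dx (Deg<-rev a y)) (≈-trans (SR.*-congˡ (rev-involutive a dy)) (SR.*-comm (rev a x) y))

  -- The degree drops when x has constant term 0, hence the existential; what counts is that the
  -- reversal is nonzero, its constant term being the leading coefficient.
  rev-exact : ∀ {d x} → Exact d x → ∃ λ e → Exact e (rev d x)
  rev-exact {d} {x} (lt , ne) with zero-or-exact (suc d) (Deg<-rev d x)
  ... | inj₂ (e , _ , ex) = e , ex
  ... | inj₁ z            = ⊥-elim (ne (trans (sym (rev-0 d x)) (at z 0)))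

  rev-square-zero : ∀ a {h} → Deg< (suc a) h → h ⊠ rev a h ≈ 0s → h ≈ 0s
  rev-square-zero a {h} lt eq with zero-or-exact (suc a) lt
  ... | inj₁ z            = z
  ... | inj₂ (e , _ , ex) = ≈-trans (≈-sym (rev-involutive a lt)) (≈-trans (rev-cong a (domain ex (suc a , Deg<-rev a h) eq)) rev-0s)
    where
    rev-0s : rev a 0s ≈ 0s
    rev-0s = rev-unique a (λ _ _ → refl) (λ _ _ _ → refl)

  module _ (2≢0 : 2F ≢ 0F) where

    ½ : Carrier
    ½ = proj₁ (inverse 2F 2≢0)

    ½-double : ∀ x → ½ ⊙ x ⊕ ½ ⊙ x ≡ x
    ½-double x = begin
      ½ ⊙ x ⊕ ½ ⊙ x                 ≡⟨ FR.*-identityˡ _ ⟨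
      1F ⊙ (½ ⊙ x ⊕ ½ ⊙ x)          ≡⟨ FS.solve 3 (λ o h x → o FS.:* (h FS.:* x FS.:+ h FS.:* x) FS.:= (o FS.:+ o) FS.:* h FS.:* x) refl 1F ½ x ⟩
      2F ⊙ ½ ⊙ x                    ≡⟨ cong (_⊙ x) (proj₂ (inverse 2F 2≢0)) ⟩
      1F ⊙ x                        ≡⟨ FR.*-identityˡ x ⟩
      x ∎
      where open ≡-Reasoning

    double-zero : ∀ x → x ⊕ x ≡ 0F → x ≡ 0F
    double-zero x eq = cancel-nonzero 2≢0 (trans (FR.distribʳ x 1F 1F) (trans (cong₂ _⊕_ (FR.*-identityˡ x) (FR.*-identityˡ x)) eq))

    -- Coordinates p on the palindromes z of degree at most 2a, chosen so that t^a p + p* = z. The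
    -- middle coefficient receives two contributions and is therefore halved.
    upperHalf : ℕ → Seq → Seq
    upperHalf a z zero    = ½ ⊙ z a
    upperHalf a z (suc j) = z (a + suc j)

    upperHalf-cong : ∀ a {z w} → z ≈ w → upperHalf a z ≈ upperHalf a w
    upperHalf-cong a e = mk≈ λ where
      zero    → cong (½ ⊙_) (at e a)
      (suc j) → at e (a + suc j)

    Deg<-upperHalf : ∀ a {z} → Deg< (suc (a + a)) z → Deg< (suc a) (upperHalf a z)
    Deg<-upperHalf a d (suc j) le = d (a + suc j) (ℕ.≤-trans (ℕ.≤-reflexive (sym (ℕ.+-suc a a))) (ℕ.+-monoʳ-≤ a le))

    palindrome-upperHalf : ∀ a {z} → Palindrome (a + a) z → P a (upperHalf a z) 1s ≈ z
    palindrome-upperHalf a {z} (lt , pal) = ≈-trans (SR.+-cong (≈-trans (SR.*-congˡ (rev-1 a)) (SR.*-comm p (X^ a))) (SR.*-identityˡ (rev a p))) (mk≈ go)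
      where
      p = upperHalf a z
      go : ∀ k → (X^ a ⊠ p ⊞ rev a p) k ≡ z k
      go k with k ℕ.<? a
      go k | yes k<a with split-≤ k<a
      ... | j , refl = begin
        (X^ a ⊠ p) k ⊕ rev (suc (k + j)) p k   ≡⟨ cong₂ _⊕_ (X^-below a p k k<a) (trans (cong (λ n → rev n p k) (sym (ℕ.+-suc k j))) (rev-at k (suc j) p)) ⟩
        0F ⊕ z (suc (k + j) + suc j)           ≡⟨ FR.+-identityˡ _ ⟩
        z (suc (k + j) + suc j)                ≡⟨ rev-at k (suc (k + j) + suc j) z ⟨
        rev (k + (suc (k + j) + suc j)) z k    ≡⟨ cong (λ n → rev n z k) index ⟩
        rev (a + a) z k                        ≡⟨ at pal k ⟩
        z k ∎
        where
        open ≡-Reasoning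
        index : k + (suc (k + j) + suc j) ≡ suc (k + j) + suc (k + j)
        index = trans (ℕ.+-comm k _) (trans (ℕ.+-assoc (suc (k + j)) (suc j) k) (cong (_+_ (suc (k + j))) (cong suc (ℕ.+-comm j k))))
      go k | no k≮a with split-≤ (ℕ.≮⇒≥ k≮a)
      ... | zero  , refl = trans (cong₂ _⊕_ (X^-shift a p 0) (trans (rev-index (ℕ.+-identityʳ a)) (rev-at a 0 p))) (trans (½-double (z a)) (cong z (sym (ℕ.+-identityʳ a))))
        where
        rev-index : ∀ {b} → b ≡ a → rev a p b ≡ rev b p a
        rev-index refl = refl
      ... | suc j , refl = trans (cong₂ _⊕_ (X^-shift a p (suc j)) (Deg<-rev a p (a + suc j) (ℕ.≤-trans (s≤s (ℕ.m≤m+n a j)) (ℕ.≤-reflexive (sym (ℕ.+-suc a j))))))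
        (FR.+-identityʳ _)

    palVec : ∀ a → Seq → Seq → Vec Carrier (suc a)
    palVec a x y = vec (suc a) (upperHalf a (P a x y))

    P-palVec : ∀ a {x y} → Deg< (suc a) x → Deg< (suc a) y → P a (seq (palVec a x y)) 1s ≈ P a x y
    P-palVec a {x} {y} dx dy = ≈-trans (P-cong a (seq-vec (suc a) (Deg<-upperHalf a (proj₁ pal))) ≈-refl) (palindrome-upperHalf a pal)
      where pal = P-palindrome a dx dy

    -- Stated on the a + 1 coordinates of the palindrome, which makes the condition decidable and so
    -- countable.
    Vanishes : ∀ a → Vec Carrier a → Vec Carrier a → Set
    Vanishes a x y = palVec a (seq x) (seq y) ≡ vec (suc a) 0s

    vanishes? : ∀ a x y → Dec (Vanishes a x y)
    vanishes? a x y = palVec a (seq x) (seq y) ≟V vec (suc a) 0s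

    Deg<-seq′ : ∀ {a} (x : Vec Carrier a) → Deg< (suc a) (seq x)
    Deg<-seq′ {a} x = Deg<-mono (ℕ.n≤1+n a) (Deg<-seq x)

    vanishes⇒P≈0 : ∀ a {x y} → Vanishes a x y → P a (seq x) (seq y) ≈ 0s
    vanishes⇒P≈0 a {x} {y} eq = begin
      P a (seq x) (seq y)                            ≈⟨ P-palVec a (Deg<-seq′ x) (Deg<-seq′ y) ⟨
      P a (seq (palVec a (seq x) (seq y))) 1s        ≡⟨ cong (λ v → P a (seq v) 1s) eq ⟩
      P a (seq (vec (suc a) 0s)) 1s                  ≈⟨ P-cong a (≈-trans (seq-vec (suc a) (λ _ _ → refl)) (≈-sym 0•)) ≈-refl ⟩
      P a (0F • 0s) 1s                               ≈⟨ P-•ˡ a 0F 0s 1s ⟩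
      0F • P a 0s 1s                                 ≈⟨ mk≈ (λ k → FR.zeroˡ _) ⟩
      0s ∎
      where
      open import Relation.Binary.Reasoning.Setoid SR.setoid
      0• : 0F • 0s ≈ 0s
      0• = mk≈ (λ k → FR.zeroˡ 0F)

    Param : ℕ → ℕ × ℕ → Set
    Param a (d , e) = Vec Carrier (suc d) × Vec Carrier (suc e) × Vec Carrier (suc (a ∸ (d + e)))

    -- x + y = X k and x - y = X · rev (k s).
    plusMinus : ∀ a i → Param a i → Seq × Seq
    plusMinus a (d , e) (X , k , s) = seq X ⊠ seq k , seq X ⊠ rev (a ∸ d) (seq k ⊠ seq s)

    param : ∀ a i → Param a i → Vec Carrier a × Vec Carrier a
    param a i w = let h , h′ = plusMinus a i w in vec a (½ • (h ⊞ h′)) , vec a (½ • (h ⊞ ⊟ h′))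

    params : ∀ a i → List (Param a i)
    params a (d , e) with d + e ℕ.≤? a
    ... | yes _ = cartesianProduct (vecs (suc d)) (cartesianProduct (vecs (suc e)) (vecs (suc (a ∸ (d + e)))))
    ... | no _  = []

    params-complete : ∀ a d e → d + e ≤ a → ∀ w → w ∈ params a (d , e)
    params-complete a d e le (X , k , s) with d + e ℕ.≤? a
    ... | yes _ = ∈-cartesianProduct⁺ (vecs-complete X) (∈-cartesianProduct⁺ (vecs-complete k) (vecs-complete s))
    ... | no nle = ⊥-elim (nle le)

    -- The lengths d + 1, e + 1 and a - d - e + 1 always add up to a + 3: whatever the degrees of
    -- the gcd and of its cofactor, s fills up the rest. So R(a) costs no more than the (a + 1)²
    -- choices of degrees.
    params-length : ∀ a i → length (params a i) ≤ q ^ (3 + a)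
    params-length a (d , e) with d + e ℕ.≤? a
    ... | no _   = z≤n
    ... | yes le = ℕ.≤-reflexive (begin
      length (cartesianProduct (vecs (suc d)) _)
        ≡⟨ length-cartesianProductWith _,_ (vecs (suc d)) _ ⟩
      length (vecs (suc d)) * length (cartesianProduct (vecs (suc e)) (vecs (suc f)))
        ≡⟨ cong₂ _*_ (vecs-length (suc d)) (trans (length-cartesianProductWith _,_ (vecs (suc e)) _) (cong₂ _*_ (vecs-length (suc e)) (vecs-length (suc f)))) ⟩
      q ^ suc d * (q ^ suc e * q ^ suc f)
        ≡⟨ trans (cong (q ^ suc d *_) (sym (ℕ.^-distribˡ-+-* q (suc e) (suc f)))) (sym (ℕ.^-distribˡ-+-* q (suc d) _)) ⟩
      q ^ (suc d + (suc e + suc f))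
        ≡⟨ cong (q ^_) (trans (cong suc (trans (ℕ.+-suc d _) (cong suc (trans (cong (_+_ d) (ℕ.+-suc e f)) (ℕ.+-suc d _)))))
             (cong (_+_ 3) (trans (sym (ℕ.+-assoc d e f)) (ℕ.m+[n∸m]≡n le)))) ⟩
      q ^ (3 + a) ∎)
      where
      open ≡-Reasoning
      f = a ∸ (d + e)

    halves : ∀ {a} (x y : Vec Carrier a) {h h′} → seq x ⊞ seq y ≈ h → seq x ⊞ ⊟ seq y ≈ h′ →
      (vec a (½ • (h ⊞ h′)) , vec a (½ • (h ⊞ ⊟ h′))) ≡ (x , y)
    halves {a} x y {h} {h′} e f = cong₂ _,_
      (trans (vec-cong a (mk≈ (λ k → trans (cong₂ (λ u v → ½ ⊙ (u ⊕ v)) (sym (at e k)) (sym (at f k)))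
        (trans (FS.solve 3 (λ h x y → h FS.:* ((x FS.:+ y) FS.:+ (x FS.:+ FS.:- y)) FS.:= h FS.:* x FS.:+ h FS.:* x) refl ½ (seq x k) (seq y k)) (½-double _))))) (vec-seq x))
      (trans (vec-cong a (mk≈ (λ k → trans (cong₂ (λ u v → ½ ⊙ (u ⊝ v)) (sym (at e k)) (sym (at f k)))
        (trans (FS.solve 3 (λ h x y → h FS.:* ((x FS.:+ y) FS.:- (x FS.:+ FS.:- y)) FS.:= h FS.:* y FS.:+ h FS.:* y) refl ½ (seq x k) (seq y k)) (½-double _))))) (vec-seq y))

    -- With h = x + y and h′ = x - y the equation reads h h* = h′ h′*. Writing h = X k and h′ = X k′ with k, k′ coprime,
    -- k k* = k′ k′* forces k to divide k′*.
    cover : ∀ a (x y : Vec Carrier a) → P a (seq x) (seq y) ≈ 0s →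
      Σ (ℕ × ℕ) λ i → i ∈ cartesianProduct (upTo (suc a)) (upTo (suc a)) × Σ (Param a i) λ w → w ∈ params a i × param a i w ≡ (x , y)
    cover a x y P≈0 = result (zero-or-exact (suc a) h-deg)
      where
      open import Relation.Binary.Reasoning.Setoid SR.setoid
      h  = seq x ⊞ seq y
      h′ = seq x ⊞ ⊟ seq y
      h-deg : Deg< (suc a) h
      h-deg = Deg<-⊞ (Deg<-seq′ x) (Deg<-seq′ y)
      h′-deg : Deg< (suc a) h′
      h′-deg = Deg<-⊞ (Deg<-seq′ x) (Deg<-⊟ (Deg<-seq′ y))
      norms : h ⊠ rev a h ≈ h′ ⊠ rev a h′
      norms = begin
        h ⊠ rev a h
          ≈⟨ SR.*-congˡ (rev-⊞ a _ _) ⟩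
        (seq x ⊞ seq y) ⊠ (rev a (seq x) ⊞ rev a (seq y))
          ≈⟨ solve 4 (λ x y rx ry → (x :+ y) :* (rx :+ ry) := ((x :* ry :+ y :* rx) :+ (x :* ry :+ y :* rx)) :+ (x :+ :- y) :* (rx :+ :- ry))
               ≈-refl (seq x) (seq y) (rev a (seq x)) (rev a (seq y)) ⟩
        (P a (seq x) (seq y) ⊞ P a (seq x) (seq y)) ⊞ (seq x ⊞ ⊟ seq y) ⊠ (rev a (seq x) ⊞ ⊟ rev a (seq y))
          ≈⟨ SR.+-cong (SR.+-cong P≈0 P≈0) (SR.*-congˡ (≈-trans (SR.+-congˡ (≈-sym (rev-⊟ a (seq y)))) (≈-sym (rev-⊞ a _ _)))) ⟩
        (0s ⊞ 0s) ⊞ h′ ⊠ rev a h′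
          ≈⟨ ≈-trans (SR.+-congʳ (SR.+-identityˡ 0s)) (SR.+-identityˡ _) ⟩
        h′ ⊠ rev a h′ ∎
      in-range : ∀ {d e} → d + e ≤ a → (d , e) ∈ cartesianProduct (upTo (suc a)) (upTo (suc a))
      in-range {d} {e} le = ∈-cartesianProduct⁺ (∈-upTo⁺ (s≤s (ℕ.≤-trans (ℕ.m≤m+n d e) le))) (∈-upTo⁺ (s≤s (ℕ.≤-trans (ℕ.m≤n+m e d) le)))
      result : h ≈ 0s ⊎ (∃ λ d → d < suc a × Exact d h) → _
      -- For x + y = 0 no gcd is taken: the norm equation forces x - y = 0 too, and the parameters 0
      -- of shape (0 , 0) represent the pair.
      result (inj₁ h≈0) = (0 , 0) , in-range z≤n , w , params-complete a 0 0 z≤n w ,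
        halves x y (≈-trans h≈0 (≈-sym z₁)) (≈-trans h′≈0 (≈-sym (zeroˡ′ _)))
        where
        w = vec 1 0s , vec 1 0s , vec (suc a) 0s
        h′≈0 : h′ ≈ 0s
        h′≈0 = rev-square-zero a h′-deg (≈-trans (≈-sym norms) (≈-trans (SR.*-congʳ h≈0) (SR.zeroˡ _)))
        zeroˡ′ : ∀ r → seq (vec 1 0s) ⊠ r ≈ 0s
        zeroˡ′ r = ≈-trans (SR.*-congʳ (seq-vec 1 (λ _ _ → refl))) (SR.zeroˡ r)
        z₁ = zeroˡ′ (seq (vec 1 0s))
      result (inj₂ (d₀ , d₀≤a , h-exact)) = from-gcd (gcd (suc a) h-exact h′-deg)
        where
        from-gcd : GCD h h′ → _
        from-gcd G = from-k (zero-or-exact _ (proj₂ k-poly))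
          where
          open GCD G renaming (x to X)
          from-k : k ≈ 0s ⊎ (∃ λ e → e < proj₁ k-poly × Exact e k) → _
          from-k (inj₁ k≈0) = ⊥-elim (proj₂ h-exact (at (≈-trans f≈ (≈-trans (SR.*-congˡ k≈0) (SR.zeroʳ X))) d₀))
          from-k (inj₂ (e , _ , k-exact)) = (d , e) , in-range d+e≤a , w , params-complete a d e d+e≤a w ,
            halves x y (≈-trans f≈ (≈-sym (SR.*-cong X≈ k≈)))
              (≈-trans g≈ (SR.*-cong (≈-sym X≈) (≈-trans (≈-sym (rev-involutive E k′-deg))
                (rev-cong E (≈-trans s≈ (SR.*-cong (≈-sym k≈) (≈-sym S≈)))))))
            where
            d+e≤a : d + e ≤ a
            d+e≤a with d + e ℕ.≤? a
            ... | yes le = le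
            ... | no nle = ⊥-elim (proj₂ (Exact-⊠ x-exact k-exact) (trans (sym (at f≈ (d + e))) (h-deg (d + e) (ℕ.≰⇒> nle))))
            E f : ℕ
            E = a ∸ d
            f = a ∸ (d + e)
            d≤a : d ≤ a
            d≤a = ℕ.≤-trans (ℕ.m≤m+n d e) d+e≤a
            d+E : d + E ≡ a
            d+E = ℕ.m+[n∸m]≡n d≤a
            e+f : e + f ≡ E
            e+f = trans (cong (_+_ e) (sym (ℕ.∸-+-assoc a d e))) (ℕ.m+[n∸m]≡n (subst (_≤ E) (ℕ.m+n∸m≡n d e) (ℕ.∸-monoˡ-≤ d d+e≤a)))
            k-deg : Deg< (suc E) k
            k-deg = Deg<-mono (s≤s (subst (e ≤_) e+f (ℕ.m≤m+n e f))) (proj₁ k-exact)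
            k′-deg : Deg< (suc E) k′
            k′-deg = quotient-degree x-exact k′-poly (Deg<-cong g≈ (Deg<-mono (ℕ.≤-reflexive (sym (trans (ℕ.+-suc d E) (cong suc d+E)))) h′-deg))
            norm : ∀ {z l} → z ≈ X ⊠ l → Deg< (suc E) l → z ⊠ rev a z ≈ X ⊠ (rev d X ⊠ (l ⊠ rev E l))
            norm {z} {l} eq l-deg = begin
              z ⊠ rev a z                           ≈⟨ SR.*-cong eq (≈-trans (rev-cong a eq) (mk≈ (λ i → cong (λ n → rev n (X ⊠ l) i) (sym d+E)))) ⟩
              (X ⊠ l) ⊠ rev (d + E) (X ⊠ l)         ≈⟨ SR.*-congˡ (rev-⊠ d E (proj₁ x-exact) l-deg) ⟩
              (X ⊠ l) ⊠ (rev d X ⊠ rev E l)         ≈⟨ solve 4 (λ x l rx rl → (x :* l) :* (rx :* rl) := x :* (rx :* (l :* rl))) ≈-refl X l (rev d X) (rev E l) ⟩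
              X ⊠ (rev d X ⊠ (l ⊠ rev E l)) ∎
            rev-poly : ∀ l → Poly (rev E l)
            rev-poly l = suc E , Deg<-rev E l
            -- Cancelling X and X*, both nonzero, leaves the norm equation for the coprime cofactors
            -- in formal degree a - d.
            reduced : k ⊠ rev E k ≈ k′ ⊠ rev E k′
            reduced = cancelˡ (proj₂ (rev-exact x-exact)) poly poly′
              (cancelˡ x-exact (Poly-⊠ rX poly) (Poly-⊠ rX poly′) (≈-trans (≈-sym (norm f≈ k-deg)) (≈-trans norms (norm g≈ k′-deg))))
              where
              poly = Poly-⊠ k-poly (rev-poly k)
              poly′ = Poly-⊠ k′-poly (rev-poly k′)
              rX : Poly (rev d X)
              rX = suc d , Deg<-rev d X
            s : Seq
            s = α ⊠ rev E k′ ⊞ β ⊠ rev E k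
            s≈ : rev E k′ ≈ k ⊠ s
            s≈ = coprime-divides bezout reduced
            s-deg : Deg< (suc f) s
            s-deg = quotient-degree k-exact (Poly-⊞ (Poly-⊠ α-poly (rev-poly k′)) (Poly-⊠ β-poly (rev-poly k)))
              (Deg<-mono (ℕ.≤-reflexive (sym (trans (ℕ.+-suc e f) (cong suc e+f)))) (Deg<-cong s≈ (Deg<-rev E k′)))
            w = vec (suc d) X , vec (suc e) k , vec (suc f) s
            X≈ = seq-vec (suc d) (proj₁ x-exact)
            k≈ = seq-vec (suc e) (proj₁ k-exact)
            S≈ = seq-vec (suc f) s-deg

    R : ℕ → ℤ
    R a = SumV a (λ y → SumV a (λ x → 𝟙 (vanishes? a x y)))

    R-bound : ∀ a → R a ℤ.≤ + ((suc a * suc a) * q ^ (3 + a))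
    R-bound a = ℤ.≤-trans (ℤ.≤-reflexive (trans (Sum-swap (vecs a) (vecs a) _) (sym (Sum-cartesian _,_ (vecs a) (vecs a) _))))
      (ℤ.≤-trans (Sum-cover (cartesianProduct (vecs a) (vecs a)) (Unique.cartesianProduct⁺ (vecs-unique a) (vecs-unique a))
          (λ xy → vanishes? a (proj₁ xy) (proj₂ xy)) (Product.≡-dec _≟V_ _≟V_) shapes (Param a) (params a) (param a)
          (λ {xy} _ v → cover a (proj₁ xy) (proj₂ xy) (vanishes⇒P≈0 a {proj₁ xy} {proj₂ xy} v)))
      (ℤ.≤-trans (Sum-mono shapes (λ i → +≤+ (params-length a i)))
        (ℤ.≤-reflexive (trans (Sum-const shapes (+ (q ^ (3 + a)))) (trans (sym (ℤ.pos-* (length shapes) _))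
          (cong (λ l → + (l * q ^ (3 + a))) (trans (length-cartesianProductWith _,_ (upTo (suc a)) (upTo (suc a)))
            (cong₂ _*_ (List.length-upTo (suc a)) (List.length-upTo (suc a))))))))))
      where shapes = cartesianProduct (upTo (suc a)) (upTo (suc a))

-- Linear forms: equidistribution, differencing and fibres.

module LinearForms (F : FiniteField) where

  open import Data.Nat using (_^_; _≤_)
  open import Data.Integer using (_*_)
  open import Data.Vec using ([]; _∷_)
  open FiniteSums
  open FieldSums F
  open PowerSeries F
  open Polynomials F
  open PalindromicPairs F
  open SS using (solve; _:=_; _:+_; _:*_; _:-_; :-_)

  record Linear (Λ : Seq → Carrier) : Set where
    field
      respects : ∀ {p r} → p ≈ r → Λ p ≡ Λ r
      add   : ∀ p r → Λ (p ⊞ r) ≡ Λ p ⊕ Λ r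
      scale : ∀ c p → Λ (c • p) ≡ c ⊙ Λ p

    zero-value : Λ 0s ≡ 0F
    zero-value = trans (respects (mk≈ {r = 0F • 0s} (λ _ → sym (FR.zeroˡ 0F)))) (trans (scale 0F 0s) (FR.zeroˡ _))

    negate : ∀ p → Λ (⊟ p) ≡ ⊖ Λ p
    negate p = begin
      Λ (⊟ p)                     ≡⟨ FS.solve 2 (λ a b → a FS.:= (b FS.:+ a) FS.:- b) refl (Λ (⊟ p)) (Λ p) ⟩
      (Λ p ⊕ Λ (⊟ p)) ⊝ Λ p       ≡⟨ cong (_⊝ Λ p) (trans (sym (add p (⊟ p))) (trans (respects (SR.-‿inverseʳ p)) zero-value)) ⟩
      0F ⊝ Λ p                    ≡⟨ FR.+-identityˡ _ ⟩
      ⊖ Λ p ∎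
      where open ≡-Reasoning

  coefficient-linear : ∀ n → Linear (λ p → p n)
  coefficient-linear n = record { respects = λ e → at e n ; add = λ _ _ → refl ; scale = λ _ _ → refl }

  ⊠-linear : ∀ {Λ} r → Linear Λ → Linear (λ p → Λ (r ⊠ p))
  ⊠-linear r L = record
    { respects  = λ e → respects (SR.*-congˡ e)
    ; add   = λ p s → trans (respects (SR.distribˡ r p s)) (add _ _)
    ; scale = λ c p → trans (respects (≈-trans (SR.*-congˡ (•≈⊠ c p))
        (≈-trans (solve 3 (λ r c p → r :* (c :* p) := c :* (r :* p)) ≈-refl r (c • 1s) p) (≈-sym (•≈⊠ c (r ⊠ p)))))) (scale c _) }
    where open Linear L

  SumV-reindex : ∀ n (σ τ : Vec Carrier n → Vec Carrier n) → (∀ v → σ (τ v) ≡ v) → (∀ v → τ (σ v) ≡ v) →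
    (f : Vec Carrier n → ℤ) → SumV n (λ v → f (σ v)) ≡ SumV n f
  SumV-reindex n = Sum-reindex (vecs n) (vecs-unique n) _≟V_ vecs-complete

  -- Induction on the length. If Λ(1) ≠ 0, summing over the lowest coordinate alone runs through the
  -- whole field and κ has total 0. Otherwise that coordinate drops out and p ↦ Λ(t p) takes over.
  equidistributed : ∀ a {Λ} → Linear Λ →
    (∀ (v : Vec Carrier a) → Λ (seq v) ≡ 0F) ⊎ (∀ c → SumV a (λ v → κ (Λ (seq v) ⊕ c)) ≡ 0ℤ)
  equidistributed zero {Λ} L = inj₁ λ where [] → Linear.zero-value L
  equidistributed (suc a) {Λ} L with Λ 1s ≟ 0F
  ... | no l≢0 = inj₂ λ c → begin
      SumV (suc a) (λ v → κ (Λ (seq v) ⊕ c))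
        ≡⟨ SumV-∷ a _ ⟩
      SumF (λ x → SumV a (λ v → κ (Λ (seq (x ∷ v)) ⊕ c)))
        ≡⟨ Sum-swap elements (vecs a) _ ⟩
      SumV a (λ v → SumF (λ x → κ (Λ (seq (x ∷ v)) ⊕ c)))
        ≡⟨ Sum-cong (vecs a) (λ v → trans (Sum-cong elements (λ x → cong κ (trans (cong (_⊕ c) (expand x v)) (FR.+-assoc _ _ c))))
             (trans (SumF-affine l≢0 (Λ (X^ 1 ⊠ seq v) ⊕ c) κ) κ-total)) ⟩
      SumV a (λ _ → 0ℤ)
        ≡⟨ Sum-zero (vecs a) ⟩
      0ℤ ∎
    where
    open ≡-Reasoning
    open Linear L
    expand : ∀ x v → Λ (seq (x ∷ v)) ≡ x ⊙ Λ 1s ⊕ Λ (X^ 1 ⊠ seq v)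
    expand x v = trans (respects (split-tail (seq (x ∷ v)))) (trans (add _ _) (cong (_⊕ Λ (X^ 1 ⊠ seq v)) (scale x 1s)))
  ... | yes l≡0 = Data.Sum.map (λ z → λ where (x ∷ v) → trans (expand x v) (z v))
      (λ z c → trans (SumV-∷ a _) (trans (Sum-cong elements (λ x → trans (Sum-cong (vecs a) (λ v → cong (λ u → κ (u ⊕ c)) (expand x v))) (z c))) (Sum-zero elements)))
      (equidistributed a (⊠-linear (X^ 1) L))
    where
    open Linear L
    expand : ∀ x v → Λ (seq (x ∷ v)) ≡ Λ (X^ 1 ⊠ seq v)
    expand x v = trans (respects (split-tail (seq (x ∷ v)))) (trans (add _ _) (trans (cong (_⊕ Λ (X^ 1 ⊠ seq v))
      (trans (scale x 1s) (trans (cong (x ⊙_) l≡0) (FR.zeroʳ x)))) (FR.+-identityˡ _)))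

  κSum : ∀ a → (Seq → Carrier) → ℤ
  κSum a Λ = SumV a (λ v → κ (Λ (seq v)))

  κSum-as-shift : ∀ a Λ → κSum a Λ ≡ SumV a (λ v → κ (Λ (seq v) ⊕ 0F))
  κSum-as-shift a Λ = Sum-cong (vecs a) (λ v → cong κ (sym (FR.+-identityʳ _)))

  κSum-nonneg : ∀ a {Λ} → Linear Λ → 0ℤ ℤ.≤ κSum a Λ
  κSum-nonneg a {Λ} L with equidistributed a L
  ... | inj₁ z = Sum-nonneg (vecs a) (λ v → subst (λ u → 0ℤ ℤ.≤ κ u) (sym (z v)) κ0-nonneg)
  ... | inj₂ e = ℤ.≤-reflexive (sym (trans (κSum-as-shift a Λ) (e 0F)))

  -- Either both sides are 0, or Λ vanishes on the box and κ(c) is compared with κ(0), the maximum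
  -- of κ. This is how inhomogeneous terms, among them all the ℓ_n, disappear.
  κSum-shift : ∀ a {Λ} → Linear Λ → ∀ c → SumV a (λ v → κ (Λ (seq v) ⊕ c)) ℤ.≤ κSum a Λ
  κSum-shift a {Λ} L c with equidistributed a L
  ... | inj₁ z = Sum-mono (vecs a) (λ v → subst (λ u → κ (Λ (seq v) ⊕ c) ℤ.≤ κ u) (sym (z v)) (κ≤κ0 _))
  ... | inj₂ e = ℤ.≤-reflexive (trans (e c) (sym (trans (κSum-as-shift a Λ) (e 0F))))

  -- A nonzero sum forces Λ to vanish on all vectors of length a, by `alive⇒vanishing`. Expressed
  -- through an integer, the property is decidable.
  alive? : ∀ a (Λ : Seq → Carrier) → Dec (κSum a Λ ≢ 0ℤ)
  alive? a Λ = ¬? (κSum a Λ ℤ.≟ 0ℤ)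

  alive⇒vanishing : ∀ a {Λ} → Linear Λ → κSum a Λ ≢ 0ℤ → ∀ (v : Vec Carrier a) → Λ (seq v) ≡ 0F
  alive⇒vanishing a {Λ} L alive with equidistributed a L
  ... | inj₁ z = z
  ... | inj₂ e = ⊥-elim (alive (trans (κSum-as-shift a Λ) (e 0F)))

  κSum-bound : ∀ a Λ → κSum a Λ ℤ.≤ + (q ^ a ℕ.* q) * 𝟙 (alive? a Λ)
  κSum-bound a Λ with κSum a Λ ℤ.≟ 0ℤ
  ... | yes z = ℤ.≤-reflexive (trans z (sym (ℤ.*-zeroʳ (+ (q ^ a ℕ.* q)))))
  ... | no _  = ℤ.≤-trans (Sum-mono (vecs a) (λ v → ℤ.≤-trans (κ≤κ0 _) κ0≤q))
    (ℤ.≤-reflexive (trans (SumV-const a (+ q)) (trans (sym (ℤ.pos-* (q ^ a) q)) (sym (ℤ.*-identityʳ _)))))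

  Sum-alive : ∀ a b (Λ : Vec Carrier b → Seq → Carrier) (N : ℤ) →
    SumV b (λ y → 𝟙 (alive? a (Λ y))) ℤ.≤ N → SumV b (λ y → κSum a (Λ y)) ℤ.≤ + (q ^ a ℕ.* q) * N
  Sum-alive a b Λ N le = ℤ.≤-trans (Sum-mono (vecs b) (λ y → κSum-bound a (Λ y)))
    (ℤ.≤-trans (ℤ.≤-reflexive (Sum-*ˡ (vecs b) (+ (q ^ a ℕ.* q)) _)) (*-mono-nonneg (pos-nonneg (q ^ a ℕ.* q)) le))

  infixl 6 _−ᵥ_
  _−ᵥ_ : ∀ {n} → Vec Carrier n → Vec Carrier n → Vec Carrier n
  _−ᵥ_ {n} v w = vec n (seq v ⊞ ⊟ seq w)

  seq-−ᵥ : ∀ {n} (v w : Vec Carrier n) → seq (v −ᵥ w) ≈ seq v ⊞ ⊟ seq w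
  seq-−ᵥ {n} v w = seq-vec n (Deg<-⊞ (Deg<-seq v) (Deg<-⊟ (Deg<-seq w)))

  −ᵥ-involutive : ∀ {n} (v w : Vec Carrier n) → v −ᵥ (v −ᵥ w) ≡ w
  −ᵥ-involutive v w = seq-injective (≈-trans (seq-−ᵥ v (v −ᵥ w)) (≈-trans (SR.+-congˡ (SR.-‿cong (seq-−ᵥ v w)))
    (solve 2 (λ v w → v :+ :- (v :+ :- w) := w) ≈-refl (seq v) (seq w))))

  -- Weyl differencing: for fixed g the map y ↦ g - y is an involution, so g - y may stand for g′.
  SumV-difference : ∀ n (f : Vec Carrier n → Vec Carrier n → ℤ) →
    SumV n (λ g → SumV n (λ g′ → f g g′)) ≡ SumV n (λ y → SumV n (λ g → f g (g −ᵥ y)))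
  SumV-difference n f = trans (Sum-cong (vecs n) (λ g → sym (SumV-reindex n (g −ᵥ_) (g −ᵥ_) (−ᵥ-involutive g) (−ᵥ-involutive g) (f g))))
    (Sum-swap (vecs n) (vecs n) _)

  module _ (2≢0 : 2F ≢ 0F) where

    palVec-⊞⊟ : ∀ a x x′ y → palVec 2≢0 a (x ⊞ ⊟ x′) y ≡ vec (suc a) (seq (palVec 2≢0 a x y) ⊞ ⊟ seq (palVec 2≢0 a x′ y))
    palVec-⊞⊟ a x x′ y = trans (vec-cong (suc a) (mk≈ half)) (vec-ext (suc a) (λ k lt → cong₂ _⊝_ (sym (seq-vec-at (suc a) (U (P a x y)) k lt)) (sym (seq-vec-at (suc a) (U (P a x′ y)) k lt))))
      where
      U = upperHalf 2≢0 a
      P-⊟ : P a (x ⊞ ⊟ x′) y ≈ P a x y ⊞ ⊟ P a x′ y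
      P-⊟ = ≈-trans (P-⊞ˡ a x (⊟ x′) y) (SR.+-congˡ (P-⊟ˡ a x′ y))
      half : ∀ k → U (P a (x ⊞ ⊟ x′) y) k ≡ U (P a x y) k ⊝ U (P a x′ y) k
      half zero    = trans (cong (½ 2≢0 ⊙_) (at P-⊟ a)) (FS.solve 3 (λ h u v → h FS.:* (u FS.:+ FS.:- v) FS.:= h FS.:* u FS.:+ FS.:- (h FS.:* v)) refl (½ 2≢0) (P a x y a) (P a x′ y a))
      half (suc j) = at P-⊟ (a ℕ.+ suc j)

    kernelSize : ∀ a → Vec Carrier a → ℤ
    kernelSize a y = SumV a (λ x → 𝟙 (vanishes? 2≢0 a x y))

    -- An empty fibre contributes nothing; for x₀ in the fibre, x ↦ x₀ - x carries it into the
    -- kernel.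
    fibre-bound : ∀ a (y : Vec Carrier a) (w : Vec Carrier (suc a)) →
      SumV a (λ x → 𝟙 (w ≟V palVec 2≢0 a (seq x) (seq y))) ℤ.≤ kernelSize a y
    fibre-bound a y w = go (vecs-any w)
      where
      open import Data.List.Relation.Unary.Any using (any?; satisfied)
      open import Data.List.Membership.Propositional using (lose)
      fib : Vec Carrier a → Vec Carrier (suc a)
      fib x = palVec 2≢0 a (seq x) (seq y)
      vecs-any : ∀ w → (∃ λ x → w ≡ fib x) ⊎ (∀ x → w ≢ fib x)
      vecs-any w with any? (λ x → w ≟V fib x) (vecs a)
      ... | yes p = inj₁ (satisfied p)
      ... | no np = inj₂ (λ x e → np (lose (vecs-complete x) e))
      go : (∃ λ x → w ≡ fib x) ⊎ (∀ x → w ≢ fib x) → _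
      go (inj₂ none) = ℤ.≤-trans (ℤ.≤-reflexive (trans (Sum-cong (vecs a) (λ x → 𝟙-no (w ≟V fib x) (none x))) (Sum-zero (vecs a))))
        (Sum-nonneg (vecs a) (λ x → 𝟙-nonneg (vanishes? 2≢0 a x y)))
      go (inj₁ (x₀ , refl)) = ℤ.≤-trans (Sum-mono (vecs a) (λ x → 𝟙-mono (w ≟V fib x) (vanishes? 2≢0 a (x₀ −ᵥ x) y) (same x)))
        (ℤ.≤-reflexive (SumV-reindex a (x₀ −ᵥ_) (x₀ −ᵥ_) (−ᵥ-involutive x₀) (−ᵥ-involutive x₀) (λ x → 𝟙 (vanishes? 2≢0 a x y))))
        where
        same : ∀ x → fib x₀ ≡ fib x → Vanishes 2≢0 a (x₀ −ᵥ x) y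
        same x e = trans (vec-cong (suc a) (upperHalf-cong 2≢0 a (P-cong a (seq-−ᵥ x₀ x) (≈-refl {seq y}))))
          (trans (palVec-⊞⊟ a (seq x₀) (seq x) (seq y)) (vec-cong (suc a) (≈⇒⊞-⊟ (mk≈ (λ k → cong (λ v → seq v k) e)))))

    -- By palindrome-upperHalf, P(x, y) = P(p, 1) for p = palVec x y, and the fibres of the additive map x ↦ p are cosets of
    -- its kernel.
    fibre-sum : ∀ a (y : Vec Carrier a) (K : Seq → ℤ) → (∀ {p r} → p ≈ r → K p ≡ K r) → (∀ p → 0ℤ ℤ.≤ K p) →
      SumV a (λ x → K (P a (seq x) (seq y))) ℤ.≤ kernelSize a y * SumV (suc a) (λ p → K (P a (seq p) 1s))
    fibre-sum a y K K-cong K-nonneg = begin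
      SumV a (λ x → K (P a (seq x) (seq y)))
        ≡⟨ Sum-cong (vecs a) (λ x → trans (K-cong (≈-sym (P-palVec 2≢0 a (Deg<-seq′ 2≢0 x) (Deg<-seq′ 2≢0 y))))
             (sym (Sum-delta (vecs (suc a)) (vecs-unique (suc a)) _≟V_ (vecs-complete (fib x)) (λ w → K (P a (seq w) 1s))))) ⟩
      SumV a (λ x → SumV (suc a) (λ w → 𝟙 (w ≟V fib x) * K (P a (seq w) 1s)))
        ≡⟨ trans (Sum-swap (vecs a) (vecs (suc a)) _) (Sum-cong (vecs (suc a)) (λ w → Sum-*ʳ (vecs a) (K (P a (seq w) 1s)) _)) ⟩
      SumV (suc a) (λ w → SumV a (λ x → 𝟙 (w ≟V fib x)) * K (P a (seq w) 1s))
        ≤⟨ Sum-mono (vecs (suc a)) (λ w → *-mono₂-nonneg (K-nonneg _) (Sum-nonneg (vecs a) (λ x → 𝟙-nonneg (vanishes? 2≢0 a x y))) (fibre-bound a y w) ℤ.≤-refl) ⟩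
      SumV (suc a) (λ w → kernelSize a y * K (P a (seq w) 1s))
        ≡⟨ Sum-*ˡ (vecs (suc a)) (kernelSize a y) _ ⟩
      kernelSize a y * SumV (suc a) (λ p → K (P a (seq p) 1s)) ∎
      where
      open ℤ.≤-Reasoning
      fib : Vec Carrier a → Vec Carrier (suc a)
      fib x = palVec 2≢0 a (seq x) (seq y)

-- The quadratic form: its kernel, the linear and the bilinear sums.

module BilinearForms (F : FiniteField) where

  open import Data.Nat using (_+_; _^_; _≤_)
  open import Data.Nat.Solver using (module +-*-Solver)
  open import Data.Integer using (_*_)
  open FiniteSums
  open FieldSums F
  open PowerSeries F
  open Polynomials F
  open PalindromicPairs F
  open LinearForms F
  open SS using (solve; _:=_; _:+_; _:*_; _:-_; :-_)

  monic : ∀ {a} → Vec Carrier a → Seq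
  monic {a} v = seq v ⊞ X^ a

  Deg<-monic : ∀ {a} (v : Vec Carrier a) → Deg< (suc a) (monic v)
  Deg<-monic {a} v = Deg<-⊞ (Deg<-mono (ℕ.n≤1+n a) (Deg<-seq v)) (Deg<-X^ a)

  monic-top : ∀ {a} (v : Vec Carrier a) → monic v a ≡ 1F
  monic-top {a} v = trans (cong₂ _⊕_ (Deg<-seq v a ℕ.≤-refl) (X^-top a)) (FR.+-identityˡ 1F)

  monic-−ᵥ : ∀ {a} (v y : Vec Carrier a) → monic (v −ᵥ y) ≈ monic v ⊞ ⊟ seq y
  monic-−ᵥ {a} v y = ≈-trans (SR.+-congʳ (seq-−ᵥ v y)) (solve 3 (λ v y x → (v :+ :- y) :+ x := (v :+ x) :+ :- y) ≈-refl (seq v) (seq y) (X^ a))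

  rev-X^ : ∀ i j → rev (i + j) (X^ i) ≈ X^ j
  rev-X^ zero    j = rev-1 j
  rev-X^ (suc i) j = ≈-trans (rev-cong (suc (i + j)) (≈-sym (≈-trans (≈-sym (X^-suc i 1s)) (SR.*-identityʳ _))))
    (≈-trans (rev-X (i + j) (X^ i ⊠ 1s)) (≈-trans (rev-cong (i + j) (SR.*-identityʳ (X^ i))) (rev-X^ i j)))

  ⊠-low : ∀ k u {z} → (∀ i → i ≤ k → z i ≡ 0F) → (u ⊠ z) k ≡ 0F
  ⊠-low zero    u e = trans (cong (u 0 ⊙_) (e 0 z≤n)) (FR.zeroʳ (u 0))
  ⊠-low (suc k) u e = trans (cong₂ _⊕_ (trans (cong (u 0 ⊙_) (e (suc k) ℕ.≤-refl)) (FR.zeroʳ (u 0)))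
    (⊠-low k (tail u) (λ i le → e i (ℕ.m≤n⇒m≤1+n le)))) (FR.+-identityˡ 0F)

  -- A series with nonzero constant term is a unit, and multiplication by a unit does not change the
  -- order of vanishing at 0. This takes the place of dividing by A₂.
  low-cancel : ∀ K {u z} → u 0 ≢ 0F → (∀ k → k < K → (u ⊠ z) k ≡ 0F) → ∀ k → k < K → z k ≡ 0F
  low-cancel (suc K) {u} {z} u₀ e = go
    where
    ih : ∀ k → k < K → z k ≡ 0F
    ih = low-cancel K u₀ (λ k lt → e k (ℕ.m≤n⇒m≤1+n lt))
    top : ∀ k → (∀ i → i < k → z i ≡ 0F) → (u ⊠ z) k ≡ 0F → z k ≡ 0F
    top zero    below eq = cancel-nonzero u₀ eq
    top (suc k) below eq = cancel-nonzero u₀ (trans (sym (FR.+-identityʳ _))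
      (trans (cong (_⊕_ (u 0 ⊙ z (suc k))) (sym (⊠-low k (tail u) (λ i le → below i (s≤s le))))) eq))
    go : ∀ k → k < suc K → z k ≡ 0F
    go k (s≤s le) with ℕ.m≤n⇒m<n∨m≡n le
    ... | inj₁ lt   = ih k lt
    ... | inj₂ refl = top k ih (e k ℕ.≤-refl)

  Palindrome-⊠ : ∀ i j {z w} → Palindrome i z → Palindrome j w → Palindrome (i + j) (z ⊠ w)
  Palindrome-⊠ i j (dz , pz) (dw , pw) = Deg<-⊠ (suc i) j dz dw , ≈-trans (rev-⊠ i j dz dw) (SR.*-cong pz pw)

  square-palindrome : ∀ a {x} → Deg< (suc a) x → Palindrome (a + a) (x ⊠ rev a x)
  square-palindrome a {x} dx = Deg<-⊠ (suc a) a dx (Deg<-rev a x) ,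
    ≈-trans (rev-⊠ a a dx (Deg<-rev a x)) (≈-trans (SR.*-congˡ (rev-involutive a dx)) (SR.*-comm _ _))

  palindrome-center : ∀ e {u v} → rev (e + e) u ≈ v → v e ≡ u e
  palindrome-center e {u} eq = trans (sym (at eq e)) (rev-at e e u)

  -- The difference g g* - (g - y)(g - y)*. Its quadratic part in g has cancelled; it is affine in g
  -- with linear part `P a g y`.
  Δ : ℕ → Seq → Seq → Seq
  Δ a g y = P a g y ⊞ ⊟ (y ⊠ rev a y)

  Δ-difference : ∀ a {g g′ y} → g′ ≈ g ⊞ ⊟ y → g ⊠ rev a g ⊞ ⊟ (g′ ⊠ rev a g′) ≈ Δ a g y
  Δ-difference a {g} {g′} {y} e = ≈-trans (SR.+-congˡ (SR.-‿cong (SR.*-cong e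
      (≈-trans (rev-cong a e) (≈-trans (rev-⊞ a g (⊟ y)) (SR.+-congˡ (rev-⊟ a y)))))))
    (solve 4 (λ g y rg ry → g :* rg :+ :- ((g :+ :- y) :* (rg :+ :- ry)) := (g :* ry :+ y :* rg) :+ :- (y :* ry)) ≈-refl g y (rev a g) (rev a y))

  Δ-⊞ : ∀ a x t y → Δ a (x ⊞ t) y ≈ P a x y ⊞ Δ a t y
  Δ-⊞ a x t y = ≈-trans (SR.+-congʳ (P-⊞ˡ a x t y)) (SR.+-assoc _ _ _)

  κ-square₁ : {A : Set} (L : List A) (φ : A → Carrier) (γ : Carrier) →
    Sum L (λ h → κ (φ h ⊝ γ)) * Sum L (λ h → κ (φ h ⊝ γ)) ℤ.≤ + q * Sum L (λ h → Sum L (λ h′ → κ (φ h ⊝ φ h′)))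
  κ-square₁ L φ γ = subst₂ ℤ._≤_ (cong₂ _*_ unit unit) (*-congʳ (+ q) (Sum-cong L (λ h → Sum-cong L (λ h′ → ℤ.*-identityˡ _))))
    (κ-square L (λ _ → 1ℤ) φ γ)
    where
    unit : Sum L (λ h → 1ℤ * κ (φ h ⊝ γ)) ≡ Sum L (λ h → κ (φ h ⊝ γ))
    unit = Sum-cong L (λ h → ℤ.*-identityˡ _)

  module Form (2≢0 : 2F ≢ 0F) (m n : ℕ) (C : Seq) (C-deg : Deg< (suc m) C) (C-top : C m ≢ 0F)
    (ℓ : Seq → Carrier) (ℓ-linear : Linear ℓ) (γ : Carrier) where

    -- With C = Σ c_j t^j this is Σ c_j z_(n-j). For z = f f* the coefficient z_(n-j) is Σ f_i
    -- f_(i-j), so the quadratic part of Q_A results.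
    form : Seq → Carrier
    form z = (C ⊠ z) n

    form-linear : Linear form
    form-linear = ⊠-linear C (coefficient-linear n)

    module form = Linear form-linear
    module ℓ = Linear ℓ-linear

    Q : Seq → Carrier
    Q f = form (f ⊠ rev n f) ⊕ ℓ f

    Q-cong : ∀ {f g} → f ≈ g → Q f ≡ Q g
    Q-cong e = cong₂ _⊕_ (form.respects (SR.*-cong e (rev-cong n e))) (ℓ.respects e)

    Φ : Seq → ℤ
    Φ f = κ (Q f ⊝ γ)

    pair : ℕ → Seq → Seq → Seq → Carrier
    pair a y W x = form (P a x y ⊠ W)

    pair-linear : ∀ a y W → Linear (pair a y W)
    pair-linear a y W = record
      { respects = λ e → form.respects (SR.*-congʳ (P-cong a e ≈-refl))
      ; add = λ p r → trans (form.respects (≈-trans (SR.*-congʳ (P-⊞ˡ a p r y)) (SR.distribʳ W _ _))) (form.add _ _)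
      ; scale = λ c p → trans (form.respects (≈-trans (SR.*-congʳ (≈-trans (P-•ˡ a c p y) (•≈⊠ c _)))
          (≈-trans (SR.*-assoc (c • 1s) _ W) (≈-sym (•≈⊠ c _))))) (form.scale c _) }

    Q-product : ∀ a b → a + b ≡ n → ∀ {g h} → Deg< (suc a) g → Deg< (suc b) h →
      Q (g ⊠ h) ≡ form ((g ⊠ rev a g) ⊠ (h ⊠ rev b h)) ⊕ ℓ (g ⊠ h)
    Q-product a b a+b≡n {g} {h} dg dh = cong (_⊕ ℓ (g ⊠ h)) (form.respects (≈-trans
      (SR.*-congˡ (≈-trans (mk≈ (λ k → cong (λ i → rev i (g ⊠ h) k) (sym a+b≡n))) (rev-⊠ a b dg dh)))
      (solve 4 (λ g h rg rh → (g :* h) :* (rg :* rh) := (g :* rg) :* (h :* rh)) ≈-refl g h (rev a g) (rev b h))))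

    Q-difference : ∀ a b → a + b ≡ n → ∀ {g h h′ v} → Deg< (suc a) g → Deg< (suc b) h → Deg< (suc b) h′ → h′ ≈ h ⊞ ⊟ v →
      Q (g ⊠ h) ⊝ Q (g ⊠ h′) ≡ form ((g ⊠ rev a g) ⊠ Δ b h v) ⊕ ℓ (g ⊠ v)
    Q-difference a b a+b≡n {g} {h} {h′} {v} dg dh dh′ e = begin
      Q (g ⊠ h) ⊝ Q (g ⊠ h′)
        ≡⟨ cong₂ _⊝_ (Q-product a b a+b≡n dg dh) (Q-product a b a+b≡n dg dh′) ⟩
      (form (G ⊠ (h ⊠ rev b h)) ⊕ ℓ (g ⊠ h)) ⊝ (form (G ⊠ (h′ ⊠ rev b h′)) ⊕ ℓ (g ⊠ h′))
        ≡⟨ FS.solve 4 (λ a b c d → (a FS.:+ b) FS.:- (c FS.:+ d) FS.:= (a FS.:+ FS.:- c) FS.:+ (b FS.:+ FS.:- d)) refl _ _ _ _ ⟩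
      (form (G ⊠ (h ⊠ rev b h)) ⊝ form (G ⊠ (h′ ⊠ rev b h′))) ⊕ (ℓ (g ⊠ h) ⊝ ℓ (g ⊠ h′))
        ≡⟨ cong₂ _⊕_ (difference form-linear G (h ⊠ rev b h) (h′ ⊠ rev b h′)) (difference ℓ-linear g h h′) ⟩
      form (G ⊠ (h ⊠ rev b h ⊞ ⊟ (h′ ⊠ rev b h′))) ⊕ ℓ (g ⊠ (h ⊞ ⊟ h′))
        ≡⟨ cong₂ _⊕_ (form.respects (SR.*-congˡ (Δ-difference b e)))
             (ℓ.respects (SR.*-congˡ (≈-trans (SR.+-congˡ (SR.-‿cong e)) (solve 2 (λ h v → h :+ :- (h :+ :- v) := v) ≈-refl h v)))) ⟩
      form (G ⊠ Δ b h v) ⊕ ℓ (g ⊠ v) ∎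
      where
      open ≡-Reasoning
      G = g ⊠ rev a g
      difference : ∀ {Λ} → Linear Λ → ∀ p r s → Λ (p ⊠ r) ⊝ Λ (p ⊠ s) ≡ Λ (p ⊠ (r ⊞ ⊟ s))
      difference {Λ} L p r s = sym (trans (respects (solve 3 (λ p r s → p :* (r :+ :- s) := p :* r :+ :- (p :* s)) ≈-refl p r s))
        (trans (add _ _) (cong (_⊕_ _) (negate _))))
        where open Linear L

    -- The leading term t^a of the monic polynomial and the term y y* of `Δ` do not depend on g;
    -- they join the constant c, which `κSum-shift` removes.
    drop-affine : ∀ a y W c → SumV a (λ g → κ (form (Δ a (monic g) y ⊠ W) ⊕ c)) ℤ.≤ κSum a (pair a y W)
    drop-affine a y W c = ℤ.≤-trans (ℤ.≤-reflexive (Sum-cong (vecs a) (λ g → cong κ (trans (cong (_⊕ c)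
        (trans (form.respects (≈-trans (SR.*-congʳ (Δ-⊞ a (seq g) (X^ a) y)) (SR.distribʳ W _ _))) (form.add _ _))) (FR.+-assoc _ _ c)))))
      (κSum-shift a (pair-linear a y W) (form (Δ a (X^ a) y ⊠ W) ⊕ c))

    -- The symmetrised symbol 2tᵐA(t) = tᵐ (C(t) + C(1/t)).
    A₂ : Seq
    A₂ = P m C 1s

    Deg<-1s : ∀ a → Deg< (suc a) 1s
    Deg<-1s a = Deg<-mono (s≤s z≤n) (Deg<-X^ 0)

    A₂-palindrome : Palindrome (m + m) A₂
    A₂-palindrome = P-palindrome m C-deg (Deg<-1s m)

    A₂-split : A₂ ≈ X^ m ⊠ C ⊞ rev m C
    A₂-split = SR.+-cong (≈-trans (SR.*-congˡ (rev-1 m)) (SR.*-comm C (X^ m))) (SR.*-identityˡ _)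

    -- Reversal puts c_m in the lowest place. For m > 0 the summand t^m C does not reach it; for m =
    -- 0 both summands agree and give 2c_0.
    A₂-unit : A₂ 0 ≢ 0F
    A₂-unit eq = nonzero m refl (trans (sym (at A₂-split 0)) eq)
      where
      nonzero : ∀ k → k ≡ m → (X^ k ⊠ C) 0 ⊕ rev k C 0 ≢ 0F
      nonzero zero    refl eq = C-top (double-zero 2≢0 (C 0) (trans (cong (_⊕ C 0) (sym (FR.*-identityˡ (C 0)))) eq))
      nonzero (suc k) refl eq = C-top (trans (sym (trans (cong (_⊕ C (suc k)) (FR.zeroˡ (C 0))) (FR.+-identityˡ _))) eq)

    -- The two summands t^m C z and C* z, with C* the reversal of C, are reversals of each other
    -- because z is a palindrome, so each contributes (C z)_n to the middle coefficient m + n.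
    A₂-double : ∀ {z} → Palindrome (n + n) z → (A₂ ⊠ z) (m + n) ≡ form z ⊕ form z
    A₂-double {z} pz = trans (at (≈-trans (SR.*-congʳ A₂-split) (SR.distribʳ z _ _)) (m + n)) (cong₂ _⊕_
      (trans (at (SR.*-assoc (X^ m) C z) (m + n)) (X^-shift m (C ⊠ z) n))
      (trans (sym (at (≈-trans (rev-⊠ m (n + n) C-deg (proj₁ pz)) (SR.*-congˡ (proj₂ pz))) (m + n)))
        (trans (cong (λ i → rev i (C ⊠ z) (m + n)) (sym (ℕ.+-assoc m n n))) (rev-at (m + n) n (C ⊠ z)))))

    subst-palindrome : ∀ {i j z} → i ≡ j → Palindrome i z → Palindrome j z
    subst-palindrome refl p = p

    module Kernel (a b : ℕ) (a+b≡n : a + b ≡ n) {W y x : Seq} (W-palindrome : Palindrome (b + b) W)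
      (y-deg : Deg< (suc a) y) (x-deg : Deg< (suc a) x) (vanish : pair a y W x ≡ 0F) where

      open +-*-Solver using () renaming (solve to solveℕ; _:=_ to _:=ℕ_; _:+_ to _:+ℕ_)

      e : ℕ
      e = m + b

      B U V : Seq
      B = A₂ ⊠ W
      U = B ⊠ (x ⊠ rev a y)
      V = B ⊠ (y ⊠ rev a x)

      B-palindrome : Palindrome (e + e) B
      B-palindrome = subst-palindrome (solveℕ 2 (λ m b → (m :+ℕ m) :+ℕ (b :+ℕ b) :=ℕ (m :+ℕ b) :+ℕ (m :+ℕ b)) refl m b)
        (Palindrome-⊠ (m + m) (b + b) A₂-palindrome W-palindrome)

      U-flip : rev ((e + a) + (e + a)) U ≈ V
      U-flip = ≈-trans (mk≈ (λ k → cong (λ i → rev i U k) (solveℕ 2 (λ e a → (e :+ℕ a) :+ℕ (e :+ℕ a) :=ℕ (e :+ℕ e) :+ℕ (a :+ℕ a)) refl e a)))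
        (≈-trans (rev-⊠ (e + e) (a + a) (proj₁ B-palindrome) (Deg<-⊠ (suc a) a x-deg (Deg<-rev a y)))
          (SR.*-cong (proj₂ B-palindrome) (≈-trans (rev-⊠ a a x-deg (Deg<-rev a y))
            (≈-trans (SR.*-congˡ (rev-involutive a y-deg)) (SR.*-comm _ _)))))

      center : (A₂ ⊠ (P a x y ⊠ W)) (m + n) ≡ U (e + a) ⊕ V (e + a)
      center = trans (at (solve 6 (λ A x y rx ry W → A :* ((x :* ry :+ y :* rx) :* W) := (A :* W) :* (x :* ry) :+ (A :* W) :* (y :* rx)) ≈-refl
          A₂ x y (rev a x) (rev a y) W) (m + n))
        (cong (λ i → U i ⊕ V i) (trans (cong (_+_ m) (sym a+b≡n)) (solveℕ 3 (λ m a b → m :+ℕ (a :+ℕ b) :=ℕ (m :+ℕ b) :+ℕ a) refl m a b)))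

      V≡U : V (e + a) ≡ U (e + a)
      V≡U = palindrome-center (e + a) U-flip

      -- U and V, the halves of B (x y* + y x*), are reversals of each other and share their middle
      -- coefficient. A vanishing sum is twice that coefficient, so one condition on x y* alone
      -- remains.
      U-zero : U (e + a) ≡ 0F
      U-zero = double-zero 2≢0 _ (begin
        U (e + a) ⊕ U (e + a)              ≡⟨ cong (U (e + a) ⊕_) V≡U ⟨
        U (e + a) ⊕ V (e + a)              ≡⟨ center ⟨
        (A₂ ⊠ (P a x y ⊠ W)) (m + n)       ≡⟨ A₂-double PW ⟩
        pair a y W x ⊕ pair a y W x        ≡⟨ cong₂ _⊕_ vanish vanish ⟩
        0F ⊕ 0F                            ≡⟨ FR.+-identityˡ 0F ⟩
        0F ∎)
        where
        open ≡-Reasoning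
        PW : Palindrome (n + n) (P a x y ⊠ W)
        PW = subst-palindrome (trans (solveℕ 2 (λ a b → (a :+ℕ a) :+ℕ (b :+ℕ b) :=ℕ (a :+ℕ b) :+ℕ (a :+ℕ b)) refl a b) (cong₂ _+_ a+b≡n a+b≡n))
          (Palindrome-⊠ (a + a) (b + b) (P-palindrome a x-deg y-deg) W-palindrome)

      V-zero : V (e + a) ≡ 0F
      V-zero = trans V≡U U-zero

    difference-low : ∀ B p r k → (B ⊠ p) k ≡ (B ⊠ r) k → (B ⊠ (p ⊞ ⊟ r)) k ≡ 0F
    difference-low B p r k eq = trans (at (solve 3 (λ B p r → B :* (p :+ :- r) := B :* p :+ :- (B :* r)) ≈-refl B p r) k)
      (trans (cong (_⊝ (B ⊠ r) k) eq) (⊝-self _))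

    -- Linear sums: h is fixed and a full range of monic k is summed.

    module TypeI (a b : ℕ) (a+b≡n : a + b ≡ n) (h : Seq) (h-deg : Deg< (suc b) h) (h-top : h b ≢ 0F) where

      W : Seq
      W = h ⊠ rev b h

      -- The test polynomial x = t^i has reversal t^(a-i), so `V-zero` isolates a single coefficient
      -- of A₂ W y.
      zeros : ∀ (y : Vec Carrier a) → κSum a (pair a (seq y) W) ≢ 0ℤ → ∀ i → i < a → ((A₂ ⊠ W) ⊠ seq y) (m + b + i) ≡ 0F
      zeros y alive i i<a with split-≤ (ℕ.<⇒≤ i<a)
      ... | j , i+j≡a = begin
        (B ⊠ seq y) (e + i)                  ≡⟨ X^-shift j (B ⊠ seq y) (e + i) ⟨
        (X^ j ⊠ (B ⊠ seq y)) (j + (e + i))   ≡⟨ cong (X^ j ⊠ (B ⊠ seq y)) (trans (ℕ.+-comm j (e + i)) (trans (ℕ.+-assoc e i j) (cong (_+_ e) i+j≡a))) ⟩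
        (X^ j ⊠ (B ⊠ seq y)) (e + a)         ≡⟨ at (solve 3 (λ x B y → x :* (B :* y) := B :* (y :* x)) ≈-refl (X^ j) B (seq y)) (e + a) ⟩
        (B ⊠ (seq y ⊠ X^ j)) (e + a)         ≡⟨ at (SR.*-congˡ (SR.*-congˡ (≈-trans (rev-cong a x≈) revX))) (e + a) ⟨
        (B ⊠ (seq y ⊠ rev a x)) (e + a)      ≡⟨ V-zero ⟩
        0F ∎
        where
        x = seq (vec a (X^ i))
        x≈ : x ≈ X^ i
        x≈ = seq-vec a (Deg<-mono i<a (Deg<-X^ i))
        open Kernel a b a+b≡n {W} {seq y} {x} (square-palindrome b h-deg) (Deg<-seq′ 2≢0 y) (Deg<-seq′ 2≢0 (vec a (X^ i)))
          (alive⇒vanishing a (pair-linear a (seq y) W) alive (vec a (X^ i)))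
        open ≡-Reasoning
        revX : rev a (X^ i) ≈ X^ j
        revX = ≈-trans (mk≈ (λ k → cong (λ n → rev n (X^ i) k) (sym i+j≡a))) (rev-X^ i j)

      -- By `zeros`, a consecutive coefficients of A₂ W y vanish, and the m + b below them determine
      -- y: if they agree for two such y with difference z, then A₂ h h* z vanishes below m + b + a.
      -- Hence so does h z, whose degree is less than a + b, and z = 0.
      kernel-count : SumV a (λ y → 𝟙 (alive? a (pair a (seq y) W))) ℤ.≤ + (q ^ (m + b))
      kernel-count = ℤ.≤-trans (Sum-inject (vecs a) (vecs-unique a) (λ y → alive? a (pair a (seq y) W)) _≟V_ (vecs (m + b)) vecs-complete
        (λ y → vec (m + b) ((A₂ ⊠ W) ⊠ seq y)) injective) (ℤ.≤-reflexive (cong +_ (vecs-length (m + b))))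
        where
        injective : ∀ {y y′} → κSum a (pair a (seq y) W) ≢ 0ℤ → κSum a (pair a (seq y′) W) ≢ 0ℤ →
          vec (m + b) ((A₂ ⊠ W) ⊠ seq y) ≡ vec (m + b) ((A₂ ⊠ W) ⊠ seq y′) → y ≡ y′
        injective {y} {y′} al al′ eq = seq-injective (⊞-⊟-zero (domain (h-deg , h-top) (a , z-deg) hz≈0))
          where
          z = seq y ⊞ ⊟ seq y′
          z-deg : Deg< a z
          z-deg = Deg<-⊞ (Deg<-seq y) (Deg<-⊟ (Deg<-seq y′))
          same : ∀ k → k < m + b + a → ((A₂ ⊠ W) ⊠ seq y) k ≡ ((A₂ ⊠ W) ⊠ seq y′) k
          same k lt with k ℕ.<? m + b
          ... | yes k<e = vec-at (m + b) eq k k<e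
          ... | no k≮e with split-≤ (ℕ.≮⇒≥ k≮e)
          ... | i , refl = trans (zeros y al i i<a) (sym (zeros y′ al′ i i<a))
            where i<a = ℕ.+-cancelˡ-< (m + b) i a lt
          -- Only A₂ h* is cancelled, with constant term A₂(0) h_b ≠ 0; the factor h itself may
          -- vanish at 0.
          u = A₂ ⊠ rev b h
          u-unit : u 0 ≢ 0F
          u-unit = *-nonzero A₂-unit (λ e → h-top (trans (sym (rev-0 b h)) e))
          hz-low : ∀ k → k < m + b + a → (h ⊠ z) k ≡ 0F
          hz-low = low-cancel (m + b + a) u-unit (λ k lt → trans
            (at (solve 4 (λ A r h z → (A :* r) :* (h :* z) := (A :* (h :* r)) :* z) ≈-refl A₂ (rev b h) h z) k)
            (difference-low (A₂ ⊠ W) (seq y) (seq y′) k (same k lt)))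
          hz-deg : Deg< (a + b) (h ⊠ z)
          hz-deg = Deg<-cong (SR.*-comm z h) (Deg<-⊠ a b z-deg h-deg)
          hz≈0 : h ⊠ z ≈ 0s
          hz≈0 = mk≈ λ k → zero-at k (k ℕ.<? m + b + a)
            where
            zero-at : ∀ k → Dec (k < m + b + a) → (h ⊠ z) k ≡ 0F
            zero-at k (yes lt) = hz-low k lt
            zero-at k (no ¬lt) = hz-deg k (ℕ.≤-trans (ℕ.≤-trans (ℕ.m≤n+m (a + b) m)
              (ℕ.≤-reflexive (trans (cong (_+_ m) (ℕ.+-comm a b)) (sym (ℕ.+-assoc m b a))))) (ℕ.≮⇒≥ ¬lt))

      T : ℤ
      T = SumV a (λ k → Φ (h ⊠ monic k))

      bound : T * T ℤ.≤ + q * (+ (q ^ a ℕ.* q) * + (q ^ (m + b)))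
      bound = ℤ.≤-trans (κ-square₁ (vecs a) (λ k → Q (h ⊠ monic k)) γ) (*-mono-nonneg (pos-nonneg q) (begin
        SumV a (λ k → SumV a (λ k′ → κ (Q (h ⊠ monic k) ⊝ Q (h ⊠ monic k′))))
          ≡⟨ SumV-difference a (λ k k′ → κ (Q (h ⊠ monic k) ⊝ Q (h ⊠ monic k′))) ⟩
        SumV a (λ y → SumV a (λ k → κ (Q (h ⊠ monic k) ⊝ Q (h ⊠ monic (k −ᵥ y)))))
          ≡⟨ Sum-cong (vecs a) (λ y → Sum-cong (vecs a) (λ k → cong κ (trans
               (Q-difference b a (trans (ℕ.+-comm b a) a+b≡n) h-deg (Deg<-monic k) (Deg<-monic (k −ᵥ y)) (monic-−ᵥ k y))
               (cong (_⊕ ℓ (h ⊠ seq y)) (form.respects (SR.*-comm W _)))))) ⟩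
        SumV a (λ y → SumV a (λ k → κ (form (Δ a (monic k) (seq y) ⊠ W) ⊕ ℓ (h ⊠ seq y))))
          ≤⟨ Sum-mono (vecs a) (λ y → drop-affine a (seq y) W (ℓ (h ⊠ seq y))) ⟩
        SumV a (λ y → κSum a (pair a (seq y) W))
          ≤⟨ Sum-alive a a (λ y → pair a (seq y) W) (+ (q ^ (m + b))) kernel-count ⟩
        + (q ^ a ℕ.* q) * + (q ^ (m + b)) ∎))
        where open ℤ.≤-Reasoning

    -- Bilinear sums with arbitrary weights in both variables.

    module TypeII (a b : ℕ) (a+b≡n : a + b ≡ n) (b≤a : b ≤ a) where

      form-comm : ∀ p r → form (p ⊠ r) ≡ form (r ⊠ p)
      form-comm p r = form.respects (SR.*-comm p r)

      -- The form summed over all pairs of palindromes of degrees at most 2a and 2b: w and the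
      -- variable of `κSum` are their coordinates.
      G₀ : ℤ
      G₀ = SumV (suc b) (λ w → κSum (suc a) (pair a 1s (P b (seq w) 1s)))

      -- Here y = 1 has reversal t^a, and x = t^i picks out the coefficient m + b - i of A₂ P(w, 1).
      zeros : ∀ (w : Vec Carrier (suc b)) → κSum (suc a) (pair a 1s (P b (seq w) 1s)) ≢ 0ℤ →
        ∀ k i → k + i ≡ m + b → i ≤ a → (A₂ ⊠ P b (seq w) 1s) k ≡ 0F
      zeros w alive k i k+i≡e i≤a = begin
        B k                                     ≡⟨ X^-shift i B k ⟨
        (X^ i ⊠ B) (i + k)                      ≡⟨ cong (X^ i ⊠ B) (trans (ℕ.+-comm i k) k+i≡e) ⟩
        (X^ i ⊠ B) e                            ≡⟨ X^-shift a (X^ i ⊠ B) e ⟨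
        (X^ a ⊠ (X^ i ⊠ B)) (a + e)             ≡⟨ cong (X^ a ⊠ (X^ i ⊠ B)) (ℕ.+-comm a e) ⟩
        (X^ a ⊠ (X^ i ⊠ B)) (e + a)             ≡⟨ at (solve 3 (λ s x B → s :* (x :* B) := B :* (x :* s)) ≈-refl (X^ a) (X^ i) B) (e + a) ⟩
        (B ⊠ (X^ i ⊠ X^ a)) (e + a)             ≡⟨ at (SR.*-congˡ (SR.*-cong x≈ (rev-1 a))) (e + a) ⟨
        (B ⊠ (x ⊠ rev a 1s)) (e + a)            ≡⟨ U-zero ⟩
        0F ∎
        where
        x = seq (vec (suc a) (X^ i))
        x≈ : x ≈ X^ i
        x≈ = seq-vec (suc a) (Deg<-mono (s≤s i≤a) (Deg<-X^ i))
        open Kernel a b a+b≡n {P b (seq w) 1s} {1s} {x} (P-palindrome b (Deg<-seq w) (Deg<-1s b)) (Deg<-1s a) (Deg<-seq (vec (suc a) (X^ i)))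
          (alive⇒vanishing (suc a) (pair-linear a 1s (P b (seq w) 1s)) alive (vec (suc a) (X^ i)))
        open ≡-Reasoning

      -- The series t^b z + z* shows z_b, ..., z_1 below the middle and 2z_0 in the middle.
      P1-injective : ∀ {z} → Deg< (suc b) z → (∀ k → k ≤ b → P b z 1s k ≡ 0F) → z ≈ 0s
      P1-injective {z} z-deg low = mk≈ λ j → zero-at j (j ℕ.≤? b)
        where
        value : ∀ i → (X^ b ⊠ z) i ⊕ rev b z i ≡ P b z 1s i
        value i = sym (at (SR.+-cong (≈-trans (SR.*-congˡ (rev-1 b)) (SR.*-comm z (X^ b))) (SR.*-identityˡ (rev b z))) i)
        zero-at : ∀ j → Dec (j ≤ b) → z j ≡ 0F
        zero-at j (no nle) = z-deg j (ℕ.≰⇒> nle)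
        zero-at zero (yes le) = double-zero 2≢0 _ (trans (cong₂ _⊕_ (trans (sym (X^-shift b z 0)) (cong (X^ b ⊠ z) (ℕ.+-identityʳ b)))
          (trans (sym (rev-at b 0 z)) (cong (λ i → rev i z b) (ℕ.+-identityʳ b)))) (trans (value b) (low b ℕ.≤-refl)))
        zero-at (suc j) (yes le) with split-≤ le
        ... | i , sj+i≡b = trans (sym (trans (cong₂ _⊕_ (X^-below b z i i<b)
              (trans (cong (λ n → rev n z i) (trans (sym sj+i≡b) (ℕ.+-comm (suc j) i))) (rev-at i (suc j) z))) (FR.+-identityˡ _)))
              (trans (value i) (low i (ℕ.<⇒≤ i<b)))
          where
          i<b : i < b
          i<b = subst (i <_) sj+i≡b (s≤s (ℕ.m≤n+m i j))

      -- If the sum for w is nonzero, the coefficients of A₂ P(w, 1) from m to m + b vanish, so the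
      -- m lowest ones fix it up to degree m + b. Cancelling the unit A₂ gives the lower half of the
      -- palindrome and with it w: at most q^m values of w survive.
      G₀-bound : G₀ ℤ.≤ + (q ^ suc a ℕ.* q) * + (q ^ m)
      G₀-bound = Sum-alive (suc a) (suc b) (λ w → pair a 1s (P b (seq w) 1s)) (+ (q ^ m))
        (ℤ.≤-trans (Sum-inject (vecs (suc b)) (vecs-unique (suc b)) (λ w → alive? (suc a) (pair a 1s (P b (seq w) 1s))) _≟V_ (vecs m) vecs-complete
          (λ w → vec m (A₂ ⊠ P b (seq w) 1s)) injective) (ℤ.≤-reflexive (cong +_ (vecs-length m))))
        where
        injective : ∀ {w w′} → κSum (suc a) (pair a 1s (P b (seq w) 1s)) ≢ 0ℤ → κSum (suc a) (pair a 1s (P b (seq w′) 1s)) ≢ 0ℤ →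
          vec m (A₂ ⊠ P b (seq w) 1s) ≡ vec m (A₂ ⊠ P b (seq w′) 1s) → w ≡ w′
        injective {w} {w′} al al′ eq = seq-injective (⊞-⊟-zero (P1-injective z-deg (λ k k≤b →
            low-cancel (suc (m + b)) A₂-unit (λ k lt → trans (at (SR.*-congˡ split) k) (difference-low A₂ _ _ k (same k (ℕ.s≤s⁻¹ lt)))) k
              (s≤s (ℕ.≤-trans k≤b (ℕ.m≤n+m b m))))))
          where
          z = seq w ⊞ ⊟ seq w′
          z-deg : Deg< (suc b) z
          z-deg = Deg<-⊞ (Deg<-seq w) (Deg<-⊟ (Deg<-seq w′))
          split : P b z 1s ≈ P b (seq w) 1s ⊞ ⊟ P b (seq w′) 1s
          split = ≈-trans (P-⊞ˡ b (seq w) (⊟ seq w′) 1s) (SR.+-congˡ (P-⊟ˡ b (seq w′) 1s))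
          same : ∀ k → k ≤ m + b → (A₂ ⊠ P b (seq w) 1s) k ≡ (A₂ ⊠ P b (seq w′) 1s) k
          same k k≤e with k ℕ.<? m
          ... | yes k<m = vec-at m eq k k<m
          ... | no k≮m with split-≤ k≤e
          ... | i , k+i≡e = trans (zeros w al k i k+i≡e i≤a) (sym (zeros w′ al′ k i k+i≡e i≤a))
            where
            -- k ≥ m gives i ≤ b, and b ≤ a makes t^i an admissible test polynomial.
            i≤a : i ≤ a
            i≤a = ℕ.≤-trans (ℕ.+-cancelˡ-≤ m i b (ℕ.≤-trans (ℕ.+-monoˡ-≤ i (ℕ.≮⇒≥ k≮m)) (ℕ.≤-reflexive k+i≡e))) b≤a

      G : ℤ
      G = SumV b (λ v → SumV a (λ y → SumV b (λ u → κSum a (pair a (seq y) (P b (seq u) (seq v))))))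

      kernel-nonneg : ∀ c (y : Vec Carrier c) → 0ℤ ℤ.≤ kernelSize 2≢0 c y
      kernel-nonneg c y = Sum-nonneg (vecs c) (λ x → 𝟙-nonneg (vanishes? 2≢0 c x y))

      -- `fibre-sum` is applied in u and, after exchanging the two factors under `form`, in x. It
      -- asks for a nonnegative summand; each time this is the inner κ-sum over the other linear
      -- variable.
      G-bound : G ℤ.≤ R 2≢0 b * (R 2≢0 a * G₀)
      G-bound = begin
        G
          ≤⟨ Sum-mono (vecs b) (λ v → Sum-mono (vecs a) (λ y → fibre-sum 2≢0 b v (λ Z → κSum a (pair a (seq y) Z))
               (λ e → Sum-cong (vecs a) (λ x → cong κ (form.respects (SR.*-congˡ e)))) (λ Z → κSum-nonneg a (pair-linear a (seq y) Z)))) ⟩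
        SumV b (λ v → SumV a (λ y → kernelSize 2≢0 b v * SumV (suc b) (λ w → κSum a (pair a (seq y) (P b (seq w) 1s)))))
          ≡⟨ Sum-product (vecs b) (vecs a) (kernelSize 2≢0 b) _ ⟩
        R 2≢0 b * SumV a (λ y → SumV (suc b) (λ w → κSum a (pair a (seq y) (P b (seq w) 1s))))
          ≤⟨ *-mono-nonneg (Sum-nonneg (vecs b) (kernel-nonneg b)) inner ⟩
        R 2≢0 b * (R 2≢0 a * G₀) ∎
        where
        open ℤ.≤-Reasoning
        swapped : Seq → ℤ
        swapped Z = κSum (suc b) (pair b 1s Z)
        inner : SumV a (λ y → SumV (suc b) (λ w → κSum a (pair a (seq y) (P b (seq w) 1s)))) ℤ.≤ R 2≢0 a * G₀
        inner = begin
          SumV a (λ y → SumV (suc b) (λ w → κSum a (pair a (seq y) (P b (seq w) 1s))))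
            ≡⟨ Sum-cong (vecs a) (λ y → trans (Sum-swap (vecs (suc b)) (vecs a) _)
                 (Sum-cong (vecs a) (λ x → Sum-cong (vecs (suc b)) (λ w → cong κ (form-comm _ _))))) ⟩
          SumV a (λ y → SumV a (λ x → swapped (P a (seq x) (seq y))))
            ≤⟨ Sum-mono (vecs a) (λ y → fibre-sum 2≢0 a y swapped
                 (λ e → Sum-cong (vecs (suc b)) (λ w → cong κ (form.respects (SR.*-congˡ e)))) (λ Z → κSum-nonneg (suc b) (pair-linear b 1s Z))) ⟩
          SumV a (λ y → kernelSize 2≢0 a y * SumV (suc a) (λ p → swapped (P a (seq p) 1s)))
            ≡⟨ Sum-*ʳ (vecs a) _ (kernelSize 2≢0 a) ⟩
          R 2≢0 a * SumV (suc a) (λ p → swapped (P a (seq p) 1s))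
            ≡⟨ *-congʳ (R 2≢0 a) (trans (Sum-swap (vecs (suc a)) (vecs (suc b)) _)
                 (Sum-cong (vecs (suc b)) (λ w → Sum-cong (vecs (suc a)) (λ p → cong κ (form-comm _ _))))) ⟩
          R 2≢0 a * G₀ ∎

      D : Vec Carrier b → Vec Carrier b → Vec Carrier a → Carrier
      D h h′ g = Q (monic g ⊠ monic h) ⊝ Q (monic g ⊠ monic h′)

      E : ℤ
      E = SumV b (λ h → SumV b (λ h′ → SumV a (λ g → SumV a (λ g′ → κ (D h h′ g ⊝ D h h′ g′)))))

      D-difference : ∀ h v g y → D h (h −ᵥ v) g ⊝ D h (h −ᵥ v) (g −ᵥ y)
        ≡ form (Δ a (monic g) (seq y) ⊠ Δ b (monic h) (seq v)) ⊕ ℓ (seq y ⊠ seq v)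
      D-difference h v g y = begin
        D h (h −ᵥ v) g ⊝ D h (h −ᵥ v) (g −ᵥ y)
          ≡⟨ cong₂ _⊝_ (diff g) (diff (g −ᵥ y)) ⟩
        (form (S g ⊠ Nb) ⊕ ℓ (monic g ⊠ seq v)) ⊝ (form (S (g −ᵥ y) ⊠ Nb) ⊕ ℓ (monic (g −ᵥ y) ⊠ seq v))
          ≡⟨ FS.solve 4 (λ a b c d → (a FS.:+ b) FS.:- (c FS.:+ d) FS.:= (a FS.:+ FS.:- c) FS.:+ (b FS.:+ FS.:- d)) refl _ _ _ _ ⟩
        (form (S g ⊠ Nb) ⊝ form (S (g −ᵥ y) ⊠ Nb)) ⊕ (ℓ (monic g ⊠ seq v) ⊝ ℓ (monic (g −ᵥ y) ⊠ seq v))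
          ≡⟨ cong₂ _⊕_ (linear-difference form-linear (S g) (S (g −ᵥ y)) Nb) (linear-difference ℓ-linear (monic g) (monic (g −ᵥ y)) (seq v)) ⟩
        form ((S g ⊞ ⊟ S (g −ᵥ y)) ⊠ Nb) ⊕ ℓ ((monic g ⊞ ⊟ monic (g −ᵥ y)) ⊠ seq v)
          ≡⟨ cong₂ _⊕_ (form.respects (SR.*-congʳ (Δ-difference a (monic-−ᵥ g y))))
               (ℓ.respects (SR.*-congʳ (≈-trans (SR.+-congˡ (SR.-‿cong (monic-−ᵥ g y)))
                 (solve 2 (λ h v → h :+ :- (h :+ :- v) := v) ≈-refl (monic g) (seq y))))) ⟩
        form (Δ a (monic g) (seq y) ⊠ Nb) ⊕ ℓ (seq y ⊠ seq v) ∎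
        where
        open ≡-Reasoning
        Nb = Δ b (monic h) (seq v)
        S : Vec Carrier a → Seq
        S g = monic g ⊠ rev a (monic g)
        diff : ∀ g → D h (h −ᵥ v) g ≡ form (S g ⊠ Nb) ⊕ ℓ (monic g ⊠ seq v)
        diff g = Q-difference a b a+b≡n (Deg<-monic g) (Deg<-monic h) (Deg<-monic (h −ᵥ v)) (monic-−ᵥ h v)
        linear-difference : ∀ {Λ} → Linear Λ → ∀ p r s → Λ (p ⊠ s) ⊝ Λ (r ⊠ s) ≡ Λ ((p ⊞ ⊟ r) ⊠ s)
        linear-difference {Λ} L p r s = sym (trans (respects (solve 3 (λ p r s → (p :+ :- r) :* s := p :* s :+ :- (r :* s)) ≈-refl p r s))
          (trans (add _ _) (cong (_⊕_ _) (negate _))))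
          where open Linear L

      -- After the substitution g′ = g - y, h′ = h - v the phase is affine in g and in h separately, and dropping the inhomogeneous
      -- parts only increases a κ-sum.
      E≤G : E ℤ.≤ G
      E≤G = begin
        E
          ≡⟨ SumV-difference b _ ⟩
        SumV b (λ v → SumV b (λ h → SumV a (λ g → SumV a (λ g′ → κ (D h (h −ᵥ v) g ⊝ D h (h −ᵥ v) g′)))))
          ≡⟨ Sum-cong (vecs b) (λ v → Sum-cong (vecs b) (λ h → trans (SumV-difference a _)
               (Sum-cong (vecs a) (λ y → Sum-cong (vecs a) (λ g → cong κ (D-difference h v g y)))))) ⟩
        SumV b (λ v → SumV b (λ h → SumV a (λ y → SumV a (λ g → κ (form (Δ a (monic g) (seq y) ⊠ Δ b (monic h) (seq v)) ⊕ ℓ (seq y ⊠ seq v))))))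
          ≤⟨ Sum-mono (vecs b) (λ v → Sum-mono (vecs b) (λ h → Sum-mono (vecs a) (λ y → drop-affine a (seq y) (Δ b (monic h) (seq v)) (ℓ (seq y ⊠ seq v))))) ⟩
        SumV b (λ v → SumV b (λ h → SumV a (λ y → κSum a (pair a (seq y) (Δ b (monic h) (seq v))))))
          ≡⟨ Sum-cong (vecs b) (λ v → trans (Sum-swap (vecs b) (vecs a) _) (Sum-cong (vecs a) (λ y → Sum-swap (vecs b) (vecs a) _))) ⟩
        SumV b (λ v → SumV a (λ y → SumV a (λ x → SumV b (λ h → κ (form (P a (seq x) (seq y) ⊠ Δ b (monic h) (seq v)))))))
          ≤⟨ Sum-mono (vecs b) (λ v → Sum-mono (vecs a) (λ y → Sum-mono (vecs a) (λ x → second v y x))) ⟩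
        SumV b (λ v → SumV a (λ y → SumV a (λ x → κSum b (pair b (seq v) (P a (seq x) (seq y))))))
          ≡⟨ Sum-cong (vecs b) (λ v → Sum-cong (vecs a) (λ y → trans (Sum-swap (vecs a) (vecs b) _)
               (Sum-cong (vecs b) (λ u → Sum-cong (vecs a) (λ x → cong κ (form-comm _ _)))))) ⟩
        G ∎
        where
        open ℤ.≤-Reasoning
        second : ∀ v y x → SumV b (λ h → κ (form (P a (seq x) (seq y) ⊠ Δ b (monic h) (seq v)))) ℤ.≤ κSum b (pair b (seq v) (P a (seq x) (seq y)))
        second v y x = ℤ.≤-trans (ℤ.≤-reflexive (Sum-cong (vecs b) (λ h → cong κ (trans (form-comm _ _) (sym (FR.+-identityʳ _))))))
          (drop-affine b (seq v) (P a (seq x) (seq y)) 0F)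

      module _ (α : Vec Carrier a → ℤ) (β : Vec Carrier b → ℤ) where

        S ∥α∥ ∥β∥ : ℤ
        S = SumV a (λ g → α g * SumV b (λ h → β h * Φ (monic g ⊠ monic h)))
        ∥α∥ = SumV a (λ g → α g * α g)
        ∥β∥ = SumV b (λ h → β h * β h)

        Y : Vec Carrier a → ℤ
        Y g = SumV b (λ h → β h * Φ (monic g ⊠ monic h))

        X : Vec Carrier b → Vec Carrier b → ℤ
        X h h′ = SumV a (λ g → κ (D h h′ g))

        Z ΣY² ΣX² : ℤ
        Z   = SumV b (λ h → SumV b (λ h′ → (β h * β h′) * X h h′))
        ΣY² = SumV a (λ g → Y g * Y g)
        ΣX² = SumV b (λ h → SumV b (λ h′ → X h h′ * X h h′))

        ΣY²≤ : ΣY² ℤ.≤ + q * Z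
        ΣY²≤ = ℤ.≤-trans (Sum-mono (vecs a) (λ g → κ-square (vecs b) β (λ h → Q (monic g ⊠ monic h)) γ))
          (ℤ.≤-reflexive (trans (Sum-*ˡ (vecs a) (+ q) _) (*-congʳ (+ q)
            (trans (Sum-swap (vecs a) (vecs b) _) (Sum-cong (vecs b) (λ h → trans (Sum-swap (vecs a) (vecs b) _)
              (Sum-cong (vecs b) (λ h′ → Sum-*ˡ (vecs a) (β h * β h′) _))))))))

        ΣX²≤ : ΣX² ℤ.≤ + q * E
        ΣX²≤ = ℤ.≤-trans (Sum-mono (vecs b) (λ h → Sum-mono (vecs b) (λ h′ → subst (λ s → s * s ℤ.≤ + q * SumV a (λ g → SumV a (λ g′ → κ (D h h′ g ⊝ D h h′ g′))))
            (Sum-cong (vecs a) (λ g → cong κ (trans (cong (_⊕_ _) ⊖-zero) (FR.+-identityʳ _)))) (κ-square₁ (vecs a) (D h h′) 0F))))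
          (ℤ.≤-reflexive (trans (Sum-cong (vecs b) (λ h → Sum-*ˡ (vecs b) (+ q) _)) (Sum-*ˡ (vecs b) (+ q) _)))

        Z²≤ : Z * Z ℤ.≤ (∥β∥ * ∥β∥) * ΣX²
        Z²≤ = subst₂ ℤ._≤_ (cong₂ _*_ pairs pairs) (cong₂ _*_ squares (Sum-cartesian _,_ (vecs b) (vecs b) _))
          (cauchy-schwarz (cartesianProduct (vecs b) (vecs b)) (λ (h , h′) → β h * β h′) (λ (h , h′) → X h h′))
          where
          open import Data.List using (cartesianProduct)
          open import Data.Integer.Solver using () renaming (module +-*-Solver to ℤS)
          pairs : Sum (cartesianProduct (vecs b) (vecs b)) (λ (h , h′) → (β h * β h′) * X h h′) ≡ Z
          pairs = Sum-cartesian _,_ (vecs b) (vecs b) _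
          squares : Sum (cartesianProduct (vecs b) (vecs b)) (λ (h , h′) → (β h * β h′) * (β h * β h′)) ≡ ∥β∥ * ∥β∥
          squares = trans (Sum-cartesian _,_ (vecs b) (vecs b) _) (trans (Sum-cong (vecs b) (λ h → Sum-cong (vecs b) (λ h′ →
            ℤS.solve 2 (λ x y → (x ℤS.:* y) ℤS.:* (x ℤS.:* y) ℤS.:= (x ℤS.:* x) ℤS.:* (y ℤS.:* y)) refl (β h) (β h′))))
            (Sum-product (vecs b) (vecs b) _ _))

        square-sum-nonneg : ∀ {A : Set} (L : List A) (f : A → ℤ) → 0ℤ ℤ.≤ Sum L (λ x → f x * f x)
        square-sum-nonneg L f = Sum-nonneg L (λ x → square-nonneg (f x))

        -- Cauchy-Schwarz over g removes α and `κ-square` opens the square in h; Cauchy-Schwarz over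
        -- the pairs h, h′ removes β and `κ-square₁` opens the square in g. This leads to E, bounded
        -- by G.
        bound : (S * S) * (S * S) ℤ.≤ (∥α∥ * ∥α∥) * ((+ q * + q) * ((∥β∥ * ∥β∥) * (+ q * G)))
        bound = begin
          (S * S) * (S * S)
            ≤⟨ square-mono (square-nonneg S) (cauchy-schwarz (vecs a) α Y) ⟩
          (∥α∥ * ΣY²) * (∥α∥ * ΣY²)
            ≡⟨ interchange ∥α∥ ΣY² ⟩
          (∥α∥ * ∥α∥) * (ΣY² * ΣY²)
            ≤⟨ *-mono-nonneg (square-nonneg ∥α∥) (square-mono (square-sum-nonneg (vecs a) Y) ΣY²≤) ⟩
          (∥α∥ * ∥α∥) * ((+ q * Z) * (+ q * Z))
            ≡⟨ *-congʳ (∥α∥ * ∥α∥) (interchange (+ q) Z) ⟩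
          (∥α∥ * ∥α∥) * ((+ q * + q) * (Z * Z))
            ≤⟨ *-mono-nonneg (square-nonneg ∥α∥) (*-mono-nonneg (square-nonneg (+ q)) (ℤ.≤-trans Z²≤
                 (*-mono-nonneg (square-nonneg ∥β∥) (ℤ.≤-trans ΣX²≤ (*-mono-nonneg (pos-nonneg q) E≤G))))) ⟩
          (∥α∥ * ∥α∥) * ((+ q * + q) * ((∥β∥ * ∥β∥) * (+ q * G))) ∎
          where
          open ℤ.≤-Reasoning
          open import Data.Integer.Solver using () renaming (module +-*-Solver to ℤS)
          interchange : ∀ x y → (x * y) * (x * y) ≡ (x * x) * (y * y)
          interchange = ℤS.solve 2 (λ x y → (x ℤS.:* y) ℤS.:* (x ℤS.:* y) ℤS.:= (x ℤS.:* x) ℤS.:* (y ℤS.:* y)) refl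

-- The monoid of monic polynomials: divisibility and irreducibles.

module MonicPolynomials (F : FiniteField) where

  open import Data.Nat using (_+_; _≤_)
  open import Data.Integer using (_*_)
  open import Data.Vec using ([])
  open import Data.List using ([])
  open import Data.List.Relation.Unary.AllPairs using ([])
  open FiniteSums
  open FieldSums F
  open PowerSeries F
  open Polynomials F
  open LinearForms F
  open BilinearForms F
  open SS using (solve; _:=_; _:+_; _:*_; _:-_; :-_)

  -- The pair (d, v) stands for t^d plus the polynomial with coefficients v. Leading coefficient and
  -- degree are built in, so equality of pairs is equality of polynomials and the only unit is `ε`.
  M : Set
  M = Σ ℕ (Vec Carrier)

  deg : M → ℕ
  deg = proj₁

  ser : M → Seq
  ser (d , v) = monic v

  ser-deg : ∀ f → Deg< (suc (deg f)) (ser f)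
  ser-deg (d , v) = Deg<-monic v

  ser-top : ∀ f → ser f (deg f) ≡ 1F
  ser-top (d , v) = monic-top v

  1≢0 : 1F ≢ 0F
  1≢0 e = 0≢1 (sym e)

  ser-exact : ∀ f → Exact (deg f) (ser f)
  ser-exact f = ser-deg f , λ e → 1≢0 (trans (sym (ser-top f)) e)

  Exact-unique : ∀ {d e p} → Exact d p → Exact e p → d ≡ e
  Exact-unique {d} {e} (dd , nd) (de , ne) with ℕ.<-cmp d e
  ... | tri< lt _ _ = ⊥-elim (ne (dd e lt))
  ... | tri≈ _ eq _ = eq
  ... | tri> _ _ gt = ⊥-elim (nd (de d gt))

  ser-injective : ∀ {f g} → ser f ≈ ser g → f ≡ g
  ser-injective {d , v} {e , w} eq with Exact-unique (ser-exact (d , v)) (Exact-cong (≈-sym eq) (ser-exact (e , w)))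
  ... | refl = cong (d ,_) (seq-injective (≈-trans (solve 2 (λ v x → v := (v :+ x) :+ :- x) ≈-refl (seq v) (X^ d))
    (≈-trans (SR.+-congʳ eq) (solve 2 (λ v x → (v :+ x) :+ :- x := v) ≈-refl (seq w) (X^ d)))))

  monic-vec : ∀ d {p} → Deg< (suc d) p → p d ≡ 1F → monic (vec d p) ≈ p
  monic-vec d {p} lt top = mk≈ go
    where
    go : ∀ k → seq (vec d p) k ⊕ X^ d k ≡ p k
    go k with ℕ.<-cmp k d
    ... | tri< k<d k≢d _ = trans (cong₂ _⊕_ (seq-vec-at d p k k<d) (X^-other d k k≢d)) (FR.+-identityʳ (p k))
    ... | tri≈ _ refl _  = trans (monic-top (vec d p)) (sym top)
    ... | tri> _ _ d<k   = trans (Deg<-monic (vec d p) k d<k) (sym (lt k d<k))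

  ε : M
  ε = 0 , []

  ser-ε : ser ε ≈ 1s
  ser-ε = SR.+-identityˡ 1s

  infixl 7 _∙_
  abstract
    _∙_ : M → M → M
    f ∙ g = deg f + deg g , vec (deg f + deg g) (ser f ⊠ ser g)

    deg-∙ : ∀ f g → deg (f ∙ g) ≡ deg f + deg g
    deg-∙ f g = refl

    ser-∙ : ∀ f g → ser (f ∙ g) ≈ ser f ⊠ ser g
    ser-∙ f g = monic-vec (deg f + deg g) (Deg<-⊠ (suc (deg f)) (deg g) (ser-deg f) (ser-deg g))
      (trans (⊠-top (deg f) (deg g) (ser-deg f) (ser-deg g)) (trans (cong₂ _⊙_ (ser-top f) (ser-top g)) (FR.*-identityˡ 1F)))

  ∙-comm : ∀ f g → f ∙ g ≡ g ∙ f
  ∙-comm f g = ser-injective (≈-trans (ser-∙ f g) (≈-trans (SR.*-comm _ _) (≈-sym (ser-∙ g f))))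

  ∙-assoc : ∀ f g h → (f ∙ g) ∙ h ≡ f ∙ (g ∙ h)
  ∙-assoc f g h = ser-injective (≈-trans (ser-∙ (f ∙ g) h) (≈-trans (SR.*-congʳ (ser-∙ f g))
    (≈-trans (SR.*-assoc _ _ _) (≈-trans (SR.*-congˡ (≈-sym (ser-∙ g h))) (≈-sym (ser-∙ f (g ∙ h)))))))

  ∙-identityˡ : ∀ f → ε ∙ f ≡ f
  ∙-identityˡ f = ser-injective (≈-trans (ser-∙ ε f) (≈-trans (SR.*-congʳ ser-ε) (SR.*-identityˡ _)))

  ∙-identityʳ : ∀ f → f ∙ ε ≡ f
  ∙-identityʳ f = trans (∙-comm f ε) (∙-identityˡ f)

  ∙-cancelˡ : ∀ f {g h} → f ∙ g ≡ f ∙ h → g ≡ h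
  ∙-cancelˡ f {g} {h} eq = ser-injective (cancelˡ (ser-exact f) (Exact⇒Poly (ser-exact g)) (Exact⇒Poly (ser-exact h))
    (≈-trans (≈-sym (ser-∙ f g)) (≈-trans (mk≈ (λ k → cong (λ u → ser u k) eq)) (ser-∙ f h))))

  deg≡0⇒ε : ∀ {f} → deg f ≡ 0 → f ≡ ε
  deg≡0⇒ε {zero , []} refl = refl

  infix 4 _∣_
  _∣_ : M → M → Set
  g ∣ f = ∃ λ s → g ∙ s ≡ f

  ∣⇒deg≤ : ∀ {g f} → g ∣ f → deg g ≤ deg f
  ∣⇒deg≤ {g} (s , refl) = ℕ.≤-trans (ℕ.m≤m+n (deg g) (deg s)) (ℕ.≤-reflexive (sym (deg-∙ g s)))

  ∣-refl : ∀ {f} → f ∣ f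
  ∣-refl {f} = ε , ∙-identityʳ f

  ∣-trans : ∀ {f g h} → f ∣ g → g ∣ h → f ∣ h
  ∣-trans {f} (s , refl) (t , refl) = s ∙ t , sym (∙-assoc f s t)

  ∣-∙ˡ : ∀ {p f} g → p ∣ f → p ∣ g ∙ f
  ∣-∙ˡ {p} g (s , refl) = s ∙ g , trans (sym (∙-assoc p s g)) (∙-comm (p ∙ s) g)

  ∣-∙-cancelˡ : ∀ f {g h} → f ∙ g ∣ f ∙ h → g ∣ h
  ∣-∙-cancelˡ f {g} {h} (s , eq) = s , ∙-cancelˡ f (trans (sym (∙-assoc f g s)) eq)

  infix 4 _≟M_ _∣?_
  _≟M_ : (f g : M) → Dec (f ≡ g)
  _≟M_ = Product.≡-dec ℕ._≟_ _≟V_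

  resize : ∀ {d e} (eq : d ≡ e) (s : Vec Carrier d) → _≡_ {A = M} (e , subst (Vec Carrier) eq s) (d , s)
  resize refl s = refl

  abstract
    _∣?_ : ∀ g f → Dec (g ∣ f)
    g ∣? f with any? (λ s → g ∙ (deg f ∸ deg g , s) ≟M f) (vecs (deg f ∸ deg g))
    ... | yes p = let s , eq = satisfied p in yes ((deg f ∸ deg g , s) , eq)
    ... | no np = no λ where
      ((e , s) , refl) → let size = sym (trans (cong (_∸ deg g) (deg-∙ g (e , s))) (ℕ.m+n∸m≡n (deg g) e)) in
        np (lose (vecs-complete (subst (Vec Carrier) size s)) (cong (g ∙_) (resize size s)))

  quotient : ∀ f g {s} → Poly s → ser f ≈ ser g ⊠ s → ∃ λ s′ → g ∙ s′ ≡ f × ser s′ ≈ s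
  quotient f g {s} (N , lt) eq with zero-or-exact N lt
  ... | inj₁ s≈0 = ⊥-elim (proj₂ (ser-exact f) (at (≈-trans eq (≈-trans (SR.*-congˡ s≈0) (SR.zeroʳ _))) (deg f)))
  ... | inj₂ (e , _ , s-exact) = s′ , ser-injective (≈-trans (ser-∙ g s′) (≈-trans (SR.*-congˡ s′≈) (≈-sym eq))) , s′≈
    where
    d+e : deg f ≡ deg g + e
    d+e = Exact-unique (ser-exact f) (Exact-cong (≈-sym eq) (Exact-⊠ (ser-exact g) s-exact))
    s-top : s e ≡ 1F
    s-top = begin
      s e                          ≡⟨ FR.*-identityˡ (s e) ⟨
      1F ⊙ s e                     ≡⟨ cong (_⊙ s e) (ser-top g) ⟨
      ser g (deg g) ⊙ s e          ≡⟨ ⊠-top (deg g) e (ser-deg g) (proj₁ s-exact) ⟨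
      (ser g ⊠ s) (deg g + e)      ≡⟨ at eq (deg g + e) ⟨
      ser f (deg g + e)            ≡⟨ cong (ser f) d+e ⟨
      ser f (deg f)                ≡⟨ ser-top f ⟩
      1F ∎
      where open ≡-Reasoning
    s′ : M
    s′ = e , vec e s
    s′≈ : ser s′ ≈ s
    s′≈ = monic-vec e (proj₁ s-exact) s-top

  -- Coprimality of k and k′ is recorded as the divisibility it implies, since Bezout coefficients
  -- are not monic.
  record CommonFactor (f g : M) : Set where
    field
      x k k′ : M
      f≡ : f ≡ x ∙ k
      g≡ : g ≡ x ∙ k′
      coprime : ∀ j l → k ∙ j ≡ k′ ∙ l → k ∣ l

  fromGCD : ∀ f g → GCD (ser f) (ser g) → CommonFactor f g
  fromGCD f g G = record
    { x = x′ ; k = k₁ ; k′ = k₁′ ; f≡ = sym f≡ ; g≡ = sym g≡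
    ; coprime = divides }
    where
    open GCD G
    -- `lead⁻¹` is the leading coefficient of x, and `lead` the scalar that makes x monic. Scaling
    -- the cofactors by the former keeps the products.
    lead lead⁻¹ : Carrier
    lead⁻¹ = x d
    lead = proj₁ (inverse (x d) (proj₂ x-exact))
    inv : lead⁻¹ ⊙ lead ≡ 1F
    inv = proj₂ (inverse (x d) (proj₂ x-exact))
    x′ : M
    x′ = d , vec d (lead • x)
    x′≈ : ser x′ ≈ lead • x
    x′≈ = monic-vec d (Deg<-• lead (proj₁ x-exact)) (trans (FR.*-comm lead (x d)) inv)
    unscale : ∀ l → x ⊠ l ≈ (lead • x) ⊠ (lead⁻¹ • l)
    unscale l = ≈-trans (≈-trans (≈-sym (≈-trans (•≈⊠ 1F _) (≈-trans (SR.*-congʳ (mk≈ (λ k → FR.*-identityˡ _))) (SR.*-identityˡ _))))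
        (mk≈ {r = (lead⁻¹ ⊙ lead) • (x ⊠ l)} (λ k → cong (_⊙ (x ⊠ l) k) (sym inv))))
      (≈-trans (mk≈ {r = lead⁻¹ • (lead • (x ⊠ l))} (λ k → FR.*-assoc lead⁻¹ lead _))
      (≈-trans (≈-trans (•≈⊠ lead⁻¹ _) (SR.*-congˡ (•≈⊠ lead _)))
      (≈-trans (solve 4 (λ u v x l → u :* (v :* (x :* l)) := (v :* x) :* (u :* l)) ≈-refl (lead⁻¹ • 1s) (lead • 1s) x l)
        (SR.*-cong (≈-sym (•≈⊠ lead x)) (≈-sym (•≈⊠ lead⁻¹ l))))))
    kq = quotient f x′ (Poly-• lead⁻¹ k-poly) (≈-trans f≈ (≈-trans (unscale k) (SR.*-congʳ (≈-sym x′≈))))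
    kq′ = quotient g x′ (Poly-• lead⁻¹ k′-poly) (≈-trans g≈ (≈-trans (unscale k′) (SR.*-congʳ (≈-sym x′≈))))
    k₁ = proj₁ kq
    k₁′ = proj₁ kq′
    f≡ = proj₁ (proj₂ kq)
    g≡ = proj₁ (proj₂ kq′)
    rescale : ∀ u l → (lead • u) ⊠ (lead⁻¹ • l) ≈ u ⊠ l
    rescale u l = ≈-trans (SR.*-cong (•≈⊠ lead u) (•≈⊠ lead⁻¹ l))
      (≈-trans (solve 4 (λ s t u l → (s :* u) :* (t :* l) := (s :* t) :* (u :* l)) ≈-refl (lead • 1s) (lead⁻¹ • 1s) u l)
      (≈-trans (SR.*-congʳ unit) (SR.*-identityˡ _)))
      where
      unit : (lead • 1s) ⊠ (lead⁻¹ • 1s) ≈ 1s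
      unit = ≈-trans (≈-sym (•≈⊠ lead _)) (mk≈ (λ k → trans (sym (FR.*-assoc lead lead⁻¹ (1s k)))
        (trans (cong (_⊙ 1s k) (trans (FR.*-comm lead lead⁻¹) inv)) (FR.*-identityˡ _))))
    bez : (lead • α) ⊠ ser k₁ ⊞ (lead • β) ⊠ ser k₁′ ≈ 1s
    bez = ≈-trans (SR.+-cong (≈-trans (SR.*-congˡ (proj₂ (proj₂ kq))) (rescale α k)) (≈-trans (SR.*-congˡ (proj₂ (proj₂ kq′))) (rescale β k′))) bezout
    divides : ∀ j l → k₁ ∙ j ≡ k₁′ ∙ l → k₁ ∣ l
    divides j l eq = proj₁ found , proj₁ (proj₂ found)
      where
      found = quotient l k₁
        (Poly-⊞ (Poly-⊠ (Poly-• lead α-poly) (Exact⇒Poly (ser-exact l))) (Poly-⊠ (Poly-• lead β-poly) (Exact⇒Poly (ser-exact j))))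
        (coprime-divides bez (≈-trans (≈-sym (ser-∙ k₁ j)) (≈-trans (mk≈ (λ i → cong (λ u → ser u i) eq)) (ser-∙ k₁′ l))))

  abstract
    commonFactor : ∀ f g → CommonFactor f g
    commonFactor f g = fromGCD f g (gcd (suc (deg g)) (ser-exact f) (ser-deg g))

  record Refinement (a b c d : M) : Set where
    field
      x y z w : M
      a≡ : a ≡ x ∙ y
      b≡ : b ≡ z ∙ w
      c≡ : c ≡ x ∙ z
      d≡ : d ≡ y ∙ w

  abstract
    -- Take x = gcd(a, c), a = x k and c = x k′. Then k b = k′ d, so k divides d, and the quotient
    -- is w.
    refine : ∀ a b c d → a ∙ b ≡ c ∙ d → Refinement a b c d
    refine a b c d eq = split (commonFactor a c)
      where
      split : CommonFactor a c → Refinement a b c d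
      split cf = record
        { x = x ; y = k ; z = k′ ; w = w ; a≡ = f≡ ; c≡ = g≡ ; d≡ = sym kw≡d
        ; b≡ = ∙-cancelˡ k (trans kb≡k′d (trans (cong (k′ ∙_) (sym kw≡d)) (trans (sym (∙-assoc k′ k w)) (trans (cong (_∙ w) (∙-comm k′ k)) (∙-assoc k k′ w))))) }
        where
        open CommonFactor cf
        kb≡k′d : k ∙ b ≡ k′ ∙ d
        kb≡k′d = ∙-cancelˡ x (trans (sym (∙-assoc x k b)) (trans (cong (_∙ b) (sym f≡)) (trans eq (trans (cong (_∙ d) g≡) (∙-assoc x k′ d)))))
        w : M
        w = proj₁ (coprime b d kb≡k′d)
        kw≡d : k ∙ w ≡ d
        kw≡d = proj₂ (coprime b d kb≡k′d)

  Irr : M → Set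
  Irr p = p ≢ ε × (∀ g → g ∣ p → g ≡ ε ⊎ g ≡ p)

  abstract
    -- Refining a b = p s gives p = x z with x dividing a and z dividing b; irreducibility makes one
    -- of x, z equal to p.
    euclid : ∀ {p} → Irr p → ∀ a b → p ∣ a ∙ b → p ∣ a ⊎ p ∣ b
    euclid {p} (_ , irr) a b (s , eq) = split (refine a b p s (sym eq))
      where
      split : Refinement a b p s → p ∣ a ⊎ p ∣ b
      split r = cases (irr x (z , sym c≡))
        where
        open Refinement r
        cases : x ≡ ε ⊎ x ≡ p → p ∣ a ⊎ p ∣ b
        cases (inj₁ x≡ε) = inj₂ (w , trans (cong (_∙ w) (trans c≡ (trans (cong (_∙ z) x≡ε) (∙-identityˡ z)))) (sym b≡))
        cases (inj₂ x≡p) = inj₁ (y , trans (cong (_∙ y) (sym x≡p)) (sym a≡))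

  euclid′ : ∀ {p p′} → Irr p → Irr p′ → p ≢ p′ → ∀ f → p ∣ p′ ∙ f → p ∣ f
  euclid′ {p} {p′} ip ip′ ne f dv = cases (euclid ip p′ f dv)
    where
    same : p ≡ ε ⊎ p ≡ p′ → p ∣ f
    same (inj₁ p≡ε)  = ⊥-elim (proj₁ ip p≡ε)
    same (inj₂ p≡p′) = ⊥-elim (ne p≡p′)
    cases : p ∣ p′ ⊎ p ∣ f → p ∣ f
    cases (inj₁ p∣p′) = same (proj₂ ip′ p p∣p′)
    cases (inj₂ p∣f)  = p∣f

  level : ℕ → List M
  level d = map (d ,_) (vecs d)

  below : ℕ → List M
  below zero    = []
  below (suc N) = level N ++ below N

  ∈-level⁺ : ∀ f → f ∈ level (deg f)
  ∈-level⁺ (d , v) = ∈-map⁺ (d ,_) (vecs-complete v)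

  ∈-level⁻ : ∀ {f d} → f ∈ level d → deg f ≡ d
  ∈-level⁻ {d = d} i with ∈-map⁻ (d ,_) i
  ... | _ , _ , refl = refl

  ∈-below⁺ : ∀ {f N} → deg f < N → f ∈ below N
  ∈-below⁺ {f} {suc N} (s≤s le) with ℕ.m≤n⇒m<n∨m≡n le
  ... | inj₁ lt   = ∈-++⁺ʳ (level N) (∈-below⁺ lt)
  ... | inj₂ refl = ∈-++⁺ˡ (∈-level⁺ f)

  ∈-below⁻ : ∀ {f} N → f ∈ below N → deg f < N
  ∈-below⁻ (suc N) i with ∈-++⁻ (level N) i
  ... | inj₁ j = ℕ.≤-reflexive (cong suc (∈-level⁻ j))
  ... | inj₂ j = ℕ.m≤n⇒m≤1+n (∈-below⁻ N j)

  level-unique : ∀ d → Unique (level d)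
  level-unique d = Unique.map⁺ (λ { refl → refl }) (vecs-unique d)

  below-unique : ∀ N → Unique (below N)
  below-unique zero    = []
  below-unique (suc N) = Unique.++⁺ (level-unique N) (below-unique N)
    (λ (i , j) → ℕ.<-irrefl (∈-level⁻ i) (∈-below⁻ N j))

  abstract
    irr? : ∀ p → Dec (Irr p)
    irr? p = ¬? (p ≟M ε) ×-dec map′
      (λ all g g∣p → All.lookup all (∈-below⁺ (s≤s (∣⇒deg≤ {g} g∣p))) g∣p) (λ irr → All.tabulate (λ {g} _ → irr g))
      (all? (λ g → (g ∣? p) →-dec ((g ≟M ε) ⊎-dec (g ≟M p))) (below (suc (deg p))))

  deg≥1 : ∀ {f} → f ≢ ε → 1 ≤ deg f
  deg≥1 {zero , []}  ne = ⊥-elim (ne refl)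
  deg≥1 {suc d , v} ne = s≤s z≤n

  abstract
    irreducible-factor : ∀ N f → deg f < N → f ≢ ε → ∃ λ p → Irr p × p ∣ f
    irreducible-factor (suc N) f (s≤s le) f≢ε with irr? f
    ... | yes irr = f , irr , ∣-refl
    ... | no ¬irr with any? (λ g → (g ∣? f) ×-dec (¬? (g ≟M ε) ×-dec ¬? (g ≟M f))) (below (suc (deg f)))
    ... | yes proper = let g , g∣f , g≢ε , g≢f = satisfied proper
                           p , ip , p∣g = irreducible-factor N g (ℕ.≤-trans (smaller g g∣f g≢f) le) g≢ε
                       in p , ip , ∣-trans {p} {g} p∣g g∣f
      where
      smaller : ∀ g → g ∣ f → g ≢ f → deg g < deg f
      smaller g (s , refl) g≢f = subst (deg g <_) (sym (deg-∙ g s)) (ℕ.m<m+n (deg g) (deg≥1 {s} (λ s≡ε → g≢f (sym (trans (cong (g ∙_) s≡ε) (∙-identityʳ g))))))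
    ... | no none = ⊥-elim (¬irr (f≢ε , λ g g∣f → classify g g∣f (g ≟M ε) (g ≟M f)))
      where
      classify : ∀ g → g ∣ f → Dec (g ≡ ε) → Dec (g ≡ f) → g ≡ ε ⊎ g ≡ f
      classify g g∣f (yes e) _       = inj₁ e
      classify g g∣f (no _)  (yes e) = inj₂ e
      classify g g∣f (no ne) (no nf) = ⊥-elim (none (lose (∈-below⁺ (s≤s (∣⇒deg≤ {g} g∣f))) (g∣f , ne , nf)))

  SumM : ℕ → (M → ℤ) → ℤ
  SumM d φ = SumV d (λ v → φ (d , v))

  Sum-level : ∀ d φ → Sum (level d) φ ≡ SumM d φ
  Sum-level d φ = Sum-map (d ,_) (vecs d) φ

  Sum-below : ∀ N φ → Sum (below N) φ ≡ Sum (downFrom N) (λ d → SumM d φ)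
  Sum-below zero    φ = refl
  Sum-below (suc N) φ = trans (Sum-++ (level N) (below N) φ) (cong₂ ℤ._+_ (Sum-level N φ) (Sum-below N φ))

  Sum-multiples : ∀ r g → deg g ≤ r → ∀ Ψ → SumM (r ∸ deg g) (λ k → Ψ (g ∙ k)) ≡ SumM r (λ f → 𝟙 (g ∣? f) * Ψ f)
  Sum-multiples r g le Ψ = begin
    SumM (r ∸ deg g) (λ k → Ψ (g ∙ k))
      ≡⟨ Sum-level (r ∸ deg g) _ ⟨
    Sum (level (r ∸ deg g)) (λ k → Ψ (g ∙ k))
      ≡⟨ Sum-cong∈ (level (r ∸ deg g)) (λ {k} i → sym (Sum-delta (level r) (level-unique r) _≟M_
           (subst (λ e → g ∙ k ∈ level e) (trans (deg-∙ g k) (trans (cong (_+_ (deg g)) (∈-level⁻ i)) (ℕ.m+[n∸m]≡n le))) (∈-level⁺ (g ∙ k))) Ψ)) ⟩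
    Sum (level (r ∸ deg g)) (λ k → Sum (level r) (λ f → 𝟙 (f ≟M g ∙ k) * Ψ f))
      ≡⟨ trans (Sum-swap (level (r ∸ deg g)) (level r) _) (Sum-cong (level r) (λ f → Sum-*ʳ (level (r ∸ deg g)) (Ψ f) _)) ⟩
    Sum (level r) (λ f → Sum (level (r ∸ deg g)) (λ k → 𝟙 (f ≟M g ∙ k)) * Ψ f)
      ≡⟨ Sum-cong∈ (level r) (λ {f} i → cong (_* Ψ f) (count f (∈-level⁻ i))) ⟩
    Sum (level r) (λ f → 𝟙 (g ∣? f) * Ψ f)
      ≡⟨ Sum-level r _ ⟩
    SumM r (λ f → 𝟙 (g ∣? f) * Ψ f) ∎
    where
    open ≡-Reasoning
    count : ∀ f → deg f ≡ r → Sum (level (r ∸ deg g)) (λ k → 𝟙 (f ≟M g ∙ k)) ≡ 𝟙 (g ∣? f)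
    count f refl with g ∣? f
    ... | no ¬dv = trans (Sum-cong (level (r ∸ deg g)) (λ k → 𝟙-no (f ≟M g ∙ k) (λ e → ¬dv (k , sym e)))) (Sum-zero (level (r ∸ deg g)))
    ... | yes (s , refl) = trans (Sum-single (level (r ∸ deg g)) (level-unique (r ∸ deg g))
        (subst (λ e → s ∈ level e) (sym (trans (cong (_∸ deg g) (deg-∙ g s)) (ℕ.m+n∸m≡n (deg g) (deg s)))) (∈-level⁺ s))
        (λ k k≢s → 𝟙-no (g ∙ s ≟M g ∙ k) (λ e → k≢s (sym (∙-cancelˡ g e))))) (𝟙-yes (g ∙ s ≟M g ∙ s) refl)

-- The Möbius and von Mangoldt functions.

module ArithmeticFunctions (F : FiniteField) where

  open import Data.Integer using (_+_; _*_; _-_; ∣_∣; _≤_)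
  open import Data.List using ([]; _∷_)
  open import Data.List.Relation.Unary.All using ([]; _∷_)
  open import Data.List.Relation.Unary.AllPairs using ([]; _∷_)
  open FiniteSums
  open FieldSums F
  open MonicPolynomials F

  ¬∣ε : ∀ {p} → Irr p → ¬ p ∣ ε
  ¬∣ε {p} ip p∣ε = proj₁ ip (deg≡0⇒ε (ℕ.n≤0⇒n≡0 (∣⇒deg≤ {p} {ε} p∣ε)))

  ε∣ : ∀ f → ε ∣ f
  ε∣ f = f , ∙-identityˡ f

  -- Products e k of equal value f are collected over all splittings of the degree r: the Dirichlet
  -- convolution ω * 1 appears as weight of Ψ.
  convolve : ∀ (ω : M → ℤ) r (Ψ : M → ℤ) →
    Sum (downFrom (suc r)) (λ d → SumM d (λ e → ω e * SumM (r ∸ d) (λ k → Ψ (e ∙ k))))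
    ≡ SumM r (λ f → Sum (below (suc r)) (λ e → ω e * 𝟙 (e ∣? f)) * Ψ f)
  convolve ω r Ψ = begin
    Sum (downFrom (suc r)) (λ d → SumM d (λ e → ω e * SumM (r ∸ d) (λ k → Ψ (e ∙ k))))
      ≡⟨ Sum-cong∈ (downFrom (suc r)) (λ {d} i → Sum-cong (vecs d) (λ v → *-congʳ (ω (d , v))
           (Sum-multiples r (d , v) (ℕ.s≤s⁻¹ (∈-downFrom⁻ i)) Ψ))) ⟩
    Sum (downFrom (suc r)) (λ d → SumM d (λ e → ω e * SumM r (λ f → 𝟙 (e ∣? f) * Ψ f)))
      ≡⟨ Sum-below (suc r) _ ⟨
    Sum (below (suc r)) (λ e → ω e * SumM r (λ f → 𝟙 (e ∣? f) * Ψ f))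
      ≡⟨ Sum-cong (below (suc r)) (λ e → trans (sym (Sum-*ˡ (vecs r) (ω e) _)) (Sum-cong (vecs r) (λ v → sym (ℤ.*-assoc (ω e) _ _)))) ⟩
    Sum (below (suc r)) (λ e → SumM r (λ f → (ω e * 𝟙 (e ∣? f)) * Ψ f))
      ≡⟨ Sum-swap (below (suc r)) (vecs r) _ ⟩
    SumM r (λ f → Sum (below (suc r)) (λ e → (ω e * 𝟙 (e ∣? f)) * Ψ f))
      ≡⟨ Sum-cong (vecs r) (λ v → Sum-*ʳ (below (suc r)) (Ψ (r , v)) _) ⟩
    SumM r (λ f → Sum (below (suc r)) (λ e → ω e * 𝟙 (e ∣? f)) * Ψ f) ∎
    where open ≡-Reasoning

  Sum-divisor-delta : ∀ B f → deg f < B → ∀ g → Sum (below B) (λ e → 𝟙 (e ≟M g) * 𝟙 (e ∣? f)) ≡ 𝟙 (g ∣? f)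
  Sum-divisor-delta B f lt g with deg g ℕ.<? B
  ... | yes g<B = Sum-delta (below B) (below-unique B) _≟M_ (∈-below⁺ g<B) (λ e → 𝟙 (e ∣? f))
  ... | no g≮B  = trans (Sum-cong∈ (below B) (λ {e} i → cong (_* 𝟙 (e ∣? f)) (𝟙-no (e ≟M g) (λ { refl → g≮B (∈-below⁻ B i) }))))
    (trans (Sum-zero (below B)) (sym (𝟙-no (g ∣? f) (λ g∣f → g≮B (ℕ.≤-<-trans (∣⇒deg≤ {g} g∣f) lt)))))

  -- Möbius function: the expansion of ∏ (1 - [p]) over a list of irreducibles p.

  -- Dirichlet convolution of φ with the indicator of p.
  shiftBy : M → (M → ℤ) → M → ℤ
  shiftBy p φ e with p ∣? e
  ... | yes (s , _) = φ s
  ... | no _        = 0ℤ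

  shiftBy-∙ : ∀ p φ s → shiftBy p φ (p ∙ s) ≡ φ s
  shiftBy-∙ p φ s with p ∣? p ∙ s
  ... | yes (t , eq) = cong φ (∙-cancelˡ p eq)
  ... | no ¬dv       = ⊥-elim (¬dv (s , refl))

  shiftBy-no : ∀ p φ e → ¬ p ∣ e → shiftBy p φ e ≡ 0ℤ
  shiftBy-no p φ e ¬dv with p ∣? e
  ... | yes dv = ⊥-elim (¬dv dv)
  ... | no _   = refl

  mobius : List M → M → ℤ
  mobius []      e = 𝟙 (e ≟M ε)
  mobius (p ∷ L) e = mobius L e - shiftBy p (mobius L) e

  -- The support consists of products of members of L, which no other irreducible can divide.
  mobius-support : ∀ {L} → All Irr L → ∀ {p} → Irr p → p ∉ L → ∀ e → p ∣ e → mobius L e ≡ 0ℤ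
  mobius-support {[]} _ ip _ e p∣e = 𝟙-no (e ≟M ε) (λ { refl → ¬∣ε ip p∣e })
  mobius-support {l ∷ L} (il ∷ iL) {p} ip p∉ e p∣e = cong₂ _-_ (mobius-support iL ip (λ i → p∉ (there i)) e p∣e) (shifted (l ∣? e))
    where
    shifted : Dec (l ∣ e) → shiftBy l (mobius L) e ≡ 0ℤ
    shifted (no ¬dv) = shiftBy-no l (mobius L) e ¬dv
    shifted (yes (s , refl)) = trans (shiftBy-∙ l (mobius L) s)
      (mobius-support iL ip (λ i → p∉ (there i)) s (euclid′ ip il (λ { refl → p∉ (here refl) }) s p∣e))

  -- Of the two terms at most one is nonzero: if l divides e the first vanishes by `mobius-support`,
  -- if not the shifted one does.
  mobius-bound : ∀ {L} → All Irr L → Unique L → ∀ e → ∣ mobius L e ∣ ℕ.≤ 1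
  mobius-bound {[]} _ _ e with e ≟M ε
  ... | yes _ = ℕ.≤-refl
  ... | no _  = z≤n
  mobius-bound {l ∷ L} (il ∷ iL) (l∉ ∷ u) e = cases (l ∣? e)
    where
    cases : Dec (l ∣ e) → ∣ mobius (l ∷ L) e ∣ ℕ.≤ 1
    cases (no ¬dv) = subst (λ s → ∣ mobius L e - s ∣ ℕ.≤ 1) (sym (shiftBy-no l (mobius L) e ¬dv))
      (subst (λ s → ∣ s ∣ ℕ.≤ 1) (sym (ℤ.+-identityʳ (mobius L e))) (mobius-bound iL u e))
    cases (yes (s , refl)) = subst₂ (λ x y → ∣ x - y ∣ ℕ.≤ 1)
      (sym (mobius-support iL il (λ i → All.lookup l∉ i refl) (l ∙ s) (s , refl))) (sym (shiftBy-∙ l (mobius L) s))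
      (subst (λ k → k ℕ.≤ 1) (sym (trans (cong ∣_∣ (ℤ.+-identityˡ (ℤ.- mobius L s))) (ℤ.∣-i∣≡∣i∣ (mobius L s)))) (mobius-bound iL u s))

  coprime? : ∀ L f → Dec (All (λ l → ¬ l ∣ f) L)
  coprime? L f = all? (λ l → ¬? (l ∣? f)) L

  shiftBy-sum : ∀ B p φ f → deg (p ∙ f) < B →
    Sum (below B) (λ e → shiftBy p φ e * 𝟙 (e ∣? p ∙ f)) ≡ Sum (below B) (λ e → φ e * 𝟙 (e ∣? f))
  shiftBy-sum B p φ f lt = begin
    Sum (below B) (λ e → shiftBy p φ e * 𝟙 (e ∣? p ∙ f))
      ≡⟨ Sum-cong∈ (below B) (λ {e} i → trans (cong (_* 𝟙 (e ∣? p ∙ f)) (expand e (∈-below⁻ B i))) (sym (Sum-*ʳ (below B) (𝟙 (e ∣? p ∙ f)) _))) ⟩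
    Sum (below B) (λ e → Sum (below B) (λ s → (φ s * 𝟙 (e ≟M p ∙ s)) * 𝟙 (e ∣? p ∙ f)))
      ≡⟨ Sum-swap (below B) (below B) _ ⟩
    Sum (below B) (λ s → Sum (below B) (λ e → (φ s * 𝟙 (e ≟M p ∙ s)) * 𝟙 (e ∣? p ∙ f)))
      ≡⟨ Sum-cong (below B) (λ s → trans (Sum-cong (below B) (λ e → ℤ.*-assoc (φ s) _ _)) (trans (Sum-*ˡ (below B) (φ s) _)
           (*-congʳ (φ s) (trans (Sum-divisor-delta B (p ∙ f) lt (p ∙ s))
             (𝟙-⇔ (p ∙ s ∣? p ∙ f) (s ∣? f) (∣-∙-cancelˡ p) (λ { (t , refl) → t , ∙-assoc p s t })))))) ⟩
    Sum (below B) (λ s → φ s * 𝟙 (s ∣? f)) ∎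
    where
    open ≡-Reasoning
    expand : ∀ e → deg e < B → shiftBy p φ e ≡ Sum (below B) (λ s → φ s * 𝟙 (e ≟M p ∙ s))
    expand e e<B = cases (p ∣? e)
      where
      cases : Dec (p ∣ e) → _
      cases (no ¬dv) = trans (shiftBy-no p φ e ¬dv) (sym (trans (Sum-cong (below B) (λ s →
        trans (*-congʳ (φ s) (𝟙-no (e ≟M p ∙ s) (λ eq → ¬dv (s , sym eq)))) (ℤ.*-zeroʳ (φ s)))) (Sum-zero (below B))))
      cases (yes (s , refl)) = trans (shiftBy-∙ p φ s) (sym (trans (Sum-single (below B) (below-unique B)
          (∈-below⁺ (ℕ.≤-<-trans (subst (deg s ℕ.≤_) (sym (deg-∙ p s)) (ℕ.m≤n+m (deg s) (deg p))) e<B))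
          (λ t t≢s → trans (*-congʳ (φ t) (𝟙-no (p ∙ s ≟M p ∙ t) (λ eq → t≢s (sym (∙-cancelˡ p eq))))) (ℤ.*-zeroʳ (φ t))))
        (trans (*-congʳ (φ s) (𝟙-yes (p ∙ s ≟M p ∙ s) refl)) (ℤ.*-identityʳ (φ s)))))

  -- Inclusion-exclusion, one irreducible at a time. If l does not divide f the shifted sum is 0. If
  -- f = l s it equals the sum for s, and since l s and s have the same divisors in the rest of the
  -- list, the difference is 0.
  mobius-sum : ∀ {L} → All Irr L → Unique L → ∀ B f → deg f < B →
    Sum (below B) (λ e → mobius L e * 𝟙 (e ∣? f)) ≡ 𝟙 (coprime? L f)
  mobius-sum {[]} _ _ B f lt = trans (Sum-divisor-delta B f lt ε) (trans (𝟙-yes (ε ∣? f) (ε∣ f)) (sym (𝟙-yes (coprime? [] f) [])))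
  mobius-sum {l ∷ L} (il ∷ iL) (l∉ ∷ u) B f lt = begin
    Sum (below B) (λ e → (mobius L e - shiftBy l (mobius L) e) * 𝟙 (e ∣? f))
      ≡⟨ Sum-cong (below B) (λ e → trans (ℤ.*-distribʳ-+ (𝟙 (e ∣? f)) (mobius L e) (ℤ.- shiftBy l (mobius L) e))
           (+-congʳ (mobius L e * 𝟙 (e ∣? f)) (sym (ℤ.neg-distribˡ-* (shiftBy l (mobius L) e) (𝟙 (e ∣? f)))))) ⟩
    Sum (below B) (λ e → mobius L e * 𝟙 (e ∣? f) - shiftBy l (mobius L) e * 𝟙 (e ∣? f))
      ≡⟨ Sum-minus (below B) _ _ ⟩
    Sum (below B) (λ e → mobius L e * 𝟙 (e ∣? f)) - shifted
      ≡⟨ cong (_- shifted) (mobius-sum iL u B f lt) ⟩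
    𝟙 (coprime? L f) - shifted
      ≡⟨ cases (l ∣? f) ⟩
    𝟙 (coprime? (l ∷ L) f) ∎
    where
    open ≡-Reasoning
    shifted : ℤ
    shifted = Sum (below B) (λ e → shiftBy l (mobius L) e * 𝟙 (e ∣? f))
    cases : Dec (l ∣ f) → 𝟙 (coprime? L f) - shifted ≡ 𝟙 (coprime? (l ∷ L) f)
    cases (no ¬dv) = trans (cong₂ _-_ (𝟙-⇔ (coprime? L f) (coprime? (l ∷ L) f) (¬dv ∷_) (λ { (_ ∷ c) → c }))
        (trans (Sum-cong (below B) (λ e → zero-term e (e ∣? f))) (Sum-zero (below B)))) (ℤ.+-identityʳ _)
      where
      zero-term : ∀ e (d : Dec (e ∣ f)) → shiftBy l (mobius L) e * 𝟙 d ≡ 0ℤ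
      zero-term e (no _)    = ℤ.*-zeroʳ (shiftBy l (mobius L) e)
      zero-term e (yes e∣f) = cong (_* 1ℤ) (shiftBy-no l (mobius L) e (λ l∣e → ¬dv (∣-trans l∣e e∣f)))
    cases (yes (s , refl)) = trans (cong₂ _-_ (𝟙-⇔ (coprime? L f) (coprime? L s) (All.map (λ ¬d d → ¬d (∣-∙ˡ l d)))
        (λ c → All.tabulate (λ {p} i p∣f → All.lookup c i (euclid′ (All.lookup iL i) il (λ e → All.lookup l∉ i (sym e)) s p∣f))))
        (trans (shiftBy-sum B l (mobius L) s lt) (mobius-sum iL u B s (ℕ.≤-<-trans (subst (deg s ℕ.≤_) (sym (deg-∙ l s)) (ℕ.m≤n+m (deg s) (deg l))) lt))))
      (trans (ℤ.+-inverseʳ (𝟙 (coprime? L s))) (sym (𝟙-no (coprime? (l ∷ L) (l ∙ s)) (λ { (¬d ∷ _) → ¬d (s , refl) }))))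

  pow : M → ℕ → M
  pow p zero    = ε
  pow p (suc k) = p ∙ pow p k

  deg-pow : ∀ p k → deg (pow p k) ≡ k ℕ.* deg p
  deg-pow p zero    = refl
  deg-pow p (suc k) = trans (deg-∙ p (pow p k)) (cong (deg p ℕ.+_) (deg-pow p k))

  pow-coprime : ∀ {p p′} → Irr p → Irr p′ → p ≢ p′ → ∀ k f → pow p k ∣ p′ ∙ f → pow p k ∣ f
  pow-coprime ip ip′ ne zero    f dv = ε∣ f
  pow-coprime {p} {p′} ip ip′ ne (suc k) f (s , eq) = step (euclid′ ip ip′ ne f (pow p k ∙ s , trans (sym (∙-assoc p (pow p k) s)) eq))
    where
    step : p ∣ f → p ∙ pow p k ∣ f
    step (t , refl) = lift (pow-coprime ip ip′ ne k t (s , ∙-cancelˡ p (begin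
      p ∙ (pow p k ∙ s)  ≡⟨ ∙-assoc p (pow p k) s ⟨
      p ∙ pow p k ∙ s    ≡⟨ eq ⟩
      p′ ∙ (p ∙ t)       ≡⟨ ∙-assoc p′ p t ⟨
      p′ ∙ p ∙ t         ≡⟨ cong (_∙ t) (∙-comm p′ p) ⟩
      p ∙ p′ ∙ t         ≡⟨ ∙-assoc p p′ t ⟩
      p ∙ (p′ ∙ t) ∎)))
      where
      open ≡-Reasoning
      lift : pow p k ∣ t → p ∙ pow p k ∣ p ∙ t
      lift (r , refl) = r , ∙-assoc p (pow p k) r

  Sum-downFrom-shift : ∀ N (a : ℕ → ℤ) → Sum (downFrom N) a + a N ≡ a 0 + Sum (downFrom N) (λ k → a (suc k))
  Sum-downFrom-shift zero    a = ℤ.+-comm 0ℤ (a 0)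
  Sum-downFrom-shift (suc N) a = begin
    (a N + Sum (downFrom N) a) + a (suc N)
      ≡⟨ cong (_+ a (suc N)) (trans (ℤ.+-comm (a N) _) (Sum-downFrom-shift N a)) ⟩
    (a 0 + Sum (downFrom N) (λ k → a (suc k))) + a (suc N)
      ≡⟨ trans (ℤ.+-assoc (a 0) _ _) (+-congʳ (a 0) (ℤ.+-comm _ (a (suc N)))) ⟩
    a 0 + (a (suc N) + Sum (downFrom N) (λ k → a (suc k))) ∎
    where open ≡-Reasoning

  module _ (N : ℕ) where

    primes : List M
    primes = filter irr? (below N)

    primes-irreducible : All Irr primes
    primes-irreducible = All.tabulate (λ i → proj₂ (∈-filter⁻ irr? {xs = below N} i))

    primes-unique : Unique primes
    primes-unique = Unique.filter⁺ irr? (below-unique N)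

    ∈-primes : ∀ {p} → Irr p → deg p < N → p ∈ primes
    ∈-primes ip lt = ∈-filter⁺ irr? (∈-below⁺ lt) ip

    -- Irreducibles of degree below N are enough for μ * 1 = δ in degrees below N.
    μ : M → ℤ
    μ = mobius primes

    ∣μ∣≤1 : ∀ e → ∣ μ e ∣ ℕ.≤ 1
    ∣μ∣≤1 = mobius-bound primes-irreducible primes-unique

    μ-sum : ∀ B f → deg f < B → deg f < N → Sum (below B) (λ e → μ e * 𝟙 (e ∣? f)) ≡ 𝟙 (f ≟M ε)
    μ-sum B f f<B f<N = trans (mobius-sum primes-irreducible primes-unique B f f<B)
      (𝟙-⇔ (coprime? primes f) (f ≟M ε) (λ c → only-unit c (f ≟M ε))
        (λ { refl → All.tabulate (λ i → ¬∣ε (All.lookup primes-irreducible i)) }))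
      where
      only-unit : All (λ l → ¬ l ∣ f) primes → Dec (f ≡ ε) → f ≡ ε
      only-unit c (yes e)  = e
      only-unit c (no f≢ε) = let p , ip , p∣f = irreducible-factor (suc (deg f)) f ℕ.≤-refl f≢ε in
        ⊥-elim (All.lookup c (∈-primes ip (ℕ.≤-<-trans (∣⇒deg≤ {p} p∣f) f<N)) p∣f)

    -- The von Mangoldt function with deg p for log p. Below degree N the exponents k + 1 ≤ N reach
    -- every prime power.
    Λ : M → ℤ
    Λ g = Sum primes (λ p → Sum (downFrom N) (λ k → + deg p * 𝟙 (g ≟M pow p (suc k))))

    valuation : M → M → ℤ
    valuation p f = Sum (downFrom N) (λ k → 𝟙 (pow p (suc k) ∣? f))

    Λ-divisors : ∀ B f → deg f < B → Sum (below B) (λ g → Λ g * 𝟙 (g ∣? f)) ≡ Sum primes (λ p → + deg p * valuation p f)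
    Λ-divisors B f lt = begin
      Sum (below B) (λ g → Λ g * 𝟙 (g ∣? f))
        ≡⟨ Sum-cong (below B) (λ g → trans (sym (Sum-*ʳ primes (𝟙 (g ∣? f)) _)) (Sum-cong primes (λ p → sym (Sum-*ʳ (downFrom N) (𝟙 (g ∣? f)) _)))) ⟩
      Sum (below B) (λ g → Sum primes (λ p → Sum (downFrom N) (λ k → (+ deg p * 𝟙 (g ≟M pow p (suc k))) * 𝟙 (g ∣? f))))
        ≡⟨ trans (Sum-swap (below B) primes _) (Sum-cong primes (λ p → Sum-swap (below B) (downFrom N) _)) ⟩
      Sum primes (λ p → Sum (downFrom N) (λ k → Sum (below B) (λ g → (+ deg p * 𝟙 (g ≟M pow p (suc k))) * 𝟙 (g ∣? f))))
        ≡⟨ Sum-cong primes (λ p → trans (Sum-cong (downFrom N) (λ k → trans (Sum-cong (below B) (λ g → ℤ.*-assoc (+ deg p) _ _))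
             (trans (Sum-*ˡ (below B) (+ deg p) _) (*-congʳ (+ deg p) (Sum-divisor-delta B f lt (pow p (suc k))))))) (Sum-*ˡ (downFrom N) (+ deg p) _)) ⟩
      Sum primes (λ p → + deg p * valuation p f) ∎
      where open ≡-Reasoning

    valuation-∙ : ∀ {p p₀} → Irr p → Irr p₀ → ∀ f → deg f < N → valuation p (p₀ ∙ f) ≡ valuation p f + 𝟙 (p ≟M p₀)
    valuation-∙ {p} {p₀} ip ip₀ f f<N = cases (p ≟M p₀)
      where
      cases : Dec (p ≡ p₀) → valuation p (p₀ ∙ f) ≡ valuation p f + 𝟙 (p ≟M p₀)
      cases (no ne) = trans (Sum-cong (downFrom N) (λ k → 𝟙-⇔ (pow p (suc k) ∣? p₀ ∙ f) (pow p (suc k) ∣? f) (pow-coprime ip ip₀ ne (suc k) f) (∣-∙ˡ p₀)))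
        (sym (trans (+-congʳ (valuation p f) (𝟙-no (p ≟M p₀) ne)) (ℤ.+-identityʳ _)))
      cases (yes refl) = begin
        Sum (downFrom N) (λ k → 𝟙 (p ∙ pow p k ∣? p ∙ f))
          ≡⟨ Sum-cong (downFrom N) (λ k → 𝟙-⇔ (p ∙ pow p k ∣? p ∙ f) (pow p k ∣? f) (∣-∙-cancelˡ p) (λ { (t , refl) → t , ∙-assoc p (pow p k) t })) ⟩
        Sum (downFrom N) a
          ≡⟨ trans (sym (ℤ.+-identityʳ _)) (+-congʳ (Sum (downFrom N) a) (sym aN)) ⟩
        Sum (downFrom N) a + a N
          ≡⟨ Sum-downFrom-shift N a ⟩
        a 0 + valuation p f
          ≡⟨ trans (cong₂ _+_ (trans (𝟙-yes (ε ∣? f) (ε∣ f)) (sym (𝟙-yes (p ≟M p) refl))) refl) (ℤ.+-comm (𝟙 (p ≟M p)) (valuation p f)) ⟩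
        valuation p f + 𝟙 (p ≟M p) ∎
        where
        open ≡-Reasoning
        a : ℕ → ℤ
        a k = 𝟙 (pow p k ∣? f)
        -- p^(k+1) divides p f exactly if p^k divides f, so the count is shifted by one place.
        -- Nothing is lost at the cut-off, as p^N has degree at least N > deg f.
        aN : a N ≡ 0ℤ
        aN = 𝟙-no (pow p N ∣? f) (λ dv → ℕ.<-irrefl refl (ℕ.<-≤-trans f<N (ℕ.≤-trans
          (subst (N ℕ.≤_) (sym (deg-pow p N)) (subst (ℕ._≤ N ℕ.* deg p) (ℕ.*-identityʳ N) (ℕ.*-monoʳ-≤ N (deg≥1 (proj₁ ip))))) (∣⇒deg≤ {pow p N} dv))))

    -- The content of unique factorisation in terms of degrees: splitting off an irreducible p₀
    -- raises both sides by deg p₀.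
    valuations : ∀ B f → deg f < B → deg f < N → Sum primes (λ p → + deg p * valuation p f) ≡ + deg f
    valuations (suc B) f (s≤s f≤B) f<N = cases (f ≟M ε)
      where
      open ≡-Reasoning
      cases : Dec (f ≡ ε) → Sum primes (λ p → + deg p * valuation p f) ≡ + deg f
      cases (yes refl) = trans (Sum-cong∈ primes (λ {p} i → trans (*-congʳ (+ deg p) (trans (Sum-cong (downFrom N) (λ k →
          𝟙-no (pow p (suc k) ∣? ε) (λ { (s , eq) → ¬∣ε (All.lookup primes-irreducible i) (pow p k ∙ s , trans (sym (∙-assoc p (pow p k) s)) eq) })))
          (Sum-zero (downFrom N)))) (ℤ.*-zeroʳ (+ deg p)))) (Sum-zero primes)
      cases (no f≢ε) = peel (irreducible-factor (suc (deg f)) f ℕ.≤-refl f≢ε)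
        where
        peel : (∃ λ p → Irr p × p ∣ f) → _
        peel (p₀ , ip₀ , f′ , refl) = begin
          Sum primes (λ p → + deg p * valuation p (p₀ ∙ f′))
            ≡⟨ Sum-cong∈ primes (λ {p} i → trans (*-congʳ (+ deg p) (valuation-∙ (All.lookup primes-irreducible i) ip₀ f′ f′<N))
                 (trans (ℤ.*-distribˡ-+ (+ deg p) _ _) (+-congʳ (+ deg p * valuation p f′) (ℤ.*-comm (+ deg p) _)))) ⟩
          Sum primes (λ p → + deg p * valuation p f′ + 𝟙 (p ≟M p₀) * + deg p)
            ≡⟨ Sum-+ primes _ _ ⟩
          Sum primes (λ p → + deg p * valuation p f′) + Sum primes (λ p → 𝟙 (p ≟M p₀) * + deg p)
            ≡⟨ cong₂ _+_ (valuations B f′ (ℕ.<-≤-trans f′<f f≤B) f′<N)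
                 (Sum-delta primes primes-unique _≟M_ (∈-primes ip₀ (ℕ.≤-<-trans (∣⇒deg≤ {p₀} (f′ , refl)) f<N)) (λ p → + deg p)) ⟩
          + deg f′ + + deg p₀
            ≡⟨ trans (sym (ℤ.pos-+ (deg f′) (deg p₀))) (cong +_ (trans (ℕ.+-comm (deg f′) (deg p₀)) (sym (deg-∙ p₀ f′)))) ⟩
          + deg (p₀ ∙ f′) ∎
          where
          f′<f : deg f′ < deg (p₀ ∙ f′)
          f′<f = subst (deg f′ <_) (sym (deg-∙ p₀ f′)) (ℕ.m<n+m (deg f′) (deg≥1 (proj₁ ip₀)))
          f′<N : deg f′ < N
          f′<N = ℕ.<-trans f′<f f<N

    Λ-sum : ∀ B f → deg f < B → deg f < N → Sum (below B) (λ g → Λ g * 𝟙 (g ∣? f)) ≡ + deg f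
    Λ-sum B f f<B f<N = trans (Λ-divisors B f f<B) (valuations (suc (deg f)) f ℕ.≤-refl f<N)

    Λ-term-nonneg : ∀ g p k → 0ℤ ≤ + deg p * 𝟙 (g ≟M pow p (suc k))
    Λ-term-nonneg g p k = *-nonneg (pos-nonneg (deg p)) (𝟙-nonneg (g ≟M pow p (suc k)))

    Λ-inner-nonneg : ∀ g p → 0ℤ ≤ Sum (downFrom N) (λ k → + deg p * 𝟙 (g ≟M pow p (suc k)))
    Λ-inner-nonneg g p = Sum-nonneg (downFrom N) (Λ-term-nonneg g p)

    Λ-nonneg : ∀ g → 0ℤ ≤ Λ g
    Λ-nonneg g = Sum-nonneg primes (Λ-inner-nonneg g)

    -- Λ(g) is one of the nonnegative terms in the sum of Λ over the divisors of g, which is deg g.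
    Λ≤deg : ∀ g → deg g < N → Λ g ≤ + deg g
    Λ≤deg g g<N = ℤ.≤-trans (ℤ.≤-reflexive (sym (trans (*-congʳ (Λ g) (𝟙-yes (g ∣? g) ∣-refl)) (ℤ.*-identityʳ (Λ g)))))
      (ℤ.≤-trans (term≤Sum (below (suc (deg g))) {λ h → Λ h * 𝟙 (h ∣? g)} (λ h → *-nonneg (Λ-nonneg h) (𝟙-nonneg (h ∣? g))) (∈-below⁺ ℕ.≤-refl))
        (ℤ.≤-reflexive (Λ-sum (suc (deg g)) g ℕ.≤-refl g<N)))

    Λ-irreducible : ∀ g → Irr g → deg g < N → Λ g ≡ + deg g
    Λ-irreducible g ig g<N = ℤ.≤-antisym (Λ≤deg g g<N)
      (ℤ.≤-trans (ℤ.≤-reflexive (sym (trans (*-congʳ (+ deg g) (𝟙-yes (g ≟M pow g 1) (sym (∙-identityʳ g)))) (ℤ.*-identityʳ _))))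
      (ℤ.≤-trans (term≤Sum (downFrom N) (Λ-term-nonneg g g) (∈-downFrom⁺ (ℕ.≤-trans (s≤s z≤n) g<N)))
        (term≤Sum primes (Λ-inner-nonneg g) (∈-primes ig g<N))))

    ProperPower : M → Set
    ProperPower g = ∃ λ p → ∃ λ k → k < N × g ≡ pow p (suc k) × 2 ℕ.* deg p ℕ.≤ deg g

    Λ-support : ∀ g → Λ g ≢ 0ℤ → ¬ Irr g → ProperPower g
    Λ-support g Λ≢0 ¬ig with Sum-nonzero primes _ Λ≢0
    ... | p , p∈ , inner≢0 with Sum-nonzero (downFrom N) _ inner≢0
    ... | k , k∈ , term≢0 with g ≟M pow p (suc k)
    ... | no _   = ⊥-elim (term≢0 (ℤ.*-zeroʳ (+ deg p)))
    ... | yes eq = p , k , ∈-downFrom⁻ k∈ , eq , degrees k eq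
      where
      degrees : ∀ k → g ≡ pow p (suc k) → 2 ℕ.* deg p ℕ.≤ deg g
      degrees zero    refl = ⊥-elim (¬ig (subst Irr (sym (∙-identityʳ p)) (All.lookup primes-irreducible p∈)))
      degrees (suc k) refl = subst (2 ℕ.* deg p ℕ.≤_) (sym (deg-pow p (suc (suc k)))) (ℕ.*-monoˡ-≤ (deg p) {2} {suc (suc k)} (s≤s (s≤s z≤n)))

-- Vaughan's identity, sorted by degrees.

module VaughanIdentity (F : FiniteField) where

  open import Data.Integer using (_+_; _*_; _-_; ∣_∣; _≤_)
  open import Data.Integer.Solver using (module +-*-Solver)
  open import Data.List using ([]; _∷_)
  open import Data.Vec using ([]; _∷_)
  open FiniteSums
  open FieldSums F
  open MonicPolynomials F
  open ArithmeticFunctions F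

  Sum-truncate : ∀ n r {P : ℕ → Set} (P? : ∀ d → Dec (P d)) → (∀ {d} → d ℕ.≤ r → P d) → (∀ {d} → P d → d ℕ.≤ r) →
    r ℕ.≤ n → (X : ℕ → ℤ) → Sum (downFrom (suc n)) (λ d → 𝟙 (P? d) * X d) ≡ Sum (downFrom (suc r)) X
  Sum-truncate n r P? in-range range-of r≤n X with ℕ.m≤n⇒m<n∨m≡n r≤n
  ... | inj₂ refl = Sum-cong∈ (downFrom (suc n)) (λ {d} i → trans (cong (_* X d) (𝟙-yes (P? d) (in-range (ℕ.s≤s⁻¹ (∈-downFrom⁻ i))))) (ℤ.*-identityˡ (X d)))
  Sum-truncate (suc n) r P? in-range range-of r≤n X | inj₁ (s≤s r≤n′) = trans
    (cong (_+ Sum (downFrom (suc n)) (λ d → 𝟙 (P? d) * X d)) (cong (_* X (suc n)) (𝟙-no (P? (suc n)) (λ p → ℕ.<-irrefl refl (ℕ.≤-trans (range-of p) r≤n′)))))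
    (trans (ℤ.+-identityˡ _) (Sum-truncate n r P? in-range range-of r≤n′ X))

  ∣Sum∣≤ : {A : Set} (L : List A) (f : A → ℤ) (ρ : ℕ) → (∀ {x} → x ∈ L → ∣ f x ∣ ℕ.≤ ρ) → ∣ Sum L f ∣ ℕ.≤ length L ℕ.* ρ
  ∣Sum∣≤ []      f ρ le = z≤n
  ∣Sum∣≤ (x ∷ L) f ρ le = ℕ.≤-trans (ℤ.∣i+j∣≤∣i∣+∣j∣ (f x) (Sum L f))
    (ℕ.+-mono-≤ (le (Data.List.Relation.Unary.Any.here refl)) (∣Sum∣≤ L f ρ (λ i → le (Data.List.Relation.Unary.Any.there i))))
    where import Data.List.Relation.Unary.Any

  ∣𝟙*∣≤ : ∀ {P : Set} (d : Dec P) X {ρ} → (P → ∣ X ∣ ℕ.≤ ρ) → ∣ 𝟙 d * X ∣ ℕ.≤ ρ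
  ∣𝟙*∣≤ (yes p) X le = subst (λ y → ∣ y ∣ ℕ.≤ _) (sym (ℤ.*-identityˡ X)) (le p)
  ∣𝟙*∣≤ (no _)  X le = z≤n

  ∣1-𝟙*∣≤ : ∀ {P : Set} (d : Dec P) X {ρ} → (¬ P → ∣ X ∣ ℕ.≤ ρ) → ∣ (1ℤ - 𝟙 d) * X ∣ ℕ.≤ ρ
  ∣1-𝟙*∣≤ (yes p) X le = z≤n
  ∣1-𝟙*∣≤ (no ¬p) X le = subst (λ y → ∣ y ∣ ℕ.≤ _) (sym (ℤ.*-identityˡ X)) (le ¬p)

  module Split (D : List ℕ) (χ : ℕ → ℤ) (t : ℕ → ℕ → ℤ) (J : ℕ → ℤ) (column : ∀ {d₂} → d₂ ∈ D → Sum D (λ d₁ → t d₁ d₂) ≡ J d₂) where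

    bilinear linear product : ℤ
    bilinear = Sum D (λ d₁ → Sum D (λ d₂ → χ d₁ * (χ d₂ * t d₁ d₂)))
    linear   = Sum D (λ d₂ → (1ℤ - χ d₂) * J d₂)
    product  = Sum D (λ d₁ → Sum D (λ d₂ → (1ℤ - χ d₁) * ((1ℤ - χ d₂) * t d₁ d₂)))

    -- With x = χ d₁ and y = χ d₂ this rests on x = x y + (1 - y) - (1 - x)(1 - y). In the middle
    -- term d₁ is unrestricted, so the known column sums apply.
    split : Sum D (λ d₁ → χ d₁ * Sum D (t d₁)) ≡ bilinear + linear - product
    split = begin
      Sum D (λ d₁ → χ d₁ * Sum D (t d₁))
        ≡⟨ Sum-cong D (λ d₁ → trans (sym (Sum-*ˡ D (χ d₁) (t d₁))) (trans (Sum-cong D (λ d₂ →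
             solve 3 (λ x y t → x :* t := x :* (y :* t) :+ ((con 1ℤ :- y) :* t :- (con 1ℤ :- x) :* ((con 1ℤ :- y) :* t))) refl (χ d₁) (χ d₂) (t d₁ d₂)))
             (trans (Sum-+ D (λ d₂ → χ d₁ * (χ d₂ * t d₁ d₂)) _) (+-congʳ (Sum D (λ d₂ → χ d₁ * (χ d₂ * t d₁ d₂)))
               (Sum-minus D (λ d₂ → (1ℤ - χ d₂) * t d₁ d₂) (λ d₂ → (1ℤ - χ d₁) * ((1ℤ - χ d₂) * t d₁ d₂))))))) ⟩
      Sum D (λ d₁ → Sum D (λ d₂ → χ d₁ * (χ d₂ * t d₁ d₂)) +
        (Sum D (λ d₂ → (1ℤ - χ d₂) * t d₁ d₂) - Sum D (λ d₂ → (1ℤ - χ d₁) * ((1ℤ - χ d₂) * t d₁ d₂))))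
        ≡⟨ trans (Sum-+ D _ _) (+-congʳ bilinear (Sum-minus D _ _)) ⟩
      bilinear + (Sum D (λ d₁ → Sum D (λ d₂ → (1ℤ - χ d₂) * t d₁ d₂)) - product)
        ≡⟨ cong (λ s → bilinear + (s - product)) (trans (Sum-swap D D _) (Sum-cong∈ D (λ {d₂} i →
             trans (Sum-*ˡ D (1ℤ - χ d₂) (λ d₁ → t d₁ d₂)) (*-congʳ (1ℤ - χ d₂) (column i))))) ⟩
      bilinear + (linear - product)
        ≡⟨ sym (ℤ.+-assoc bilinear linear (ℤ.- product)) ⟩
      bilinear + linear - product ∎
      where
      open ≡-Reasoning
      open +-*-Solver

    split-bound : ∀ {ρ} → (∀ d₁ d₂ → ∣ χ d₁ * (χ d₂ * t d₁ d₂) ∣ ℕ.≤ ρ) → (∀ d₂ → ∣ (1ℤ - χ d₂) * J d₂ ∣ ℕ.≤ ρ) →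
      (∀ d₁ d₂ → ∣ (1ℤ - χ d₁) * ((1ℤ - χ d₂) * t d₁ d₂) ∣ ℕ.≤ ρ) → let N = length D in
      ∣ bilinear + linear - product ∣ ℕ.≤ N ℕ.* (N ℕ.* ρ) ℕ.+ N ℕ.* ρ ℕ.+ N ℕ.* (N ℕ.* ρ)
    split-bound {ρ} II I III = ℕ.≤-trans (ℤ.∣i-j∣≤∣i∣+∣j∣ (bilinear + linear) product)
      (ℕ.+-mono-≤ (ℕ.≤-trans (ℤ.∣i+j∣≤∣i∣+∣j∣ bilinear linear) (ℕ.+-mono-≤
          (∣Sum∣≤ D _ _ (λ {d₁} _ → ∣Sum∣≤ D _ ρ (λ {d₂} _ → II d₁ d₂))) (∣Sum∣≤ D _ ρ (λ {d₂} _ → I d₂))))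
        (∣Sum∣≤ D _ _ (λ {d₁} _ → ∣Sum∣≤ D _ ρ (λ {d₂} _ → III d₁ d₂))))

  -- T d₁ d₂ is the part of Λ * μ * 1 with first factor of degree d₁ and second of degree d₂. Each row sums to the convolution with
  -- μ * 1 = δ, each column to the convolution with Λ * 1 = deg.
  module Vaughan (n : ℕ) (Φ : M → ℤ) where

    N : ℕ
    N = suc n

    T : ℕ → ℕ → ℤ
    T d₁ d₂ = SumM d₁ (λ g → Λ N g * SumM d₂ (λ e → μ N e * SumM (n ∸ d₁ ∸ d₂) (λ k → Φ (g ∙ (e ∙ k)))))

    J : ℕ → ℤ
    J d₂ = + (n ∸ d₂) * SumM d₂ (λ e → μ N e * SumM (n ∸ d₂) (λ f → Φ (e ∙ f)))

    -- For d₁ + d₂ > n truncated subtraction would leave products of degree above n in T; the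
    -- indicator removes them.
    t : ℕ → ℕ → ℤ
    t d₁ d₂ = 𝟙 (d₁ ℕ.+ d₂ ℕ.≤? n) * T d₁ d₂

    ΛΦ : ℤ
    ΛΦ = SumM n (λ g → Λ N g * Φ g)

    row : ∀ d₁ → d₁ ℕ.≤ n → Sum (downFrom N) (t d₁) ≡ SumM d₁ (λ g → Λ N g * SumM (n ∸ d₁) (λ f → 𝟙 (f ≟M ε) * Φ (g ∙ f)))
    row d₁ d₁≤n = begin
      Sum (downFrom N) (t d₁)
        ≡⟨ Sum-truncate n r (λ d → d₁ ℕ.+ d ℕ.≤? n) (λ d≤r → subst (_ ℕ.≤_) (ℕ.m+[n∸m]≡n d₁≤n) (ℕ.+-monoʳ-≤ d₁ d≤r))
             (λ le → subst (ℕ._≤ r) (ℕ.m+n∸m≡n d₁ _) (ℕ.∸-monoˡ-≤ d₁ le)) (ℕ.m∸n≤m n d₁) (T d₁) ⟩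
      Sum (downFrom (suc r)) (T d₁)
        ≡⟨ Sum-swap (downFrom (suc r)) (vecs d₁) _ ⟩
      SumM d₁ (λ g → Sum (downFrom (suc r)) (λ d₂ → Λ N g * SumM d₂ (λ e → μ N e * SumM (r ∸ d₂) (λ k → Φ (g ∙ (e ∙ k))))))
        ≡⟨ Sum-cong (vecs d₁) (λ v → trans (Sum-*ˡ (downFrom (suc r)) (Λ N (d₁ , v)) _) (*-congʳ (Λ N (d₁ , v))
             (trans (convolve (μ N) r (λ f → Φ ((d₁ , v) ∙ f))) (Sum-cong (vecs r) (λ w → cong (_* Φ ((d₁ , v) ∙ (r , w)))
               (μ-sum N (suc r) (r , w) ℕ.≤-refl (s≤s (ℕ.m∸n≤m n d₁)))))))) ⟩
      SumM d₁ (λ g → Λ N g * SumM r (λ f → 𝟙 (f ≟M ε) * Φ (g ∙ f))) ∎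
      where
      open ≡-Reasoning
      r = n ∸ d₁

    row-short : ∀ d₁ → d₁ < n → Sum (downFrom N) (t d₁) ≡ 0ℤ
    row-short d₁ d₁<n = trans (row d₁ (ℕ.<⇒≤ d₁<n)) (trans (Sum-cong (vecs d₁) (λ v → trans (*-congʳ (Λ N (d₁ , v))
        (trans (Sum-cong (vecs (n ∸ d₁)) (λ w → cong (_* Φ ((d₁ , v) ∙ (n ∸ d₁ , w))) (𝟙-no ((n ∸ d₁ , w) ≟M ε) (λ e → ℕ.m>n⇒m∸n≢0 d₁<n (cong deg e)))))
          (Sum-zero (vecs (n ∸ d₁))))) (ℤ.*-zeroʳ (Λ N (d₁ , v))))) (Sum-zero (vecs d₁)))

    row-full : Sum (downFrom N) (t n) ≡ ΛΦ
    row-full = trans (row n ℕ.≤-refl) (Sum-cong (vecs n) (λ v → *-congʳ (Λ N (n , v)) (unit (n ∸ n) (ℕ.n∸n≡0 n) (n , v))))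
      where
      unit : ∀ r → r ≡ 0 → ∀ g → SumM r (λ f → 𝟙 (f ≟M ε) * Φ (g ∙ f)) ≡ Φ g
      unit zero refl g = trans (ℤ.+-identityʳ _) (trans (cong₂ _*_ (𝟙-yes (ε ≟M ε) refl) (cong Φ (∙-identityʳ g))) (ℤ.*-identityˡ (Φ g)))

    column : ∀ d₂ → d₂ ℕ.≤ n → Sum (downFrom N) (λ d₁ → t d₁ d₂) ≡ J d₂
    column d₂ d₂≤n = begin
      Sum (downFrom N) (λ d₁ → t d₁ d₂)
        ≡⟨ Sum-truncate n r (λ d → d ℕ.+ d₂ ℕ.≤? n) (λ d≤r → subst (_ ℕ.≤_) (ℕ.m∸n+n≡m d₂≤n) (ℕ.+-monoˡ-≤ d₂ d≤r))
             (λ le → subst (ℕ._≤ r) (ℕ.m+n∸n≡m _ d₂) (ℕ.∸-monoˡ-≤ d₂ le)) (ℕ.m∸n≤m n d₂) (λ d₁ → T d₁ d₂) ⟩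
      Sum (downFrom (suc r)) (λ d₁ → T d₁ d₂)
        ≡⟨ Sum-cong (downFrom (suc r)) (λ d₁ → reorder d₁) ⟩
      Sum (downFrom (suc r)) (λ d₁ → SumM d₂ (λ e → μ N e * SumM d₁ (λ g → Λ N g * SumM (r ∸ d₁) (λ k → Φ (e ∙ (g ∙ k))))))
        ≡⟨ Sum-swap (downFrom (suc r)) (vecs d₂) _ ⟩
      SumM d₂ (λ e → Sum (downFrom (suc r)) (λ d₁ → μ N e * SumM d₁ (λ g → Λ N g * SumM (r ∸ d₁) (λ k → Φ (e ∙ (g ∙ k))))))
        ≡⟨ Sum-cong (vecs d₂) (λ v → trans (Sum-*ˡ (downFrom (suc r)) (μ N (d₂ , v)) _) (*-congʳ (μ N (d₂ , v))
             (trans (convolve (Λ N) r (λ f → Φ ((d₂ , v) ∙ f))) (trans (Sum-cong (vecs r) (λ w → cong (_* Φ ((d₂ , v) ∙ (r , w)))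
               (Λ-sum N (suc r) (r , w) ℕ.≤-refl (s≤s (ℕ.m∸n≤m n d₂))))) (Sum-*ˡ (vecs r) (+ r) _))))) ⟩
      SumM d₂ (λ e → μ N e * (+ r * SumM r (λ f → Φ (e ∙ f))))
        ≡⟨ trans (Sum-cong (vecs d₂) (λ v → solve 3 (λ a b c → a :* (b :* c) := b :* (a :* c)) refl (μ N (d₂ , v)) (+ r) (SumM r (λ f → Φ ((d₂ , v) ∙ f)))))
             (Sum-*ˡ (vecs d₂) (+ r) _) ⟩
      J d₂ ∎
      where
      open ≡-Reasoning
      open +-*-Solver
      r = n ∸ d₂
      codegree : ∀ d₁ → n ∸ d₁ ∸ d₂ ≡ r ∸ d₁
      codegree d₁ = trans (ℕ.∸-+-assoc n d₁ d₂) (trans (cong (n ∸_) (ℕ.+-comm d₁ d₂)) (sym (ℕ.∸-+-assoc n d₂ d₁)))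
      exchange : ∀ g e k → g ∙ (e ∙ k) ≡ e ∙ (g ∙ k)
      exchange g e k = trans (sym (∙-assoc g e k)) (trans (cong (_∙ k) (∙-comm g e)) (∙-assoc e g k))
      reorder : ∀ d₁ → T d₁ d₂ ≡ SumM d₂ (λ e → μ N e * SumM d₁ (λ g → Λ N g * SumM (r ∸ d₁) (λ k → Φ (e ∙ (g ∙ k)))))
      reorder d₁ = begin
        SumM d₁ (λ g → Λ N g * SumM d₂ (λ e → μ N e * SumM (n ∸ d₁ ∸ d₂) (λ k → Φ (g ∙ (e ∙ k)))))
          ≡⟨ Sum-cong (vecs d₁) (λ v → trans (sym (Sum-*ˡ (vecs d₂) (Λ N (d₁ , v)) _)) (Sum-cong (vecs d₂) (λ w →
               trans (cong (λ s → Λ N (d₁ , v) * (μ N (d₂ , w) * s)) (trans (cong (λ s → SumM s (λ k → Φ ((d₁ , v) ∙ ((d₂ , w) ∙ k)))) (codegree d₁))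
                 (Sum-cong (vecs (r ∸ d₁)) (λ u → cong Φ (exchange (d₁ , v) (d₂ , w) (r ∸ d₁ , u))))))
               (solve 3 (λ a b c → a :* (b :* c) := b :* (a :* c)) refl (Λ N (d₁ , v)) (μ N (d₂ , w)) (SumM (r ∸ d₁) (λ k → Φ ((d₂ , w) ∙ ((d₁ , v) ∙ k)))))))) ⟩
        SumM d₁ (λ g → SumM d₂ (λ e → μ N e * (Λ N g * SumM (r ∸ d₁) (λ k → Φ (e ∙ (g ∙ k))))))
          ≡⟨ trans (Sum-swap (vecs d₁) (vecs d₂) _) (Sum-cong (vecs d₂) (λ w → Sum-*ˡ (vecs d₁) (μ N (d₂ , w)) _)) ⟩
        SumM d₂ (λ e → μ N e * SumM d₁ (λ g → Λ N g * SumM (r ∸ d₁) (λ k → Φ (e ∙ (g ∙ k))))) ∎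

    module _ (V : ℕ) (V<n : V < n) where

      large : ∀ d → Dec (V < d)
      large d = V ℕ.<? d

      χ : ℕ → ℤ
      χ d = 𝟙 (large d)

      open Split (downFrom N) χ t J (λ {d₂} i → column d₂ (ℕ.s≤s⁻¹ (∈-downFrom⁻ i)))

      -- All rows but d₁ = n vanish, and V < n puts this row among the large ones, so discarding the
      -- small d₁ leaves the total unchanged.
      vaughan : ΛΦ ≡ bilinear + linear - product
      vaughan = begin
        ΛΦ
          ≡⟨ trans (sym row-full) (sym (ℤ.*-identityˡ _)) ⟩
        1ℤ * Sum (downFrom N) (t n)
          ≡⟨ trans (sym (ℤ.+-identityʳ _)) (cong₂ _+_ (cong (_* Sum (downFrom N) (t n)) (sym (𝟙-yes (large n) V<n)))
               (sym (trans (Sum-cong∈ (downFrom n) (λ {d} i → trans (*-congʳ (χ d) (row-short d (∈-downFrom⁻ i))) (ℤ.*-zeroʳ (χ d)))) (Sum-zero (downFrom n))))) ⟩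
        Sum (downFrom N) (λ d₁ → χ d₁ * Sum (downFrom N) (t d₁))
          ≡⟨ split ⟩
        bilinear + linear - product ∎
        where open ≡-Reasoning

      vaughan-bound : ∀ ρ →
        (∀ d₁ d₂ → V < d₁ → V < d₂ → d₁ ℕ.+ d₂ ℕ.≤ n → ∣ T d₁ d₂ ∣ ℕ.≤ ρ) →
        (∀ d₂ → d₂ ℕ.≤ V → ∣ J d₂ ∣ ℕ.≤ ρ) →
        (∀ d₁ d₂ → d₁ ℕ.≤ V → d₂ ℕ.≤ V → d₁ ℕ.+ d₂ ℕ.≤ n → ∣ T d₁ d₂ ∣ ℕ.≤ ρ) →
        ∣ ΛΦ ∣ ℕ.≤ N ℕ.* (N ℕ.* ρ) ℕ.+ N ℕ.* ρ ℕ.+ N ℕ.* (N ℕ.* ρ)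
      vaughan-bound ρ II I III = subst₂ (λ s l → ∣ s ∣ ℕ.≤ l ℕ.* (l ℕ.* ρ) ℕ.+ l ℕ.* ρ ℕ.+ l ℕ.* (l ℕ.* ρ)) (sym vaughan) (List.length-downFrom N)
        (split-bound {ρ}
          (λ d₁ d₂ → ∣𝟙*∣≤ (large d₁) (χ d₂ * t d₁ d₂) (λ l₁ → ∣𝟙*∣≤ (large d₂) (t d₁ d₂) (λ l₂ → ∣𝟙*∣≤ (d₁ ℕ.+ d₂ ℕ.≤? n) (T d₁ d₂) (II d₁ d₂ l₁ l₂))))
          (λ d₂ → ∣1-𝟙*∣≤ (large d₂) (J d₂) (λ ¬l → I d₂ (ℕ.≮⇒≥ ¬l)))
          (λ d₁ d₂ → ∣1-𝟙*∣≤ (large d₁) ((1ℤ - χ d₂) * t d₁ d₂) (λ ¬l₁ → ∣1-𝟙*∣≤ (large d₂) (t d₁ d₂) (λ ¬l₂ →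
            ∣𝟙*∣≤ (d₁ ℕ.+ d₂ ℕ.≤? n) (T d₁ d₂) (III d₁ d₂ (ℕ.≮⇒≥ ¬l₁) (ℕ.≮⇒≥ ¬l₂))))))

-- Estimates for the pieces and for the sum over irreducibles.

module PrimeSums (F : FiniteField) where

  open import Data.Nat using (_^_)
  open import Data.Nat.DivMod using (_/_; m/n*n≤m; m≡m%n+[m/n]*n; m%n<n; m*n/n≡m; /-monoˡ-≤; m/n≤m)
  open import Data.Nat.Solver using () renaming (module +-*-Solver to ℕS)
  open import Data.Integer using (_+_; _*_; _-_; ∣_∣; _≤_)
  open import Data.Integer.Solver using () renaming (module +-*-Solver to ℤS)
  open import Data.List using ([])
  open import Data.Vec using ([])
  open FiniteSums
  open FieldSums F
  open PowerSeries F
  open PalindromicPairs F using (R; R-bound)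
  open LinearForms F
  open BilinearForms F
  open MonicPolynomials F
  open ArithmeticFunctions F
  open VaughanIdentity F

  length-level : ∀ d → length (level d) ≡ q ^ d
  length-level d = trans (List.length-map {B = M} (d ,_) (vecs d)) (vecs-length d)

  mul≤ : ∀ {x y a b} → 0ℤ ≤ x → x ≤ + a → y ≤ + b → x * y ≤ + (a ℕ.* b)
  mul≤ {a = a} {b} 0≤x x≤a y≤b = ℤ.≤-trans (*-mono-nonneg 0≤x y≤b)
    (ℤ.≤-trans (*-mono₂-nonneg (pos-nonneg b) (pos-nonneg a) x≤a ℤ.≤-refl) (ℤ.≤-reflexive (sym (ℤ.pos-* a b))))

  -- Opening the square and summing over h leaves the coincidences p x = p y, with weights of
  -- absolute value at most 1.
  square-collect : {X : Set} (L : List X) (p : X → M) (c : X → ℤ) (b : ℕ) → (∀ {x} → x ∈ L → deg (p x) ≡ b) → (∀ x → ∣ c x ∣ ℕ.≤ 1) →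
    SumM b (λ h → Sum L (λ x → c x * 𝟙 (h ≟M p x)) * Sum L (λ x → c x * 𝟙 (h ≟M p x)))
    ≤ Sum (cartesianProduct L L) (λ (x , y) → 𝟙 (p x ≟M p y))
  square-collect L p c b degrees c≤1 = begin
    SumM b (λ h → coefficient h * coefficient h)
      ≡⟨ trans (sym (Sum-level b _)) (Sum-cong (level b) (λ h → sym (Sum-product L L (λ x → c x * 𝟙 (h ≟M p x)) (λ y → c y * 𝟙 (h ≟M p y))))) ⟩
    Sum (level b) (λ h → Sum L (λ x → Sum L (λ y → (c x * 𝟙 (h ≟M p x)) * (c y * 𝟙 (h ≟M p y)))))
      ≡⟨ trans (Sum-swap (level b) L _) (Sum-cong L (λ x → Sum-swap (level b) L _)) ⟩
    Sum L (λ x → Sum L (λ y → Sum (level b) (λ h → (c x * 𝟙 (h ≟M p x)) * (c y * 𝟙 (h ≟M p y)))))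
      ≡⟨ Sum-cong∈ L (λ {x} i → Sum-cong L (λ y → collapse x y i)) ⟩
    Sum L (λ x → Sum L (λ y → (c x * c y) * 𝟙 (p x ≟M p y)))
      ≤⟨ Sum-mono L (λ x → Sum-mono L (λ y → bounded x y (p x ≟M p y))) ⟩
    Sum L (λ x → Sum L (λ y → 𝟙 (p x ≟M p y)))
      ≡⟨ Sum-cartesian _,_ L L _ ⟨
    Sum (cartesianProduct L L) (λ (x , y) → 𝟙 (p x ≟M p y)) ∎
    where
    open ℤ.≤-Reasoning
    coefficient : M → ℤ
    coefficient h = Sum L (λ x → c x * 𝟙 (h ≟M p x))
    collapse : ∀ x y → x ∈ L → Sum (level b) (λ h → (c x * 𝟙 (h ≟M p x)) * (c y * 𝟙 (h ≟M p y))) ≡ (c x * c y) * 𝟙 (p x ≟M p y)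
    collapse x y i = trans (Sum-cong (level b) (λ h → ℤS.solve 4 (λ a s b t → (a ℤS.:* s) ℤS.:* (b ℤS.:* t) ℤS.:= s ℤS.:* ((a ℤS.:* b) ℤS.:* t)) refl
        (c x) (𝟙 (h ≟M p x)) (c y) (𝟙 (h ≟M p y))))
      (Sum-delta (level b) (level-unique b) _≟M_ (subst (λ d → p x ∈ level d) (degrees i) (∈-level⁺ (p x))) (λ h → (c x * c y) * 𝟙 (h ≟M p y)))
    abs≤1 : ∀ {z} → ∣ z ∣ ℕ.≤ 1 → z ≤ 1ℤ
    abs≤1 {+ n} le = +≤+ le
    abs≤1 {ℤ.-[1+ n ]} le = ℤ.-≤+
    bounded : ∀ x y (d : Dec (p x ≡ p y)) → (c x * c y) * 𝟙 d ≤ 𝟙 d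
    bounded x y (no _)  = ℤ.≤-reflexive (ℤ.*-zeroʳ (c x * c y))
    bounded x y (yes _) = ℤ.≤-trans (ℤ.≤-reflexive (ℤ.*-identityʳ (c x * c y)))
      (abs≤1 (subst (ℕ._≤ 1) (sym (ℤ.abs-* (c x) (c y))) (ℕ.*-mono-≤ (c≤1 x) (c≤1 y))))

  module Quadruples (d c : ℕ) where

    Quad : Set
    Quad = M × M × M × M

    pairs : List (M × M)
    pairs = cartesianProduct (level d) (level c)

    _≟P_ : (x y : M × M) → Dec (x ≡ y)
    _≟P_ = Product.≡-dec _≟M_ _≟M_

    pairs-unique : Unique pairs
    pairs-unique = Unique.cartesianProduct⁺ (level-unique d) (level-unique c)

    quads : ℕ → List Quad
    quads i with d ∸ i ℕ.≤? c
    ... | yes _ = cartesianProduct (level i) (cartesianProduct (level (d ∸ i)) (cartesianProduct (level (d ∸ i)) (level (c ∸ (d ∸ i)))))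
    ... | no _  = []

    ∈-quads : ∀ {x y z w} i → d ∸ i ℕ.≤ c → deg x ≡ i → deg y ≡ d ∸ i → deg z ≡ d ∸ i → deg w ≡ c ∸ (d ∸ i) → (x , y , z , w) ∈ quads i
    ∈-quads {x} {y} {z} {w} i le ex ey ez ew with d ∸ i ℕ.≤? c
    ... | no nle = ⊥-elim (nle le)
    ... | yes _  = ∈-cartesianProduct⁺ (in-level ex) (∈-cartesianProduct⁺ (in-level ey) (∈-cartesianProduct⁺ (in-level ez) (in-level ew)))
      where
      in-level : ∀ {f e} → deg f ≡ e → f ∈ level e
      in-level {f} eq = subst (λ e → f ∈ level e) eq (∈-level⁺ f)

    -- With j = d - i the degrees of x, y, z, w are i, j, j and c - j. They add up to d + c for
    -- every i, so the count exceeds the diagonal by a factor of at most d + 1.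
    length-quads : ∀ {i} → i ℕ.≤ d → length (quads i) ℕ.≤ q ^ (d ℕ.+ c)
    length-quads {i} i≤d with d ∸ i ℕ.≤? c
    ... | no _   = z≤n
    ... | yes le = ℕ.≤-reflexive (begin
      length (cartesianProduct (level i) _)
        ≡⟨ trans (length-cartesianProductWith _,_ (level i) _) (cong₂ ℕ._*_ (length-level i) (trans (length-cartesianProductWith _,_ (level j) _)
             (cong₂ ℕ._*_ (length-level j) (trans (length-cartesianProductWith _,_ (level j) _) (cong₂ ℕ._*_ (length-level j) (length-level (c ∸ j))))))) ⟩
      q ^ i ℕ.* (q ^ j ℕ.* (q ^ j ℕ.* q ^ (c ∸ j)))
        ≡⟨ trans (cong (q ^ i ℕ.*_) (trans (cong (q ^ j ℕ.*_) (sym (ℕ.^-distribˡ-+-* q j (c ∸ j)))) (sym (ℕ.^-distribˡ-+-* q j _)))) (sym (ℕ.^-distribˡ-+-* q i _)) ⟩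
      q ^ (i ℕ.+ (j ℕ.+ (j ℕ.+ (c ∸ j))))
        ≡⟨ cong (q ^_) (trans (cong (λ s → i ℕ.+ (j ℕ.+ s)) (ℕ.m+[n∸m]≡n le)) (trans (sym (ℕ.+-assoc i j c)) (cong (ℕ._+ c) (ℕ.m+[n∸m]≡n i≤d)))) ⟩
      q ^ (d ℕ.+ c) ∎)
      where
      open ≡-Reasoning
      j = d ∸ i

    toPairs : Quad → (M × M) × (M × M)
    toPairs (x , y , z , w) = (x ∙ y , z ∙ w) , (x ∙ z , y ∙ w)

    cover-quads : ∀ {pq : (M × M) × (M × M)} → pq ∈ cartesianProduct pairs pairs →
      proj₁ (proj₁ pq) ∙ proj₂ (proj₁ pq) ≡ proj₁ (proj₂ pq) ∙ proj₂ (proj₂ pq) →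
      Σ ℕ λ i → i ∈ downFrom (suc d) × Σ Quad λ k → k ∈ quads i × toPairs k ≡ pq
    cover-quads {(e , k) , (e′ , k′)} mem eq = build (refine e k e′ k′ eq)
      where
      m₁ = ∈-cartesianProduct⁻ (level d) (level c) (proj₁ (∈-cartesianProduct⁻ pairs pairs mem))
      m₂ = ∈-cartesianProduct⁻ (level d) (level c) (proj₂ (∈-cartesianProduct⁻ pairs pairs mem))
      build : Refinement e k e′ k′ → _
      build r = deg x , ∈-downFrom⁺ (s≤s (subst (deg x ℕ.≤_) xy (ℕ.m≤m+n (deg x) (deg y)))) , (x , y , z , w) ,
        ∈-quads (deg x) (subst (d ∸ deg x ℕ.≤_) zw (subst (ℕ._≤ deg z ℕ.+ deg w) dz (ℕ.m≤m+n (deg z) (deg w)))) refl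
          (sym (trans (cong (_∸ deg x) (sym xy)) (ℕ.m+n∸m≡n (deg x) (deg y)))) dz
          (sym (trans (cong₂ _∸_ (sym zw) (sym dz)) (ℕ.m+n∸m≡n (deg z) (deg w)))) ,
        cong₂ _,_ (cong₂ _,_ (sym a≡) (sym b≡)) (cong₂ _,_ (sym c≡) (sym d≡))
        where
        open Refinement r
        xy : deg x ℕ.+ deg y ≡ d
        xy = trans (sym (deg-∙ x y)) (trans (cong deg (sym a≡)) (∈-level⁻ (proj₁ m₁)))
        zw : deg z ℕ.+ deg w ≡ c
        zw = trans (sym (deg-∙ z w)) (trans (cong deg (sym b≡)) (∈-level⁻ (proj₂ m₁)))
        xz : deg x ℕ.+ deg z ≡ d
        xz = trans (sym (deg-∙ x z)) (trans (cong deg (sym c≡)) (∈-level⁻ (proj₁ m₂)))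
        dz : deg z ≡ d ∸ deg x
        dz = sym (trans (cong (_∸ deg x) (sym xz)) (ℕ.m+n∸m≡n (deg x) (deg z)))

    quad-count : Sum (cartesianProduct pairs pairs) (λ (x , y) → 𝟙 (proj₁ x ∙ proj₂ x ≟M proj₁ y ∙ proj₂ y)) ≤ + (suc d ℕ.* q ^ (d ℕ.+ c))
    quad-count = ℤ.≤-trans (Sum-cover (cartesianProduct pairs pairs) (Unique.cartesianProduct⁺ pairs-unique pairs-unique)
        (λ (x , y) → proj₁ x ∙ proj₂ x ≟M proj₁ y ∙ proj₂ y) (Product.≡-dec _≟P_ _≟P_) (downFrom (suc d)) (λ _ → Quad) quads (λ _ → toPairs) cover-quads)
      (subst (λ l → Sum (downFrom (suc d)) (λ i → + length (quads i)) ≤ + (l ℕ.* q ^ (d ℕ.+ c))) (List.length-downFrom (suc d))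
        (Sum-bounded (downFrom (suc d)) (λ {i} j → +≤+ (length-quads (ℕ.s≤s⁻¹ (∈-downFrom⁻ j))))))

  module Estimates (2≢0 : 2F ≢ 0F) (m n : ℕ) (C : Seq) (C-deg : Deg< (suc m) C) (C-top : C m ≢ 0F)
    (ℓ : Seq → Carrier) (ℓ-linear : Linear ℓ) (γ : Carrier) where

    open Form 2≢0 m n C C-deg C-top ℓ ℓ-linear γ

    φ : M → ℤ
    φ f = Φ (ser f)

    φ-∙ : ∀ f g → φ (f ∙ g) ≡ Φ (ser f ⊠ ser g)
    φ-∙ f g = cong (λ s → κ (s ⊝ γ)) (Q-cong (ser-∙ f g))

    open Vaughan n φ

    B : ℕ
    B = NumericalBounds.bound N q m n

    -- The common currency of all estimates: linear sums are bounded through x², bilinear ones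
    -- through x⁴ q^s, and both convert into a twentieth power.
    record Small (x : ℤ) : Set where
      constructor small
      field power : ∣ x ∣ ^ 20 ℕ.≤ B

    ∣Λ∣≤N : ∀ g → deg g ℕ.≤ n → ∣ Λ N g ∣ ℕ.≤ N
    ∣Λ∣≤N g le = ℕ.≤-trans (drop (Λ N g) (Λ-nonneg N g) (Λ≤deg N g (s≤s le))) (ℕ.m≤n⇒m≤1+n le)
      where
      drop : ∀ x {k} → 0ℤ ≤ x → x ≤ + k → ∣ x ∣ ℕ.≤ k
      drop (+ x) _ (+≤+ le) = le

    inner : ℕ → M → ℤ
    inner a h = SumM a (λ k → φ (h ∙ k))

    inner-square : ∀ a h → a ℕ.+ deg h ≡ n → inner a h * inner a h ≤ + (q ^ (2 ℕ.+ m ℕ.+ n))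
    inner-square a h a+b≡n = ℤ.≤-trans (subst (λ s → s * s ≤ + q * (+ (q ^ a ℕ.* q) * + (q ^ (m ℕ.+ deg h))))
        (Sum-cong (vecs a) (λ k → sym (φ-∙ h (a , k)))) (TypeI.bound a (deg h) a+b≡n (ser h) (ser-deg h) (proj₂ (ser-exact h))))
      (ℤ.≤-reflexive (trans (*-congʳ (+ q) (sym (ℤ.pos-* (q ^ a ℕ.* q) _))) (trans (sym (ℤ.pos-* q _)) (cong +_ (begin
        q ℕ.* (q ^ a ℕ.* q ℕ.* q ^ (m ℕ.+ deg h))
          ≡⟨ ℕS.solve 3 (λ q u v → q ℕS.:* (u ℕS.:* q ℕS.:* v) ℕS.:= q ℕS.:* (q ℕS.:* (u ℕS.:* v))) refl q (q ^ a) (q ^ (m ℕ.+ deg h)) ⟩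
        q ℕ.* (q ℕ.* (q ^ a ℕ.* q ^ (m ℕ.+ deg h)))
          ≡⟨ cong (λ s → q ℕ.* (q ℕ.* s)) (trans (sym (ℕ.^-distribˡ-+-* q a (m ℕ.+ deg h))) (cong (q ^_)
               (trans (ℕS.solve 3 (λ a m b → a ℕS.:+ (m ℕS.:+ b) ℕS.:= m ℕS.:+ (a ℕS.:+ b)) refl a m (deg h)) (cong (m ℕ.+_) a+b≡n)))) ⟩
        q ^ (2 ℕ.+ m ℕ.+ n) ∎)))))
      where open ≡-Reasoning

    -- Covers both kinds of linear sums: T with small d₁ and d₂, where the rough variable is g e,
    -- and the columns J, where it is e.
    linear-power : ∀ {X : Set} (L : List X) (h : X → M) (c : X → ℤ) a b → a ℕ.+ b ≡ n → 5 ℕ.* b ℕ.≤ 2 ℕ.* n → length L ≡ q ^ b →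
      (∀ x → deg (h x) ≡ b) → (∀ x → ∣ c x ∣ ℕ.≤ N) → Small (Sum L (λ x → c x * inner a (h x)))
    linear-power L h c a b a+b≡n 5b≤2n len degrees c≤N = small (NumericalBounds.typeI-power (s≤s z≤n) size-positive m n b {∣ S ∣} 5b≤2n
      (subst (λ l → ∣ S ∣ ℕ.* ∣ S ∣ ℕ.≤ (l ℕ.* (N ℕ.* N)) ℕ.* (l ℕ.* q ^ (2 ℕ.+ m ℕ.+ n))) len
        (sum-of-squares-bound L c (λ x → inner a (h x)) (λ {x} _ → c≤N x)
          (λ {x} _ → inner-square a (h x) (trans (cong (a ℕ.+_) (degrees x)) a+b≡n)))))
      where S = Sum L (λ x → c x * inner a (h x))

    short-power : ∀ d₁ d₂ → d₁ ℕ.+ d₂ ℕ.≤ n → 5 ℕ.* (d₁ ℕ.+ d₂) ℕ.≤ 2 ℕ.* n → Small (T d₁ d₂)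
    short-power d₁ d₂ le 5b≤2n = subst Small (sym collect)
      (linear-power L (λ (g , e) → (d₁ , g) ∙ (d₂ , e)) (λ (g , e) → Λ N (d₁ , g) * μ N (d₂ , e)) a (d₁ ℕ.+ d₂)
        (trans (cong (ℕ._+ (d₁ ℕ.+ d₂)) (ℕ.∸-+-assoc n d₁ d₂)) (ℕ.m∸n+n≡m le)) 5b≤2n
        (trans (length-cartesianProductWith _,_ (vecs d₁) (vecs d₂)) (trans (cong₂ ℕ._*_ (vecs-length d₁) (vecs-length d₂)) (sym (ℕ.^-distribˡ-+-* q d₁ d₂))))
        (λ (g , e) → deg-∙ (d₁ , g) (d₂ , e))
        (λ (g , e) → subst (ℕ._≤ N) (sym (ℤ.abs-* (Λ N (d₁ , g)) (μ N (d₂ , e))))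
          (subst (∣ Λ N (d₁ , g) ∣ ℕ.* ∣ μ N (d₂ , e) ∣ ℕ.≤_) (ℕ.*-identityʳ N)
            (ℕ.*-mono-≤ (∣Λ∣≤N (d₁ , g) (ℕ.≤-trans (ℕ.m≤m+n d₁ d₂) le)) (∣μ∣≤1 N (d₂ , e))))))
      where
      a = n ∸ d₁ ∸ d₂
      L = cartesianProduct (vecs d₁) (vecs d₂)
      collect : T d₁ d₂ ≡ Sum L (λ (g , e) → (Λ N (d₁ , g) * μ N (d₂ , e)) * inner a ((d₁ , g) ∙ (d₂ , e)))
      collect = sym (trans (Sum-cartesian _,_ (vecs d₁) (vecs d₂) _) (Sum-cong (vecs d₁) (λ g → trans (Sum-cong (vecs d₂) (λ e →
        trans (ℤ.*-assoc (Λ N (d₁ , g)) (μ N (d₂ , e)) _) (cong (λ s → Λ N (d₁ , g) * (μ N (d₂ , e) * s))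
          (Sum-cong (vecs a) (λ k → cong φ (∙-assoc (d₁ , g) (d₂ , e) (a , k)))))))
        (Sum-*ˡ (vecs d₂) (Λ N (d₁ , g)) _))))

    linear-term-power : ∀ d → d ℕ.≤ n → 5 ℕ.* d ℕ.≤ 2 ℕ.* n → Small (J d)
    linear-term-power d d≤n 5d≤2n = subst Small (sym collect)
      (linear-power (vecs d) (d ,_) (λ e → + (n ∸ d) * μ N (d , e)) (n ∸ d) d (ℕ.m∸n+n≡m d≤n) 5d≤2n (vecs-length d) (λ _ → refl)
        (λ e → subst (ℕ._≤ N) (sym (ℤ.abs-* (+ (n ∸ d)) (μ N (d , e)))) (subst ((n ∸ d) ℕ.* ∣ μ N (d , e) ∣ ℕ.≤_) (ℕ.*-identityʳ N)
          (ℕ.*-mono-≤ (ℕ.m≤n⇒m≤1+n (ℕ.m∸n≤m n d)) (∣μ∣≤1 N (d , e))))))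
      where
      collect : J d ≡ SumV d (λ e → (+ (n ∸ d) * μ N (d , e)) * inner (n ∸ d) (d , e))
      collect = trans (sym (Sum-*ˡ (vecs d) (+ (n ∸ d)) _)) (Sum-cong (vecs d) (λ e → sym (ℤ.*-assoc (+ (n ∸ d)) (μ N (d , e)) _)))

    R-uniform : ∀ a → a ℕ.≤ n → R 2≢0 a ≤ + (N ℕ.* N ℕ.* q ^ (3 ℕ.+ a))
    R-uniform a a≤n = ℤ.≤-trans (R-bound 2≢0 a) (+≤+ (ℕ.*-monoˡ-≤ (q ^ (3 ℕ.+ a)) (ℕ.*-mono-≤ (s≤s a≤n) (s≤s a≤n))))

    bilinear-power : ∀ a b → a ℕ.+ b ≡ n → b ℕ.≤ a → ∀ s → s ℕ.≤ b → n ℕ.≤ 5 ℕ.* s → (α : Vec Carrier a → ℤ) (β : Vec Carrier b → ℤ) →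
      SumV a (λ g → α g * α g) ≤ + (N ℕ.* N ℕ.* q ^ a) → SumV b (λ h → β h * β h) ≤ + (N ℕ.* N ℕ.* q ^ b) →
      Small (SumV a (λ g → α g * SumV b (λ h → β h * Φ (monic g ⊠ monic h))))
    bilinear-power a b a+b≡n b≤a s s≤b n≤5s α β α≤ β≤ = small (NumericalBounds.typeII-power size-positive m n s {∣ S α β ∣} n≤5s
      (ℕ.≤-trans (ℕ.*-monoˡ-≤ (q ^ s) (abs-fourth (square-bound {S α β * S α β} {K} fourth)))
        (subst (λ k → K ℕ.* q ^ s ℕ.≤ N ^ 12 ℕ.* q ^ (11 ℕ.+ m ℕ.+ 4 ℕ.* k)) a+b≡n (NumericalBounds.bilinear-constants size-positive N m a b s s≤b))))
      where
      open TypeII a b a+b≡n b≤a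
      Na = N ℕ.* N ℕ.* q ^ a
      Nb = N ℕ.* N ℕ.* q ^ b
      K = (Na ℕ.* Na) ℕ.* ((q ℕ.* q) ℕ.* ((Nb ℕ.* Nb) ℕ.* (q ℕ.* ((N ℕ.* N ℕ.* q ^ (3 ℕ.+ b)) ℕ.* ((N ℕ.* N ℕ.* q ^ (3 ℕ.+ a)) ℕ.* ((q ^ suc a ℕ.* q) ℕ.* q ^ m))))))
      abs-fourth : ∣ S α β * S α β ∣ ℕ.* ∣ S α β * S α β ∣ ℕ.≤ K → (∣ S α β ∣ ℕ.* ∣ S α β ∣) ℕ.* (∣ S α β ∣ ℕ.* ∣ S α β ∣) ℕ.≤ K
      abs-fourth = subst (λ x → x ℕ.* x ℕ.≤ K) (ℤ.abs-* (S α β) (S α β))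
      R-nonneg : ∀ c → 0ℤ ≤ R 2≢0 c
      R-nonneg c = Sum-nonneg (vecs c) (kernel-nonneg c)
      G≤ : G ≤ + ((N ℕ.* N ℕ.* q ^ (3 ℕ.+ b)) ℕ.* ((N ℕ.* N ℕ.* q ^ (3 ℕ.+ a)) ℕ.* ((q ^ suc a ℕ.* q) ℕ.* q ^ m)))
      G≤ = ℤ.≤-trans G-bound (mul≤ (R-nonneg b) (R-uniform b (subst (b ℕ.≤_) a+b≡n (ℕ.m≤n+m b a)))
        (mul≤ (R-nonneg a) (R-uniform a (subst (a ℕ.≤_) a+b≡n (ℕ.m≤m+n a b)))
          (ℤ.≤-trans G₀-bound (ℤ.≤-reflexive (sym (ℤ.pos-* (q ^ suc a ℕ.* q) (q ^ m)))))))
      squares≥0 : ∀ {A : Set} (L : List A) (f : A → ℤ) → 0ℤ ≤ Sum L (λ x → f x * f x)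
      squares≥0 L f = Sum-nonneg L (λ x → square-nonneg (f x))
      fourth : (S α β * S α β) * (S α β * S α β) ≤ + K
      fourth = ℤ.≤-trans (bound α β)
        (mul≤ (square-nonneg (∥α∥ α β)) (mul≤ (squares≥0 (vecs a) α) α≤ α≤)
        (mul≤ (square-nonneg (+ q)) (ℤ.≤-reflexive (sym (ℤ.pos-* q q)))
        (mul≤ (square-nonneg (∥β∥ α β)) (mul≤ (squares≥0 (vecs b) β) β≤ β≤)
        (mul≤ (pos-nonneg q) ℤ.≤-refl G≤))))

    -- `TypeII` expects b ≤ a. Multiplication is commutative, so the variables may be exchanged; the
    -- saving comes from the smaller degree, which is at least s either way.
    bilinear-power-sym : ∀ a b → a ℕ.+ b ≡ n → ∀ s → s ℕ.≤ a → s ℕ.≤ b → n ℕ.≤ 5 ℕ.* s → (α : Vec Carrier a → ℤ) (β : Vec Carrier b → ℤ) →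
      SumV a (λ g → α g * α g) ≤ + (N ℕ.* N ℕ.* q ^ a) → SumV b (λ h → β h * β h) ≤ + (N ℕ.* N ℕ.* q ^ b) →
      Small (SumV a (λ g → α g * SumV b (λ h → β h * Φ (monic g ⊠ monic h))))
    bilinear-power-sym a b a+b≡n s s≤a s≤b n≤5s α β α≤ β≤ with ℕ.≤-total b a
    ... | inj₁ b≤a = bilinear-power a b a+b≡n b≤a s s≤b n≤5s α β α≤ β≤
    ... | inj₂ a≤b = subst Small swap (bilinear-power b a (trans (ℕ.+-comm b a) a+b≡n) a≤b s s≤a n≤5s β α β≤ α≤)
      where
      swap : SumV b (λ h → β h * SumV a (λ g → α g * Φ (monic h ⊠ monic g))) ≡ SumV a (λ g → α g * SumV b (λ h → β h * Φ (monic g ⊠ monic h)))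
      swap = trans (Sum-cong (vecs b) (λ h → sym (Sum-*ˡ (vecs a) (β h) _))) (trans (Sum-swap (vecs b) (vecs a) _) (Sum-cong (vecs a) (λ g →
        trans (Sum-cong (vecs b) (λ h → trans (ℤS.solve 3 (λ x y z → x ℤS.:* (y ℤS.:* z) ℤS.:= y ℤS.:* (x ℤS.:* z)) refl (β h) (α g) (Φ (monic h ⊠ monic g)))
          (cong (λ s → α g * (β h * κ (s ⊝ γ))) (Q-cong (SR.*-comm (monic h) (monic g)))))) (Sum-*ˡ (vecs b) (α g) _))))

    -- e and k are merged into h = e k, with weight the sum of μ(e) over such factorisations and
    -- mean square bounded by `quad-count`. Its degree n - d₁ is at least d₂, so both variables have
    -- degree above V.
    long-power : ∀ V d₁ d₂ → n ℕ.≤ 5 ℕ.* suc V → V < d₁ → V < d₂ → d₁ ℕ.+ d₂ ℕ.≤ n → Small (T d₁ d₂)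
    long-power V d₁ d₂ n≤5s V<d₁ V<d₂ le = subst Small (sym collect)
      (bilinear-power-sym d₁ b (ℕ.m+[n∸m]≡n d₁≤n) (suc V) V<d₁ (ℕ.≤-trans V<d₂ d₂≤b) n≤5s (λ g → Λ N (d₁ , g)) (λ h → β (b , h))
        α≤ (ℤ.≤-trans (square-collect pairs (λ (e , k) → e ∙ k) (λ (e , k) → μ N e) b degrees (λ (e , _) → ∣μ∣≤1 N e)) (ℤ.≤-trans quad-count (+≤+ β≤))))
      where
      b = n ∸ d₁
      d₁≤n : d₁ ℕ.≤ n
      d₁≤n = ℕ.≤-trans (ℕ.m≤m+n d₁ d₂) le
      d₂≤b : d₂ ℕ.≤ b
      d₂≤b = subst (ℕ._≤ b) (ℕ.m+n∸m≡n d₁ d₂) (ℕ.∸-monoˡ-≤ d₁ le)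
      open Quadruples d₂ (b ∸ d₂)
      β : M → ℤ
      β h = Sum pairs (λ (e , k) → μ N e * 𝟙 (h ≟M e ∙ k))
      degrees : ∀ {x} → x ∈ pairs → deg (proj₁ x ∙ proj₂ x) ≡ b
      degrees {e , k} i = let j , l = ∈-cartesianProduct⁻ (level d₂) (level (b ∸ d₂)) i in
        trans (deg-∙ e k) (trans (cong₂ ℕ._+_ (∈-level⁻ j) (∈-level⁻ l)) (ℕ.m+[n∸m]≡n d₂≤b))
      α≤ : SumV d₁ (λ g → Λ N (d₁ , g) * Λ N (d₁ , g)) ≤ + (N ℕ.* N ℕ.* q ^ d₁)
      α≤ = ℤ.≤-trans (Sum-bounded (vecs d₁) (λ {g} _ → abs-bound⇒square {Λ N (d₁ , g)} (∣Λ∣≤N (d₁ , g) d₁≤n)))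
        (ℤ.≤-reflexive (cong +_ (trans (cong (ℕ._* (N ℕ.* N)) (vecs-length d₁)) (ℕ.*-comm (q ^ d₁) (N ℕ.* N)))))
      β≤ : suc d₂ ℕ.* q ^ (d₂ ℕ.+ (b ∸ d₂)) ℕ.≤ N ℕ.* N ℕ.* q ^ b
      β≤ = ℕ.*-mono-≤ (ℕ.≤-trans (s≤s (ℕ.≤-trans d₂≤b (ℕ.m∸n≤m n d₁))) (ℕ.m≤m*n N N)) (ℕ.≤-reflexive (cong (q ^_) (ℕ.m+[n∸m]≡n d₂≤b)))
      collect-inner : ∀ g → SumM d₂ (λ e → μ N e * SumM (b ∸ d₂) (λ k → φ (g ∙ (e ∙ k)))) ≡ SumM b (λ h → β h * Φ (ser g ⊠ ser h))
      collect-inner g = begin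
        SumM d₂ (λ e → μ N e * SumM (b ∸ d₂) (λ k → φ (g ∙ (e ∙ k))))
          ≡⟨ trans (sym (Sum-level d₂ _)) (Sum-cong (level d₂) (λ e → trans (*-congʳ (μ N e) (sym (Sum-level (b ∸ d₂) _))) (sym (Sum-*ˡ (level (b ∸ d₂)) (μ N e) _)))) ⟩
        Sum (level d₂) (λ e → Sum (level (b ∸ d₂)) (λ k → μ N e * φ (g ∙ (e ∙ k))))
          ≡⟨ sym (Sum-cartesian _,_ (level d₂) (level (b ∸ d₂)) _) ⟩
        Sum pairs (λ (e , k) → μ N e * φ (g ∙ (e ∙ k)))
          ≡⟨ Sum-cong∈ pairs (λ {(e , k)} i → *-congʳ (μ N e) (sym (Sum-delta (level b) (level-unique b) _≟M_
               (subst (λ d → e ∙ k ∈ level d) (degrees i) (∈-level⁺ (e ∙ k))) (λ h → φ (g ∙ h))))) ⟩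
        Sum pairs (λ (e , k) → μ N e * Sum (level b) (λ h → 𝟙 (h ≟M e ∙ k) * φ (g ∙ h)))
          ≡⟨ Sum-cong pairs (λ (e , k) → trans (sym (Sum-*ˡ (level b) (μ N e) _)) (Sum-cong (level b) (λ h → sym (ℤ.*-assoc (μ N e) _ _)))) ⟩
        Sum pairs (λ (e , k) → Sum (level b) (λ h → (μ N e * 𝟙 (h ≟M e ∙ k)) * φ (g ∙ h)))
          ≡⟨ trans (Sum-swap pairs (level b) _) (Sum-cong (level b) (λ h → Sum-*ʳ pairs (φ (g ∙ h)) _)) ⟩
        Sum (level b) (λ h → β h * φ (g ∙ h))
          ≡⟨ trans (Sum-level b _) (Sum-cong (vecs b) (λ h → *-congʳ (β (b , h)) (φ-∙ g (b , h)))) ⟩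
        SumM b (λ h → β h * Φ (ser g ⊠ ser h)) ∎
        where open ≡-Reasoning
      collect : T d₁ d₂ ≡ SumV d₁ (λ g → Λ N (d₁ , g) * SumV b (λ h → β (b , h) * Φ (monic g ⊠ monic h)))
      collect = Sum-cong (vecs d₁) (λ g → *-congʳ (Λ N (d₁ , g)) (collect-inner (d₁ , g)))

    ∣φ∣≤q : ∀ f → ∣ φ f ∣ ℕ.≤ q
    ∣φ∣≤q f = ∣κ∣≤q (Q (ser f) ⊝ γ)
      where
      ∣κ∣≤q : ∀ x → ∣ κ x ∣ ℕ.≤ q
      ∣κ∣≤q x with x ≟ 0F
      ... | yes _ = subst (λ s → ∣ s - 1ℤ ∣ ℕ.≤ q) (sym (ℤ.*-identityʳ (+ q))) (below-q q size-positive)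
        where
        below-q : ∀ k → 1 ℕ.≤ k → ∣ + k - 1ℤ ∣ ℕ.≤ k
        below-q (suc k) _ = ℕ.n≤1+n k
      ... | no _  = subst (λ s → ∣ s - 1ℤ ∣ ℕ.≤ q) (sym (ℤ.*-zeroʳ (+ q))) size-positive

    D : ℤ
    D = SumM n (λ f → 𝟙 (irr? f) * φ f)

    Composite : M → Set
    Composite g = Λ N g ≢ 0ℤ × ¬ Irr g

    composite? : ∀ g → Dec (Composite g)
    composite? g = ¬? (Λ N g ℤ.≟ 0ℤ) ×-dec ¬? (irr? g)

    -- These are the proper prime powers p^(k+1), determined by p with deg p ≤ n/2 and an exponent k
    -- < N.
    composite-count : Sum (level n) (λ g → 𝟙 (composite? g)) ≤ + (N ℕ.* N ℕ.* q ^ (n / 2))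
    composite-count = ℤ.≤-trans (Sum-cover (level n) (level-unique n) composite? _≟M_ shapes (λ _ → M) (λ (d , _) → level d) (λ (_ , k) p → pow p (suc k)) cover)
      (ℤ.≤-trans (Sum-bounded shapes (λ {(d , k)} i → +≤+ (subst (ℕ._≤ q ^ (n / 2)) (sym (length-level d))
          (ℕ.^-monoʳ-≤ q {{ℕ.>-nonZero size-positive}} (ℕ.s≤s⁻¹ (∈-downFrom⁻ (proj₁ (∈-cartesianProduct⁻ (downFrom (suc (n / 2))) (downFrom N) i))))))))
        (+≤+ (ℕ.*-monoˡ-≤ (q ^ (n / 2)) (subst (ℕ._≤ N ℕ.* N) (sym (trans (length-cartesianProductWith _,_ (downFrom (suc (n / 2))) (downFrom N))
          (cong₂ ℕ._*_ (List.length-downFrom (suc (n / 2))) (List.length-downFrom N)))) (ℕ.*-monoˡ-≤ N (s≤s (m/n≤m n 2)))))))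
      where
      shapes : List (ℕ × ℕ)
      shapes = cartesianProduct (downFrom (suc (n / 2))) (downFrom N)
      cover : ∀ {g} → g ∈ level n → Composite g → Σ (ℕ × ℕ) λ i → i ∈ shapes × Σ M λ p → p ∈ level (proj₁ i) × pow p (suc (proj₂ i)) ≡ g
      cover {g} g∈ (Λ≢0 , ¬ig) = let p , k , k<N , eq , 2d≤ = Λ-support N g Λ≢0 ¬ig in
        (deg p , k) , ∈-cartesianProduct⁺ (∈-downFrom⁺ (s≤s (subst (ℕ._≤ n / 2) (m*n/n≡m (deg p) 2)
          (/-monoˡ-≤ 2 (subst₂ ℕ._≤_ (ℕ.*-comm 2 (deg p)) (∈-level⁻ g∈) 2d≤))))) (∈-downFrom⁺ k<N) , p , ∈-level⁺ p , sym eq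

    prime-powers : ∣ ΛΦ - + n * D ∣ ℕ.≤ N ℕ.* N ℕ.* q ^ (n / 2) ℕ.* (N ℕ.* q)
    prime-powers = ℤ.drop‿+≤+ (begin
      + ∣ ΛΦ - + n * D ∣
        ≡⟨ cong (λ s → + ∣ s ∣) (trans (cong (ΛΦ -_) (sym (Sum-*ˡ (vecs n) (+ n) _))) (trans (sym (Sum-minus (vecs n) _ _)) (sym (Sum-level n difference)))) ⟩
      + ∣ Sum (level n) difference ∣
        ≤⟨ Sum-abs (level n) difference ⟩
      Sum (level n) (λ g → + ∣ difference g ∣)
        ≤⟨ Sum-mono∈ (level n) (λ {g} i → term g (∈-level⁻ i)) ⟩
      Sum (level n) (λ g → 𝟙 (composite? g) * + (N ℕ.* q))
        ≡⟨ Sum-*ʳ (level n) (+ (N ℕ.* q)) _ ⟩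
      Sum (level n) (λ g → 𝟙 (composite? g)) * + (N ℕ.* q)
        ≤⟨ mul≤ (Sum-nonneg (level n) (λ g → 𝟙-nonneg (composite? g))) composite-count ℤ.≤-refl ⟩
      + (N ℕ.* N ℕ.* q ^ (n / 2) ℕ.* (N ℕ.* q)) ∎)
      where
      open ℤ.≤-Reasoning
      difference : M → ℤ
      difference g = Λ N g * φ g - + n * (𝟙 (irr? g) * φ g)
      vanishes : ∀ g → difference g ≡ 0ℤ → + ∣ difference g ∣ ≤ 𝟙 (composite? g) * + (N ℕ.* q)
      vanishes g eq = ℤ.≤-trans (ℤ.≤-reflexive (cong (λ s → + ∣ s ∣) eq)) (*-nonneg (𝟙-nonneg (composite? g)) (pos-nonneg (N ℕ.* q)))
      term : ∀ g → deg g ≡ n → + ∣ difference g ∣ ≤ 𝟙 (composite? g) * + (N ℕ.* q)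
      term g dg = cases (irr? g) (Λ N g ℤ.≟ 0ℤ)
        where
        cases : Dec (Irr g) → Dec (Λ N g ≡ 0ℤ) → + ∣ difference g ∣ ≤ 𝟙 (composite? g) * + (N ℕ.* q)
        cases (yes ig) _ = vanishes g (trans (cong₂ (λ x y → x * φ g - + n * (y * φ g)) (trans (Λ-irreducible N g ig (s≤s (ℕ.≤-reflexive dg))) (cong +_ dg)) (𝟙-yes (irr? g) ig))
          (ℤS.solve 2 (λ n x → n ℤS.:* x ℤS.:- n ℤS.:* (ℤS.con 1ℤ ℤS.:* x) ℤS.:= ℤS.con 0ℤ) refl (+ n) (φ g)))
        cases (no ¬ig) (yes Λ≡0) = vanishes g (trans (cong₂ (λ x y → x * φ g - + n * (y * φ g)) Λ≡0 (𝟙-no (irr? g) ¬ig))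
          (ℤS.solve 2 (λ n x → ℤS.con 0ℤ ℤS.:* x ℤS.:- n ℤS.:* (ℤS.con 0ℤ ℤS.:* x) ℤS.:= ℤS.con 0ℤ) refl (+ n) (φ g)))
        cases (no ¬ig) (no Λ≢0) = ℤ.≤-trans (+≤+ (subst (ℕ._≤ N ℕ.* q) (sym (trans (cong ∣_∣
            (trans (cong (λ y → Λ N g * φ g - + n * (y * φ g)) (𝟙-no (irr? g) ¬ig))
              (ℤS.solve 3 (λ l n x → l ℤS.:* x ℤS.:- n ℤS.:* (ℤS.con 0ℤ ℤS.:* x) ℤS.:= l ℤS.:* x) refl (Λ N g) (+ n) (φ g)))) (ℤ.abs-* (Λ N g) (φ g))))
            (ℕ.*-mono-≤ (∣Λ∣≤N g (ℕ.≤-reflexive dg)) (∣φ∣≤q g))))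
          (ℤ.≤-reflexive (sym (trans (cong (_* + (N ℕ.* q)) (𝟙-yes (composite? g) (Λ≢0 , ¬ig))) (ℤ.*-identityˡ _))))

    prime-sum-root : 1 ℕ.≤ n → ∀ ρ → (∀ {x} → x ^ 20 ℕ.≤ B → x ℕ.≤ ρ) → ∣ D ∣ ℕ.≤ 4 ℕ.* q ℕ.* N ^ 3 ℕ.* ρ
    prime-sum-root 1≤n ρ largest = begin
      ∣ D ∣
        ≤⟨ ℕ.m≤n*m ∣ D ∣ n {{ℕ.>-nonZero 1≤n}} ⟩
      n ℕ.* ∣ D ∣
        ≤⟨ ℕ.≤-trans nD≤ (ℕ.+-mono-≤ ΛΦ≤ (ℕ.≤-trans prime-powers (ℕ.*-monoˡ-≤ (N ℕ.* q) (ℕ.*-monoʳ-≤ (N ℕ.* N) half≤ρ)))) ⟩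
      N ℕ.* (N ℕ.* ρ) ℕ.+ N ℕ.* ρ ℕ.+ N ℕ.* (N ℕ.* ρ) ℕ.+ N ℕ.* N ℕ.* ρ ℕ.* (N ℕ.* q)
        ≤⟨ ℕ.+-mono-≤ (ℕ.+-mono-≤ (ℕ.+-mono-≤ two one) two) (ℕ.≤-reflexive (ℕS.solve 3 (λ N r q → N ℕS.:* N ℕS.:* r ℕS.:* (N ℕS.:* q) ℕS.:= q ℕS.:* (N ℕS.:^ 3) ℕS.:* r) refl N ρ q)) ⟩
      -- Two double sums, one sum over columns, and the proper prime powers; the last of these is
      -- exactly X and sets the constant.
      X ℕ.+ X ℕ.+ X ℕ.+ X
        ≡⟨ ℕS.solve 3 (λ q N r → let x = q ℕS.:* (N ℕS.:^ 3) ℕS.:* r in x ℕS.:+ x ℕS.:+ x ℕS.:+ x ℕS.:= ℕS.con 4 ℕS.:* q ℕS.:* (N ℕS.:^ 3) ℕS.:* r) refl q N ρ ⟩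
      4 ℕ.* q ℕ.* N ^ 3 ℕ.* ρ ∎
      where
      open ℕ.≤-Reasoning
      -- 5V ≤ n keeps d₁ + d₂ ≤ 2n/5 in the linear sums. In the bilinear ones V < d gives degrees at
      -- least s = V + 1, and n ≤ 5s.
      V : ℕ
      V = n / 5
      5V≤n : 5 ℕ.* V ℕ.≤ n
      5V≤n = subst (ℕ._≤ n) (ℕ.*-comm V 5) (m/n*n≤m n 5)
      V≤n : V ℕ.≤ n
      V≤n = m/n≤m n 5
      V<n : V < n
      V<n = fifth n 1≤n 5V≤n
        where
        fifth : ∀ n {V} → 1 ℕ.≤ n → 5 ℕ.* V ℕ.≤ n → V < n
        fifth n {zero}  1≤n le = 1≤n
        fifth n {suc V} 1≤n le = ℕ.<-≤-trans (ℕ.m<m+n (suc V) {4 ℕ.* suc V} (s≤s z≤n)) le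
      n≤5s : n ℕ.≤ 5 ℕ.* suc V
      n≤5s = begin
        n                          ≡⟨ m≡m%n+[m/n]*n n 5 ⟩
        n ℕ.% 5 ℕ.+ V ℕ.* 5        ≤⟨ ℕ.+-monoˡ-≤ (V ℕ.* 5) (ℕ.<⇒≤ (m%n<n n 5)) ⟩
        suc V ℕ.* 5                ≡⟨ ℕ.*-comm (suc V) 5 ⟩
        5 ℕ.* suc V ∎
      short : ∀ {d₁ d₂} → d₁ ℕ.≤ V → d₂ ℕ.≤ V → 5 ℕ.* (d₁ ℕ.+ d₂) ℕ.≤ 2 ℕ.* n
      short {d₁} {d₂} l₁ l₂ = begin
        5 ℕ.* (d₁ ℕ.+ d₂)          ≤⟨ ℕ.*-monoʳ-≤ 5 (ℕ.+-mono-≤ l₁ l₂) ⟩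
        5 ℕ.* (V ℕ.+ V)            ≡⟨ ℕS.solve 1 (λ v → ℕS.con 5 ℕS.:* (v ℕS.:+ v) ℕS.:= ℕS.con 2 ℕS.:* (ℕS.con 5 ℕS.:* v)) refl V ⟩
        2 ℕ.* (5 ℕ.* V)            ≤⟨ ℕ.*-monoʳ-≤ 2 5V≤n ⟩
        2 ℕ.* n ∎
      ΛΦ≤ : ∣ ΛΦ ∣ ℕ.≤ N ℕ.* (N ℕ.* ρ) ℕ.+ N ℕ.* ρ ℕ.+ N ℕ.* (N ℕ.* ρ)
      ΛΦ≤ = vaughan-bound V V<n ρ
        (λ d₁ d₂ l₁ l₂ le → largest (Small.power (long-power V d₁ d₂ n≤5s l₁ l₂ le)))
        (λ d le → largest (Small.power (linear-term-power d (ℕ.≤-trans le V≤n) (subst (λ k → 5 ℕ.* k ℕ.≤ 2 ℕ.* n) (ℕ.+-identityʳ d) (short le z≤n)))))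
        (λ d₁ d₂ l₁ l₂ le → largest (Small.power (short-power d₁ d₂ le (short l₁ l₂))))
      half≤ρ : q ^ (n / 2) ℕ.≤ ρ
      half≤ρ = largest (NumericalBounds.half-power (s≤s z≤n) size-positive m n)
      nD≤ : n ℕ.* ∣ D ∣ ℕ.≤ ∣ ΛΦ ∣ ℕ.+ ∣ ΛΦ - + n * D ∣
      nD≤ = subst (ℕ._≤ ∣ ΛΦ ∣ ℕ.+ ∣ ΛΦ - + n * D ∣) (trans (cong ∣_∣ (ℤS.solve 2 (λ l d → l ℤS.:- (l ℤS.:- d) ℤS.:= d) refl ΛΦ (+ n * D))) (ℤ.abs-* (+ n) D))
        (ℤ.∣i-j∣≤∣i∣+∣j∣ ΛΦ (ΛΦ - + n * D))
      X = q ℕ.* N ^ 3 ℕ.* ρ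
      one : N ℕ.* ρ ℕ.≤ X
      one = ℕ.*-monoˡ-≤ ρ (begin
        N                  ≤⟨ ℕ.m≤m*n N (N ℕ.* N) ⟩
        N ℕ.* (N ℕ.* N)    ≡⟨ cong (λ k → N ℕ.* (N ℕ.* k)) (ℕ.*-identityʳ N) ⟨
        N ^ 3              ≤⟨ ℕ.m≤n*m (N ^ 3) q {{ℕ.>-nonZero size-positive}} ⟩
        q ℕ.* N ^ 3 ∎)
      two : N ℕ.* (N ℕ.* ρ) ℕ.≤ X
      two = subst (ℕ._≤ X) (ℕ.*-assoc N N ρ) (ℕ.*-monoˡ-≤ ρ (begin
        N ℕ.* N            ≤⟨ ℕ.m≤m*n (N ℕ.* N) N ⟩
        N ℕ.* N ℕ.* N      ≡⟨ ℕS.solve 1 (λ N → N ℕS.:* N ℕS.:* N ℕS.:= N ℕS.:^ 3) refl N ⟩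
        N ^ 3              ≤⟨ ℕ.m≤n*m (N ^ 3) q {{ℕ.>-nonZero size-positive}} ⟩
        q ℕ.* N ^ 3 ∎))

    prime-sum : 1 ℕ.≤ n → ∣ D ∣ ^ 20 ℕ.≤ (4 ℕ.* q ℕ.* N ^ 3) ^ 20 ℕ.* B
    prime-sum 1≤n = let ρ , ρ≤ , largest = NumericalBounds.root 19 B in begin
      ∣ D ∣ ^ 20                              ≤⟨ ℕ.^-monoˡ-≤ 20 (prime-sum-root 1≤n ρ (λ {x} → largest x)) ⟩
      (4 ℕ.* q ℕ.* N ^ 3 ℕ.* ρ) ^ 20          ≡⟨ NumericalBounds.^-distribʳ 20 (4 ℕ.* q ℕ.* N ^ 3) ρ ⟩
      (4 ℕ.* q ℕ.* N ^ 3) ^ 20 ℕ.* ρ ^ 20     ≤⟨ ℕ.*-monoʳ-≤ ((4 ℕ.* q ℕ.* N ^ 3) ^ 20) ρ≤ ⟩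
      (4 ℕ.* q ℕ.* N ^ 3) ^ 20 ℕ.* B ∎
      where open ℕ.≤-Reasoning

-- Translation to the coefficients, enumerations and sums of the statement.

module Conclusion (F : FiniteField) where

  open import Data.Nat using (_^_; _≤_)
  open import Data.Integer using (_+_; _*_; _-_; ∣_∣)
  open import Data.Integer.Solver using () renaming (module +-*-Solver to ℤS)
  open import Data.Fin using (fromℕ<)
  open import Data.Vec using ([]; _∷_)
  open import Function.Bundles using (Equivalence)
  open FiniteSums
  open FieldSums F
  open PowerSeries F
  open LinearForms F
  open BilinearForms F
  open MonicPolynomials F

  sumFrom-suc : ∀ a k g → sumFrom F (suc a) k g ≡ sumFrom F a k (λ i → g (suc i))
  sumFrom-suc a zero    g = refl
  sumFrom-suc a (suc k) g = cong (g (suc a) ⊕_) (sumFrom-suc (suc a) k g)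

  sumFrom-shift : ∀ j a k g → sumFrom F (j ℕ.+ a) k g ≡ sumFrom F a k (λ i → g (j ℕ.+ i))
  sumFrom-shift zero    a k g = refl
  sumFrom-shift (suc j) a k g = trans (sumFrom-suc (j ℕ.+ a) k g) (sumFrom-shift j a k (λ i → g (suc i)))

  sumFrom-cong : ∀ a k {g h} → (∀ i → i < a ℕ.+ k → g i ≡ h i) → sumFrom F a k g ≡ sumFrom F a k h
  sumFrom-cong a zero    e = refl
  sumFrom-cong a (suc k) e = cong₂ _⊕_ (e a (ℕ.m<m+n a (s≤s z≤n))) (sumFrom-cong (suc a) k (λ i lt → e i (subst (i <_) (sym (ℕ.+-suc a k)) lt)))

  sumFrom-zero : ∀ a k {g} → (∀ i → a ≤ i → g i ≡ 0F) → sumFrom F a k g ≡ 0F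
  sumFrom-zero a zero    z = refl
  sumFrom-zero a (suc k) z = trans (cong₂ _⊕_ (z a ℕ.≤-refl) (sumFrom-zero (suc a) k (λ i le → z i (ℕ.<⇒≤ le)))) (FR.+-identityˡ 0F)

  sumFrom-append : ∀ a k l g → sumFrom F a (k ℕ.+ l) g ≡ sumFrom F a k g ⊕ sumFrom F (a ℕ.+ k) l g
  sumFrom-append a zero    l g = trans (cong (λ b → sumFrom F b l g) (sym (ℕ.+-identityʳ a))) (sym (FR.+-identityˡ _))
  sumFrom-append a (suc k) l g = trans (cong (g a ⊕_) (trans (sumFrom-append (suc a) k l g)
    (cong (λ b → sumFrom F (suc a) k g ⊕ sumFrom F b l g) (sym (ℕ.+-suc a k))))) (sym (FR.+-assoc (g a) _ _))

  ⊠-sum : ∀ p r k → (p ⊠ r) k ≡ sumRange F 0 k (λ i → p i ⊙ r (k ∸ i))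
  ⊠-sum p r zero    = sym (FR.+-identityʳ _)
  ⊠-sum p r (suc k) = cong (p 0 ⊙ r (suc k) ⊕_) (trans (⊠-sum (tail p) r k) (sym (sumFrom-suc 0 (suc k) (λ i → p i ⊙ r (suc k ∸ i)))))

  lookup-seq : ∀ {n} (v : Vec Carrier n) {i} (lt : i < n) → lookup v (fromℕ< lt) ≡ seq v i
  lookup-seq (x ∷ v) {zero}  lt       = refl
  lookup-seq (x ∷ v) {suc i} (s≤s lt) = lookup-seq v lt

  coeff-monic : ∀ {n} (v : Vec Carrier n) i → coeff F v i ≡ monic v i
  coeff-monic {n} v i with ℕ.<-cmp i n
  ... | tri< lt i≢n _ = trans (lookup-seq v lt) (sym (trans (cong (seq v i ⊕_) (X^-other n i i≢n)) (FR.+-identityʳ _)))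
  ... | tri≈ _ refl _ = sym (monic-top v)
  ... | tri> _ _ gt   = sym (Deg<-monic v i gt)

  last-seq : ∀ {m} (c : Vec Carrier (suc m)) → seq c m ≡ last c
  last-seq {zero}  (x ∷ [])    = refl
  last-seq {suc m} (x ∷ y ∷ c) = last-seq (y ∷ c)

  product⇒∙ : ∀ {a b n} (g : Vec Carrier a) (h : Vec Carrier b) (f : Vec Carrier n) → IsProduct F g h f → (a , g) ∙ (b , h) ≡ (n , f)
  product⇒∙ {a} {b} g h f (refl , eq) = ser-injective (≈-trans (ser-∙ (a , g) (b , h)) (mk≈ coefficients))
    where
    coefficients : ∀ k → (monic g ⊠ monic h) k ≡ monic f k
    coefficients k with k ℕ.≤? a ℕ.+ b
    ... | no nle = trans (Deg<-⊠ (suc a) b (Deg<-monic g) (Deg<-monic h) k (ℕ.≰⇒> nle)) (sym (Deg<-monic f k (ℕ.≰⇒> nle)))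
    ... | yes le = trans (⊠-sum (monic g) (monic h) k) (trans
      (sumFrom-cong 0 (suc k) (λ i _ → cong₂ _⊙_ (sym (coeff-monic g i)) (sym (coeff-monic h (k ∸ i))))) (trans (sym (eq k le)) (coeff-monic f k)))

  ∙⇒product : ∀ {a b n} (g : Vec Carrier a) (h : Vec Carrier b) (f : Vec Carrier n) → (a , g) ∙ (b , h) ≡ (n , f) → IsProduct F g h f
  ∙⇒product {a} {b} g h f eq = trans (sym (deg-∙ (a , g) (b , h))) (cong deg eq) , λ k _ → begin
    coeff F f k                                           ≡⟨ coeff-monic f k ⟩
    monic f k                                             ≡⟨ cong (λ u → ser u k) eq ⟨
    ser ((a , g) ∙ (b , h)) k                             ≡⟨ at (ser-∙ (a , g) (b , h)) k ⟩
    (monic g ⊠ monic h) k                                 ≡⟨ ⊠-sum (monic g) (monic h) k ⟩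
    sumRange F 0 k (λ i → monic g i ⊙ monic h (k ∸ i))    ≡⟨ sumFrom-cong 0 (suc k) (λ i _ → cong₂ _⊙_ (coeff-monic g i) (coeff-monic h (k ∸ i))) ⟨
    sumRange F 0 k (λ i → coeff F g i ⊙ coeff F h (k ∸ i)) ∎
    where open ≡-Reasoning

  Irr⇒Irreducible : ∀ {n} (f : Vec Carrier n) → Irr (n , f) → Irreducible F f
  Irr⇒Irreducible {n} f (f≢ε , irr) = deg≥1 f≢ε , λ a b 1≤a 1≤b g h prod → cases 1≤a 1≤b prod (irr (a , g) ((b , h) , product⇒∙ g h f prod))
    where
    cases : ∀ {a b} {g : Vec Carrier a} {h : Vec Carrier b} → 1 ≤ a → 1 ≤ b → IsProduct F g h f → (a , g) ≡ ε ⊎ (a , g) ≡ (n , f) → ⊥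
    cases (s≤s z≤n) 1≤b prod (inj₁ ())
    cases {a} {b} 1≤a 1≤b (a+b≡n , _) (inj₂ refl) = ℕ.<-irrefl (sym a+b≡n) (ℕ.m<m+n a 1≤b)

  Irreducible⇒Irr : ∀ {n} (f : Vec Carrier n) → Irreducible F f → Irr (n , f)
  Irreducible⇒Irr {n} f (1≤n , irr) = (λ e → ℕ.<-irrefl (sym (cong deg e)) 1≤n) , divisors
    where
    divisors : ∀ g → g ∣ (n , f) → g ≡ ε ⊎ g ≡ (n , f)
    divisors (zero  , []) _ = inj₁ refl
    divisors (suc a , g) ((zero  , []) , eq) = inj₂ (trans (sym (∙-identityʳ (suc a , g))) eq)
    divisors (suc a , g) ((suc b , h) , eq)  = ⊥-elim (irr (suc a) (suc b) (s≤s z≤n) (s≤s z≤n) g h (∙⇒product g h f eq))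

  irreducible? : ∀ {n} (f : Vec Carrier n) → Dec (Irreducible F f)
  irreducible? {n} f = map′ (Irr⇒Irreducible f) (Irreducible⇒Irr f) (irr? (n , f))

  enumeration-length : ∀ {n} {P : Vec Carrier n → Set} (P? : ∀ v → Dec (P v)) (L : List (Vec Carrier n)) → Enumerates F L P →
    + length L ≡ SumV n (λ v → 𝟙 (P? v))
  enumeration-length {n} {P} P? L (unique , members) = begin
    + length L
      ≡⟨ trans (sym (ℤ.*-identityʳ (+ length L))) (sym (Sum-const L 1ℤ)) ⟩
    Sum L (λ _ → 1ℤ)
      ≡⟨ Sum-cong L (λ x → sym (trans (Sum-cong (vecs n) (λ v → sym (ℤ.*-identityʳ _))) (Sum-delta (vecs n) (vecs-unique n) _≟V_ (vecs-complete x) (λ _ → 1ℤ)))) ⟩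
    Sum L (λ x → SumV n (λ v → 𝟙 (v ≟V x)))
      ≡⟨ Sum-swap L (vecs n) _ ⟩
    SumV n (λ v → Sum L (λ x → 𝟙 (v ≟V x)))
      ≡⟨ Sum-cong (vecs n) (λ v → count v (P? v)) ⟩
    SumV n (λ v → 𝟙 (P? v)) ∎
    where
    open ≡-Reasoning
    count : ∀ v (d : Dec (P v)) → Sum L (λ x → 𝟙 (v ≟V x)) ≡ 𝟙 d
    count v (yes p) = trans (Sum-single L unique (Equivalence.from (members v) p) (λ x x≢v → 𝟙-no (v ≟V x) (λ e → x≢v (sym e)))) (𝟙-yes (v ≟V v) refl)
    count v (no ¬p) = trans (Sum-cong∈ L (λ {x} i → 𝟙-no (v ≟V x) (λ { refl → ¬p (Equivalence.to (members v) i) }))) (Sum-zero L)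

  ∣⊖∣ : ∀ m n → ∣ m ⊖ n ∣ ≡ ℕ.∣ m - n ∣
  ∣⊖∣ zero    zero    = refl
  ∣⊖∣ zero    (suc n) = refl
  ∣⊖∣ (suc m) zero    = refl
  ∣⊖∣ (suc m) (suc n) = trans (cong ∣_∣ (ℤ.[1+m]⊖[1+n]≡m⊖n m n)) (∣⊖∣ m n)

  ∣pos-pos∣ : ∀ m n → ∣ + m - + n ∣ ≡ ℕ.∣ m - n ∣
  ∣pos-pos∣ m n = trans (cong ∣_∣ (ℤ.[+m]-[+n]≡m⊖n m n)) (∣⊖∣ m n)

  -- The coefficient lookup is local to `QA`; the existential lets unification name it, so that it
  -- can be compared with `seq`.
  QA-unfold : ∀ m (c : Vec Carrier (suc m)) n (a : Vec Carrier (suc n)) (f : Vec Carrier n) → Σ (ℕ → Carrier) λ cs → Σ (ℕ → Carrier) λ as →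
    QA F m c n a f ≡ sumRange F 0 m (λ j → cs j ⊙ sumRange F j n (λ i → coeff F f i ⊙ coeff F f (i ∸ j))) ⊕ sumRange F 0 n (λ i → as i ⊙ coeff F f i)
  QA-unfold m c n a f = _ , _ , refl

  QA-c : ∀ m c n a f i → proj₁ (QA-unfold m c n a f) i ≡ seq c i
  QA-c m c n a f i with ℕ.<-cmp i (suc m)
  ... | tri< lt _ _   = lookup-seq c lt
  ... | tri≈ _ refl _ = sym (Deg<-seq c (suc m) ℕ.≤-refl)
  ... | tri> _ _ gt   = sym (Deg<-seq c i (ℕ.<⇒≤ gt))

  QA-a : ∀ m c n a f i → proj₁ (proj₂ (QA-unfold m c n a f)) i ≡ seq a i
  QA-a m c n a f i with ℕ.<-cmp i (suc n)
  ... | tri< lt _ _   = lookup-seq a lt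
  ... | tri≈ _ refl _ = sym (Deg<-seq a (suc n) ℕ.≤-refl)
  ... | tri> _ _ gt   = sym (Deg<-seq a i (ℕ.<⇒≤ gt))

  -- After the shift of i by j the summand is p_i p_(j+i), and p_(j+i) is the coefficient of the
  -- reversal at n - j - i.
  autocorrelation : ∀ n (p : Seq) j → j ≤ n → sumRange F j n (λ i → p i ⊙ p (i ∸ j)) ≡ (p ⊠ rev n p) (n ∸ j)
  autocorrelation n p j j≤n = begin
    sumFrom F j (suc n ∸ j) (λ i → p i ⊙ p (i ∸ j))
      ≡⟨ cong₂ (λ a k → sumFrom F a k (λ i → p i ⊙ p (i ∸ j))) (sym (ℕ.+-identityʳ j)) (ℕ.+-∸-assoc 1 j≤n) ⟩
    sumFrom F (j ℕ.+ 0) (suc r) (λ i → p i ⊙ p (i ∸ j))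
      ≡⟨ sumFrom-shift j 0 (suc r) _ ⟩
    sumFrom F 0 (suc r) (λ i → p (j ℕ.+ i) ⊙ p (j ℕ.+ i ∸ j))
      ≡⟨ sumFrom-cong 0 (suc r) (λ i lt → trans (cong (p (j ℕ.+ i) ⊙_) (cong p (ℕ.m+n∸m≡n j i))) (trans (FR.*-comm _ (p i)) (cong (p i ⊙_) (sym (reversed i (ℕ.s≤s⁻¹ lt)))))) ⟩
    sumFrom F 0 (suc r) (λ i → p i ⊙ rev n p (r ∸ i))
      ≡⟨ ⊠-sum p (rev n p) r ⟨
    (p ⊠ rev n p) r ∎
    where
    open ≡-Reasoning
    r = n ∸ j
    reversed : ∀ i → i ≤ r → rev n p (r ∸ i) ≡ p (j ℕ.+ i)
    reversed i i≤r = trans (cong (λ s → rev s p (r ∸ i)) (sym (begin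
      (r ∸ i) ℕ.+ (j ℕ.+ i)   ≡⟨ cong ((r ∸ i) ℕ.+_) (ℕ.+-comm j i) ⟩
      (r ∸ i) ℕ.+ (i ℕ.+ j)   ≡⟨ ℕ.+-assoc (r ∸ i) i j ⟨
      (r ∸ i) ℕ.+ i ℕ.+ j     ≡⟨ cong (ℕ._+ j) (ℕ.m∸n+n≡m i≤r) ⟩
      r ℕ.+ j                 ≡⟨ ℕ.m∸n+n≡m j≤n ⟩
      n ∎))) (rev-at (r ∸ i) (j ℕ.+ i) p)

  -- Coefficient n of a* f is Σ a_i f_i. In this shape the functional is defined on all series, with
  -- linearity inherited from `⊠-linear`.
  linearForm : ∀ {n} → Vec Carrier (suc n) → Seq → Carrier
  linearForm {n} a f = (rev n (seq a) ⊠ f) n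

  linearForm-linear : ∀ {n} (a : Vec Carrier (suc n)) → Linear (linearForm a)
  linearForm-linear {n} a = ⊠-linear (rev n (seq a)) (coefficient-linear n)

  linearForm-sum : ∀ {n} (a : Vec Carrier (suc n)) p → sumRange F 0 n (λ i → seq a i ⊙ p i) ≡ linearForm a p
  linearForm-sum {n} a p = sym (trans (at (SR.*-comm (rev n (seq a)) p) n) (trans (⊠-sum p (rev n (seq a)) n)
    (sumFrom-cong 0 (suc n) (λ i lt → trans (cong (p i ⊙_) (trans (cong (λ s → rev s (seq a) (n ∸ i)) (sym (ℕ.m∸n+n≡m (ℕ.s≤s⁻¹ lt)))) (rev-at (n ∸ i) i (seq a)))) (FR.*-comm _ _)))))

  QA-form : ∀ m (c : Vec Carrier (suc m)) n → m ≤ n → (a : Vec Carrier (suc n)) (f : Vec Carrier n) →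
    QA F m c n a f ≡ (seq c ⊠ (monic f ⊠ rev n (monic f))) n ⊕ linearForm a (monic f)
  QA-form m c n m≤n a f = trans (proj₂ (proj₂ (QA-unfold m c n a f))) (cong₂ _⊕_ quadratic
      (trans (sumFrom-cong 0 (suc n) (λ i _ → cong₂ _⊙_ (QA-a m c n a f i) (coeff-monic f i))) (linearForm-sum a (monic f))))
    where
    open ≡-Reasoning
    cs = proj₁ (QA-unfold m c n a f)
    sq = monic f ⊠ rev n (monic f)
    correlation : ∀ j → j ≤ n → sumRange F j n (λ i → coeff F f i ⊙ coeff F f (i ∸ j)) ≡ sq (n ∸ j)
    correlation j j≤n = trans (sumFrom-cong j (suc n ∸ j) (λ i _ → cong₂ _⊙_ (coeff-monic f i) (coeff-monic f (i ∸ j)))) (autocorrelation n (monic f) j j≤n)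
    quadratic : sumRange F 0 m (λ j → cs j ⊙ sumRange F j n (λ i → coeff F f i ⊙ coeff F f (i ∸ j))) ≡ (seq c ⊠ sq) n
    quadratic = begin
      sumFrom F 0 (suc m) (λ j → cs j ⊙ sumRange F j n (λ i → coeff F f i ⊙ coeff F f (i ∸ j)))
        ≡⟨ sumFrom-cong 0 (suc m) (λ j lt → cong₂ _⊙_ (QA-c m c n a f j) (correlation j (ℕ.≤-trans (ℕ.s≤s⁻¹ lt) m≤n))) ⟩
      sumFrom F 0 (suc m) (λ j → seq c j ⊙ sq (n ∸ j))
        -- The lags from m + 1 to n are supplied with weight 0, which completes the convolution sum.
        ≡⟨ trans (sym (FR.+-identityʳ _)) (cong (sumFrom F 0 (suc m) (λ j → seq c j ⊙ sq (n ∸ j)) ⊕_)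
             (sym (sumFrom-zero (suc m) (n ∸ m) (λ j le → trans (cong (_⊙ sq (n ∸ j)) (Deg<-seq c j le)) (FR.zeroˡ _))))) ⟩
      sumFrom F 0 (suc m) (λ j → seq c j ⊙ sq (n ∸ j)) ⊕ sumFrom F (suc m) (n ∸ m) (λ j → seq c j ⊙ sq (n ∸ j))
        ≡⟨ sumFrom-append 0 (suc m) (n ∸ m) _ ⟨
      sumFrom F 0 (suc m ℕ.+ (n ∸ m)) (λ j → seq c j ⊙ sq (n ∸ j))
        ≡⟨ cong (λ k → sumFrom F 0 (suc k) (λ j → seq c j ⊙ sq (n ∸ j))) (ℕ.m+[n∸m]≡n m≤n) ⟩
      sumFrom F 0 (suc n) (λ j → seq c j ⊙ sq (n ∸ j))
        ≡⟨ ⊠-sum (seq c) sq n ⟨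
      (seq c ⊠ sq) n ∎

  module Final (odd : ∀ k → q ≢ 2 ℕ.* k) (m : ℕ) (c : Vec Carrier (suc m)) (c-top : last c ≢ 0F) (n : ℕ) (m<n : m < n)
    (a : Vec Carrier (suc n)) (γ : Carrier) where

    2≢0 : 2F ≢ 0F
    2≢0 = odd⇒2≢0 odd

    open PrimeSums.Estimates F 2≢0 m n (seq c) (Deg<-seq c) (λ e → c-top (trans (sym (last-seq c)) e)) (linearForm a) (linearForm-linear a) γ
      using (D; φ; prime-sum)

    QA? : ∀ f → Dec (QA F m c n a f ≡ γ)
    QA? f = QA F m c n a f ≟ γ

    discrepancy : ∀ Lγ → Enumerates F Lγ (λ f → Irreducible F {n} f × QA F m c n a f ≡ γ) → ∀ LP → Enumerates F LP (λ f → Irreducible F {n} f) →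
      D ≡ + (q ℕ.* length Lγ) - + length LP
    discrepancy Lγ eγ LP eP = begin
      D
        ≡⟨ Sum-cong (vecs n) term ⟩
      SumV n (λ f → + q * 𝟙 (irreducible? f ×-dec QA? f) - 𝟙 (irreducible? f))
        ≡⟨ trans (Sum-minus (vecs n) _ _) (cong₂ _-_ (Sum-*ˡ (vecs n) (+ q) _) refl) ⟩
      + q * SumV n (λ f → 𝟙 (irreducible? f ×-dec QA? f)) - SumV n (λ f → 𝟙 (irreducible? f))
        ≡⟨ cong₂ _-_ (trans (*-congʳ (+ q) (sym (enumeration-length (λ f → irreducible? f ×-dec QA? f) Lγ eγ))) (sym (ℤ.pos-* q (length Lγ))))
             (sym (enumeration-length irreducible? LP eP)) ⟩
      + (q ℕ.* length Lγ) - + length LP ∎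
      where
      open ≡-Reasoning
      form-zero : ∀ f → 𝟙 ((((seq c ⊠ (monic f ⊠ rev n (monic f))) n ⊕ linearForm a (monic f)) ⊝ γ) ≟ 0F) ≡ 𝟙 (QA? f)
      form-zero f = 𝟙-⇔ _ (QA? f) (λ e → trans form (⊝-zero e)) (λ e → trans (cong (_⊝ γ) (trans (sym form) e)) (⊝-self γ))
        where form = QA-form m c n (ℕ.<⇒≤ m<n) a f
      combine : ∀ {A B : Set} (d : Dec A) (e : Dec B) → 𝟙 d * (+ q * 𝟙 e - 1ℤ) ≡ + q * 𝟙 (d ×-dec e) - 𝟙 d
      combine (yes _) (yes _) = ℤ.*-identityˡ _
      combine (yes _) (no _)  = ℤ.*-identityˡ _
      combine (no _)  e       = sym (cong (_- 0ℤ) (ℤ.*-zeroʳ (+ q)))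
      term : ∀ f → 𝟙 (irr? (n , f)) * φ (n , f) ≡ + q * 𝟙 (irreducible? f ×-dec QA? f) - 𝟙 (irreducible? f)
      term f = trans (cong₂ _*_ (𝟙-⇔ (irr? (n , f)) (irreducible? f) (Irr⇒Irreducible f) (Irreducible⇒Irr f)) (cong (λ i → + q * i - 1ℤ) (form-zero f)))
        (combine (irreducible? f) (QA? f))

    final : ∀ k → 1 ≤ k → ∀ Lγ → Enumerates F Lγ (λ f → Irreducible F {n} f × QA F m c n a f ≡ γ) → ∀ LP → Enumerates F LP (λ f → Irreducible F {n} f) →
      ℕ.∣ q ℕ.* length Lγ - length LP ∣ ^ (20 ℕ.* k) ≤ NumericalBounds.final-constant q m k ℕ.* q ^ (20 ℕ.* k) ℕ.* q ^ ((19 ℕ.* k ℕ.+ 20) ℕ.* n)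
    final (suc k′) _ Lγ eγ LP eP = subst (λ x → x ^ (20 ℕ.* k) ≤ NumericalBounds.final-constant q m k ℕ.* q ^ (20 ℕ.* k) ℕ.* q ^ ((19 ℕ.* k ℕ.+ 20) ℕ.* n))
      (trans (cong ∣_∣ (discrepancy Lγ eγ LP eP)) (∣pos-pos∣ (q ℕ.* length Lγ) (length LP)))
      (NumericalBounds.final-power {suc n} {q} {∣ D ∣} size≥2 m n k (NumericalBounds.power≤exponential (120 ℕ.* k) n) (prime-sum (ℕ.≤-trans (s≤s z≤n) m<n)))
      where k = suc k′

open import Data.Nat using (ℕ; suc; _+_; _*_; _^_; _≤_; ∣_-_∣)
open import Data.Vec using (Vec; last)
open import Data.List using (length)
open import Data.Product using (Σ; _×_; _,_)
open import Relation.Binary.PropositionalEquality using (_≡_; _≢_)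

theorem1p1 : (F : FiniteField) → (∀ k → FiniteField.size F ≢ 2 * k)
  → (m : ℕ) (c : Vec (FiniteField.Carrier F) (suc m)) → last c ≢ FiniteField.0F F
  → (k : ℕ) → 1 ≤ k
  → Σ ℕ λ C → Σ ℕ λ N → ∀ n → N ≤ n
  → (a : Vec (FiniteField.Carrier F) (suc n)) (γ : FiniteField.Carrier F)
  → (Lγ : _) → Enumerates F Lγ (λ f → Irreducible F {n} f × QA F m c n a f ≡ γ)
  → (LP : _) → Enumerates F LP (λ f → Irreducible F {n} f)
  → ∣ FiniteField.size F * length Lγ - length LP ∣ ^ (20 * k)
    ≤ C * FiniteField.size F ^ (20 * k) * FiniteField.size F ^ ((19 * k + 20) * n)
-- n > m ensures that every lag j ≤ m fits into degree n and that n ≥ 1. The constant depends on q,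
-- m and k alone.
theorem1p1 F odd m c c-top k 1≤k = NumericalBounds.final-constant (FiniteField.size F) m k , suc m , λ n m<n a γ Lγ eγ LP eP →
  Conclusion.Final.final F odd m c c-top n m<n a γ k 1≤k Lγ eγ LP eP
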